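{- Let $G$ and $H$ be vertex partitioned arrow presentations, let $e$ be a fixed edge of $H$, and for each edge $f$ of $G$ let $\varphi_f$ be a coupling of $f$ and $e$, with $\boldsymbol\varphi=\{\varphi_f\}_{f\in E(G)}$. Let $\phi_{(=,2)},\phi_{\parallel},\phi_{\times},\phi_{(=,1)}$ be the unique solution of \[\alpha\beta\begin{bmatrix}\alpha\beta&1&1&\alpha\\1&\alpha&1&1\\1&1&\alpha&1\\\alpha&1&1&\alpha\end{bmatrix}\begin{bmatrix}\phi_{(=,2)}\\\phi_{\parallel}\\\phi_{\times}\\\phi_{(=,1)}\end{bmatrix}=\begin{bmatrix}\hat Q(H\setminus e;a,b,c,x,\alpha,\beta)\\\hat Q(H/e;a,b,c,x,\alpha,\beta)\\\hat Q(H\dagger e;a,b,c,x,\alpha,\beta)\\\hat Q(H\setminus_m e;a,b,c,x,\alpha,\beta)\end{bmatrix}.\] Then $\hat Q(G\otimes_{\boldsymbol\varphi}H;a,b,c,x,\alpha,\beta)=\hat Q(G;\phi_{(=,2)},\phi_{\parallel},\phi_{\times},\phi_{(=,1)},\alpha,\beta)$.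
   Context: An arrow presentation $A$ consists of a finite set $V(A)$ of disjoint circles (the vertices), a finite set of pairwise disjoint arrows (directed arcs) on the circles, and a finite set $E(A)$ of labels (the edges) such that every arrow carries one label and every label is carried by exactly two arrows (constituting that edge). An arrow along a circle from $p$ to $q$ is written $\overrightarrow{pq}$. Arrow presentations are considered up to equivalence (diffeomorphism of circles sending arrows to arrows, reversing both arrows of some edges, relabelling edges bijectively). Boundary components: for every edge $e$ with arrows $\overrightarrow{p_1p_2},\overrightarrow{q_1q_2}$, remove the arrows with the interiors of their arcs and add a curve joining $q_2$ to $p_1$ and one joining $p_2$ to $q_1$; the resulting closed curves form $B(A)$. For an edge $e$ with arrows $\overrightarrow{p_1p_2},\overrightarrow{q_1q_2}$: $A\setminus e$ removes the two arrows (not their arcs) and $e$; $A/e$ removes the arrows with the interiors of their arcs, identifies $p_1$ with $q_2$ and $p_2$ with $q_1$, and removes $e$; $A\dagger e$ (Penrose-contraction) does the same but identifies $p_1$ with $q_1$ and $p_2$ with $q_2$. A packaged arrow presentation is $P=(A,\mathcal V,\mathcal B)$ with $\mathcal V$ a partition of $V(A)$, $\mathcal B$ a partition of $B(A)$; $[v]$ is the block containing $v$. For an edge $e$ with incident vertices $u,v$ and incident boundary components $a,b$ (possibly equal): vertices of $A$ and $A\setminus e$ are identified; vertices of $A$ other than $u,v$ are identified with vertices of $A/e$ (resp. $A\dagger e$) and the rest form the set $T$ of created vertices; boundary components of $A$ and $A/e$ are identified; boundary components of $A$ other than $a,b$ are identified with those of $A\setminus e$ (resp. $A\dagger e$) and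 the rest form the set $S$ of created boundary components. Put $\mathcal V'=(\mathcal V-\{[u],[v]\})\cup\{[u]\cup[v]\}$, $\mathcal B'=(\mathcal B-\{[a],[b]\})\cup\{[a]\cup[b]\cup S-\{a,b\}\}$ ($S$ from deletion), $\mathcal V''=(\mathcal V-\{[u],[v]\})\cup\{[u]\cup[v]\cup T-\{u,v\}\}$ ($T$ from contraction), $\mathcal B''=(\mathcal B-\{[a],[b]\})\cup\{[a]\cup[b]\}$, and $\mathcal V''',\mathcal B'''$ defined like $\mathcal V'',\mathcal B'$ with $T,S$ created by the Penrose-contraction. Then $P\setminus e=(A\setminus e,\mathcal V,\mathcal B')$, $P\setminus_m e=(A\setminus e,\mathcal V',\mathcal B')$ (merge-deletion), $P/e=(A/e,\mathcal V'',\mathcal B)$, $P/_m e=(A/e,\mathcal V'',\mathcal B'')$ (merge-contraction), $P\dagger e=(A\dagger e,\mathcal V''',\mathcal B''')$. A coupling of edge $f$ of $P$ and edge $e$ of $H$ is a bijection from the two arrows of $f$ to the two arrows of $e$. 2-sum: with $P=(A,\mathcal V,\mathcal B)$, $H=(A',\mathcal V',\mathcal B')$ and $\varphi$ sending $\overrightarrow{p_1p_2}\mapsto\overrightarrow{q_1q_2}$, $\overrightarrow{p_3p_4}\mapsto\overrightarrow{q_3q_4}$, $A\oplus_\varphi A'$ deletes these four arrows with the interiors of their arcs and identifies $p_i$ with $q_i$ ($i=1,\dots,4$). Let $u$ (resp. $v$) be the vertex of $A$ containing $\overrightarrow{p_1p_2}$ (resp. $\overrightarrow{p_3p_4}$),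 $a$ (resp. $b$) the boundary component containing $p_1,p_4$ (resp. $p_2,p_3$), and $u',v',a',b'$ likewise in $A'$. In $A\oplus_\varphi A'$ let $\alpha_0,\beta_0,\gamma_0,\delta_0$ be the vertices and $h,i,j,k$ the boundary components containing $p_1,p_2,p_3,p_4$ respectively. Then $P\oplus_\varphi H=(A\oplus_\varphi A',\mathcal V^*,\mathcal B^*)$ with $\mathcal V^*=(\mathcal V\cup\mathcal V'-\{[u],[v],[u'],[v']\})\cup\{[u]\cup[u']\cup\{\alpha_0,\beta_0\}-\{u,u'\}\}\cup\{[v]\cup[v']\cup\{\gamma_0,\delta_0\}-\{v,v'\}\}$ and $\mathcal B^*=(\mathcal B\cup\mathcal B'-\{[a],[b],[a'],[b']\})\cup\{[a]\cup[a']\cup\{h,k\}-\{a,a'\}\}\cup\{[b]\cup[b']\cup\{i,j\}-\{b,b'\}\}$. The tensor product $P\otimes_{\boldsymbol\varphi}H$ is obtained from $P$ by taking, for each edge $f$ of $P$, the 2-sum with a distinct copy of $H$ along the coupling of $f$ with the copy of $e$ induced by $\varphi_f$. A vertex partitioned arrow presentation is a pair $(A,\mathcal V)$ with $\mathcal V$ a partition of $V(A)$. It is regarded as the packaged arrow presentation $(A,\mathcal V,\{B(A)\})$ (all boundary components in one block); deletion, contraction, Penrose-contraction, merge-deletion, couplings, 2-sums and tensor products of vertex partitioned arrow presentations are those induced from packaged arrow presentations, forgetting the boundary partition. Polynomials: $Q(P;a,b,c,x,y,\alpha,\beta,\gamma)$ is the unique map on packaged arrow presentations with $Q(P)=aQ(P\setminus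 e)+bQ(P/e)+cQ(P\dagger e)+xQ(P\setminus_m e)+yQ(P/_m e)$ for any edge $e$, and $Q(P)=\alpha^{|V(A)|}\beta^{|\mathcal V|}\gamma^{|\mathcal B|}$ when $A$ has no edges. For a vertex partitioned arrow presentation $G=(A,\mathcal V)$, $\hat Q(G;a,b,c,x,\alpha,\beta)=Q(P;a,b,c,x,0,\alpha,\beta,1)$ where $P$ is any packaged arrow presentation $(A,\mathcal V,\mathcal B)$ (the value is independent of $\mathcal B$). -}

module Defs where

open import Level using (Level; _⊔_)
open import Data.Nat.Base using (ℕ; zero; suc; _≡ᵇ_) renaming (_⊔_ to _⊔ℕ_; _+_ to _+ℕ_)
open import Data.Nat.Properties using (_≟_)
open import Data.Bool.Base using (Bool; true; false; not; if_then_else_; _∧_; _∨_; _xor_)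
open import Data.List.Base using (List; []; _∷_; _++_; map; reverse; length; foldr; foldl; deduplicate; filterᵇ; concatMap; sum)
open import Data.Bool.ListAction using (any)
open import Data.List.Membership.Propositional using (_∈_)
open import Data.Maybe.Base using (Maybe; just; nothing)
open import Data.Product.Base using (_×_; _,_; proj₁; proj₂)
open import Relation.Binary.PropositionalEquality using (_≡_)
open import Algebra.Bundles using (CommutativeRing)

-- Arrow presentations.
-- Every circle (vertex) carries a fixed orientation and is recorded as the
-- cyclic sequence (starting point arbitrary) of the arrows met along it.
-- An arrow is named by (edge label, side); the two arrows of an edge have
-- sides false and true.  'fwd' says whether the arrow points along the
-- orientation of its circle.

record Ent : Set where
  constructor ent
  field
    lab  : ℕ
    side : Bool
    fwd  : Bool
open Ent public

-- A vertex together with the label of the block of the vertex partition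
-- containing it.  Two vertices lie in the same block iff they carry the
-- same block label.
Circle : Set
Circle = ℕ × List Ent

VPAP : Set
VPAP = List Circle

entries : VPAP → List Ent
entries = concatMap proj₂

labs : VPAP → List ℕ
labs G = map lab (entries G)

edges : VPAP → List ℕ
edges G = deduplicate _≟_ (labs G)

beq : Bool → Bool → Bool
beq a b = if a then b else not b

countArrow : ℕ → Bool → VPAP → ℕ
countArrow l s G = length (filterᵇ (λ x → (lab x ≡ᵇ l) ∧ beq (side x) s) (entries G))

WF : VPAP → Set
WF G = ∀ l → l ∈ labs G → (countArrow l false G ≡ 1) × (countArrow l true G ≡ 1)

numVertices : VPAP → ℕ
numVertices = length

numBlocks : VPAP → ℕ
numBlocks G = length (deduplicate _≟_ (map proj₁ G))

-- Points (endpoints of arrows): tail (phead = false) or head (phead = true)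

record Pt : Set where
  constructor pt
  field
    plab  : ℕ
    pside : Bool
    phead : Bool
open Pt public

eqP : Pt → Pt → Bool
eqP (pt a b c) (pt a' b' c') = (a ≡ᵇ a') ∧ beq b b' ∧ beq c c'

-- first / last point of an arrow when traversing its circle forwards
entryPt : Ent → Pt
entryPt (ent l s f) = pt l s (not f)

exitPt : Ent → Pt
exitPt (ent l s f) = pt l s f

flipE : Ent → Ent
flipE (ent l s f) = ent l s (not f)

revW : List Ent → List Ent
revW w = reverse (map flipE w)

-- A strand: the part of a circle between two removed arrows (arcs removed),
-- running from point 'start' to point 'stop'.
record Strand : Set where
  constructor strand
  field
    start : Pt
    word  : List Ent
    stop  : Pt
open Strand public

spanNot : (Ent → Bool) → List Ent → List Ent × List Ent
spanNot r [] = [] , []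
spanNot r (x ∷ xs) with r x | spanNot r xs
... | true  | _ = [] , x ∷ xs
... | false | (a , b) = x ∷ a , b

cutGo : (Ent → Bool) → Ent → Ent → List Ent → List Ent → List Strand
cutGo r R0 R acc [] = strand (exitPt R) (reverse acc) (entryPt R0) ∷ []
cutGo r R0 R acc (y ∷ ys) with r y
... | true  = strand (exitPt R) (reverse acc) (entryPt y) ∷ cutGo r R0 y [] ys
... | false = cutGo r R0 R (y ∷ acc) ys

cutSplit : (Ent → Bool) → List Ent × List Ent → Maybe (List Strand)
cutSplit r (A , []) = nothing
cutSplit r (A , R ∷ B) = just (cutGo r R R [] (B ++ A))

cutCircle : (Ent → Bool) → List Ent → Maybe (List Strand)
cutCircle r w = cutSplit r (spanNot r w)

cutAll : (Ent → Bool) → VPAP → VPAP × List Strand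
cutAll r [] = [] , []
cutAll r ((l , w) ∷ cs) with cutAll r cs | cutCircle r w
... | (U , S) | nothing = (l , w) ∷ U , S
... | (U , S) | just S' = U , S' ++ S

extract : Pt → List Strand → Maybe (List Ent × Pt × List Strand)
extract p [] = nothing
extract p (s ∷ ss) with eqP (start s) p | eqP (stop s) p | extract p ss
... | true  | _     | _ = just (word s , stop s , ss)
... | false | true  | _ = just (revW (word s) , start s , ss)
... | false | false | nothing = nothing
... | false | false | just (w , q , ss') = just (w , q , s ∷ ss')

-- Gluing strands along an identification of endpoints idf (an involution).
-- Produces closed circles together with the list of endpoints on them.
mutual
  closeLoop : (Pt → Pt) → ℕ → Pt → Pt → List Ent → List Pt → List Strand
            → (List Ent × List Pt) × List Strand
  closeLoop idf n s0 e acc ps S with eqP (idf e) s0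
  ... | true  = (acc , ps) , S
  ... | false = closeStep idf n s0 e acc ps S (extract (idf e) S)

  closeStep : (Pt → Pt) → ℕ → Pt → Pt → List Ent → List Pt → List Strand
            → Maybe (List Ent × Pt × List Strand)
            → (List Ent × List Pt) × List Strand
  closeStep idf zero s0 e acc ps S _ = (acc , ps) , S
  closeStep idf (suc n) s0 e acc ps S nothing = (acc , ps) , S
  closeStep idf (suc n) s0 e acc ps S (just (w , q , S')) =
    closeLoop idf n s0 q (acc ++ w) (idf e ∷ q ∷ ps) S'

glueAll : (Pt → Pt) → ℕ → List Strand → List (List Ent × List Pt)
glueAll idf zero _ = []
glueAll idf (suc n) [] = []
glueAll idf (suc n) (s ∷ S) with closeLoop idf (length S) (start s) (stop s) (word s) (start s ∷ stop s ∷ []) S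
... | (c , S') = c ∷ glueAll idf n S'

glue : (Pt → Pt) → List Strand → List (List Ent × List Pt)
glue idf S = glueAll idf (length S) S

inCircle : ℕ → Bool → Circle → Bool
inCircle l s (_ , w) = any (λ x → (lab x ≡ᵇ l) ∧ beq (side x) s) w

blockOf : ℕ → Bool → VPAP → ℕ
blockOf l s [] = 0
blockOf l s (c ∷ cs) with inCircle l s c
... | true  = proj₁ c
... | false = blockOf l s cs

relab : ℕ → ℕ → VPAP → VPAP
relab a b = map (λ c → (if proj₁ c ≡ᵇ a then b else proj₁ c) , proj₂ c)

isEdge : ℕ → Ent → Bool
isEdge e x = lab x ≡ᵇ e

-- Deletion, contraction, Penrose-contraction, merge-deletion of edge e.
-- The arrows of e are (e , false) = p₁p₂ and (e , true) = q₁q₂.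

delete : ℕ → VPAP → VPAP
delete e = map (λ c → proj₁ c , filterᵇ (λ x → not (isEdge e x)) (proj₂ c))

mdelete : ℕ → VPAP → VPAP
mdelete e G = relab (blockOf e true G) (blockOf e false G) (delete e G)

-- common part of contraction and Penrose contraction: cut out the arcs of
-- e, glue by idf, new vertices T form one block with [u] ∪ [v]
contractBy : (Pt → Pt) → ℕ → VPAP → VPAP
contractBy idf e G with cutAll (isEdge e) G
... | (U , S) = relab (blockOf e true G) (blockOf e false G)
                  (U ++ map (λ c → blockOf e false G , proj₁ c) (glue idf S))

-- p₁ ~ q₂ , p₂ ~ q₁
idfContract : ℕ → Pt → Pt
idfContract e p with plab p ≡ᵇ e
... | true  = pt e (not (pside p)) (not (phead p))
... | false = p

-- p₁ ~ q₁ , p₂ ~ q₂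
idfPenrose : ℕ → Pt → Pt
idfPenrose e p with plab p ≡ᵇ e
... | true  = pt e (not (pside p)) (phead p)
... | false = p

contract : ℕ → VPAP → VPAP
contract e = contractBy (idfContract e) e

penrose : ℕ → VPAP → VPAP
penrose e = contractBy (idfPenrose e) e

-- a coupling of edge f with edge e: false sends (f,s) to (e,s),
-- true sends (f,s) to (e, not s)
Coupling : Set
Coupling = Bool

idfSum : ℕ → ℕ → Coupling → Pt → Pt
idfSum f e' φ p with plab p ≡ᵇ f | plab p ≡ᵇ e'
... | true  | _     = pt e' (pside p xor φ) (phead p)
... | false | true  = pt f (pside p xor φ) (phead p)
... | false | false = p

hasArrowPt : ℕ → Bool → List Pt → Bool
hasArrowPt f s = any (λ p → (plab p ≡ᵇ f) ∧ beq (pside p) s)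

-- 2-sum of G (edge f) with H (edge e'), where the edge and block labels of H
-- are assumed disjoint from those of G.
-- u, v : vertices of (f,false), (f,true) in G; u', v' those of the images.
twoSum : VPAP → VPAP → ℕ → ℕ → Coupling → VPAP
twoSum G H f e' φ with cutAll (λ x → isEdge f x ∨ isEdge e' x) (G ++ H)
... | (U , S) =
  let T   = glue (idfSum f e' φ) S
      Lu  = blockOf f false G
      Lv  = blockOf f true G
      Lu' = blockOf e' φ H
      Lv' = blockOf e' (not φ) H
      lblT : List Ent × List Pt → Circle
      lblT c = (if hasArrowPt f false (proj₂ c) then Lu else Lv) , proj₁ c
      merge = (Lu' ≡ᵇ Lv') ∨ any (λ c → hasArrowPt f false (proj₂ c) ∧ hasArrowPt f true (proj₂ c)) T
      R = relab Lv' Lv (relab Lu' Lu (U ++ map lblT T))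
  in if merge then relab Lv Lu R else R

maxLab : VPAP → ℕ
maxLab G = foldr _⊔ℕ_ 0 (map proj₁ G ++ labs G)

shift : ℕ → VPAP → VPAP
shift off = map (λ c → proj₁ c +ℕ off , map (λ x → ent (lab x +ℕ off) (side x) (fwd x)) (proj₂ c))

tensorStep : VPAP → ℕ → (ℕ → Coupling) → VPAP → ℕ → VPAP
tensorStep H e φ G f = twoSum G (shift (suc (maxLab G)) H) f (e +ℕ suc (maxLab G)) (φ f)

tensor : VPAP → VPAP → ℕ → (ℕ → Coupling) → VPAP
tensor G H e φ = foldl (tensorStep H e φ) G (edges G)

firstEdge : VPAP → Maybe ℕ
firstEdge G with entries G
... | [] = nothing
... | x ∷ _ = just (lab x)

module QhatDef {ℓ₁ ℓ₂ : Level} (R : CommutativeRing ℓ₁ ℓ₂) where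
  open CommutativeRing R renaming (Carrier to K)

  pow : K → ℕ → K
  pow z zero = 1#
  pow z (suc n) = z * pow z n

  base : K → K → VPAP → K
  base α β G = pow α (numVertices G) * pow β (numBlocks G)

  Qfuel : (a b c x α β : K) → ℕ → VPAP → K
  Qfuel a b c x α β zero G = base α β G
  Qfuel a b c x α β (suc n) G with firstEdge G
  ... | nothing = base α β G
  ... | just e  = a * Qfuel a b c x α β n (delete e G)
                + b * Qfuel a b c x α β n (contract e G)
                + c * Qfuel a b c x α β n (penrose e G)
                + x * Qfuel a b c x α β n (mdelete e G)

  Qhat : (a b c x α β : K) → VPAP → K
  Qhat a b c x α β G = Qfuel a b c x α β (length (entries G)) G

  IsSolution : (a b c x α β : K) → VPAP → ℕ → (φ₂ φp φx φ₁ : K) → Set ℓ₂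
  IsSolution a b c x α β H e φ₂ φp φx φ₁ =
    ((α * β) * ((α * β) * φ₂ + φp + φx + α * φ₁) ≈ Qhat a b c x α β (delete e H)) ×
    ((α * β) * (φ₂ + α * φp + φx + φ₁) ≈ Qhat a b c x α β (contract e H)) ×
    ((α * β) * (φ₂ + φp + α * φx + φ₁) ≈ Qhat a b c x α β (penrose e H)) ×
    ((α * β) * (α * φ₂ + φp + φx + α * φ₁) ≈ Qhat a b c x α β (mdelete e H))

{-# OPTIONS --safe #-}
-- Deleting, contracting, Penrose-contracting or merge-deleting every edge, in all possible ways, writes
-- Q̂ as a sum over states.  A state contributes α^C β^B, where C counts the components of a graph on the
-- endpoints of the arrows (the arcs of the circles together with a matching for every edge) and B those
-- of a graph on the blocks; in particular the order in which the edges are processed does not matter.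
-- In a 2-sum of G and H along f and e, a state of the edges of H other than e reduces H to a presentation
-- whose only edge is e, and gluing this into f has, up to extra circles and blocks, the effect of one of
-- the four operations on f.  Hence Q̂ of the 2-sum is Σ_t A_t Q̂(G with operation t at f), with
-- coefficients A_t that depend on H and e only.  The same A_t expand Q̂(H ∖ e), Q̂(H / e), Q̂(H † e) and
-- Q̂(H ∖ₘ e), which is the given linear system, so A_t = φ_t by uniqueness.  The edges of G are replaced
-- one at a time, with weights that depend on the edge.
module Submission where

open import Defs
open import Data.Nat.Base as ℕ using (ℕ; zero; suc; _≤_; z≤n; s≤s; _≡ᵇ_)
import Data.Sum.Properties as Sumₚ
import Data.List.Membership.DecPropositional as DecMembership
import Data.List.Base as List
import Data.Nat.Properties as ℕₚ
open import Data.Bool.Base using (Bool; true; false; not; if_then_else_; _∧_; _∨_; _xor_; T)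
open import Data.Bool.ListAction using (any)
open import Data.Maybe.Base using (Maybe; just; nothing)
import Data.Bool.Properties as Boolₚ
open import Data.Empty using (⊥; ⊥-elim)
open import Data.Sum.Base using (_⊎_; inj₁; inj₂; [_,_]′)
open import Data.Product.Base using (∃; _×_; _,_; proj₁; proj₂; swap)
open import Data.List.Base using (List; []; _∷_; [_]; _++_; map; foldl; length; deduplicate; reverse; filterᵇ)
import Data.List.Properties as Listₚ
open import Data.List.Membership.Propositional using (_∈_; _∉_)
open import Data.List.Membership.Propositional.Properties using (∈-map⁺; ∈-map⁻; ∈-++⁺ˡ; ∈-++⁺ʳ; ∈-++⁻; ∈-∃++; ∈-insert; ∈-deduplicate⁺; ∈-deduplicate⁻; ∈-filter⁺; ∈-filter⁻)
open import Data.List.Relation.Unary.Any using (here; there)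
open import Data.List.Relation.Unary.All as All using (All; []; _∷_)
open import Data.List.Relation.Unary.AllPairs as AllPairs using (AllPairs; []; _∷_)
import Data.List.Relation.Unary.AllPairs.Properties as AllPairsₚ
open import Data.List.Relation.Unary.Unique.Propositional using (Unique)
open import Data.List.Relation.Binary.Permutation.Propositional as Perm using (_↭_; ↭-refl; ↭-sym; ↭-trans; prep)
import Data.List.Relation.Binary.Permutation.Propositional.Properties as Permₚ
import Data.List.Relation.Binary.Permutation.Setoid.Properties as PermSₚ
import Algebra.Solver.CommutativeMonoid as CMSolver
open import Function.Base using (_∘_; id)
open import Relation.Nullary using (¬_; Dec; yes; no; does)
open import Relation.Nullary.Decidable using (¬?)
open import Relation.Binary.Definitions using (DecidableEquality)
open import Relation.Binary.PropositionalEquality using (_≡_; _≢_; refl; sym; trans; cong; cong₂; subst; subst₂; setoid; isEquivalence; module ≡-Reasoning)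
import Relation.Binary.Construct.On as On
open import Relation.Binary.Construct.Closure.ReflexiveTransitive using (ε; _◅◅_)
open import Level using (Level)
import Data.List.Relation.Unary.Unique.DecPropositional.Properties as UniqueDecₚ
import Data.List.Relation.Unary.Unique.Propositional.Properties as Uniqueₚ
open import Relation.Binary.Structures using (IsEquivalence)
open import Relation.Binary.Construct.Closure.Equivalence as EqC using (EqClosure)
open import Algebra.Bundles using (CommutativeRing)
import Algebra.Solver.Ring.NaturalCoefficients.Default as RingSolver
open DecMembership ℕₚ._≟_ using () renaming (_∈?_ to _∈ℕ?_)

-- The operations are algorithms on cyclic words with chosen directions, starting points and block
-- labels, on none of which the counts may depend. Endpoints of arrows are free of these choices: in
-- both graphs an operation only adds links among the four endpoints of its edge, so the links of
-- the other edges can stay pending in a list. The labour is to show that cutting, gluing and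
-- relabelling change the counts exactly as the added links would. Two graphs are needed because
-- `del` and `mdel` have the same matching and differ in the blocks alone. Circles without arrows
-- have no endpoints and are counted apart. The four unknowns come from the possible shapes of a
-- presentation whose only edge is `e`: both arrows on one circle, in one of two relative
-- directions, or on two circles, in different blocks or in the same one. These behave like `con`,
-- `pen`, `del` and `mdel` respectively.

private variable
  A B : Set

-- Counting connected components

∼[]-rel : List (A × A) → A → A → Set
∼[]-rel L = EqClosure (λ a b → (a , b) ∈ L)

infix 4 ∼[]-rel
syntax ∼[]-rel L x y = x ∼[ L ] y

link : {L : List (A × A)} {a b : A} → (a , b) ∈ L → a ∼[ L ] b
link = EqC.return

∼-sym : {L : List (A × A)} {a b : A} → a ∼[ L ] b → b ∼[ L ] a
∼-sym = EqC.symmetric _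

∼-fold : {L : List (A × A)} {R : A → A → Set} → IsEquivalence R →
         (∀ {a b} → (a , b) ∈ L → R a b) → ∀ {x y} → x ∼[ L ] y → R x y
∼-fold eq f = EqC.fold eq f

∼-map : {L : List (A × A)} {L′ : List (B × B)} (f : A → B) →
        (∀ {a b} → (a , b) ∈ L → f a ∼[ L′ ] f b) → ∀ {x y} → x ∼[ L ] y → f x ∼[ L′ ] f y
∼-map f h = EqC.gfold (EqC.isEquivalence _) f h

∼-weaken : {L L′ : List (A × A)} → (∀ {l} → l ∈ L → l ∈ L′) → ∀ {x y} → x ∼[ L ] y → x ∼[ L′ ] y
∼-weaken f = EqC.map f

≡⇒∼ : {L : List (A × A)} {a b : A} → a ≡ b → a ∼[ L ] b
≡⇒∼ refl = ε

-- Counts classes rather than elements. The partner of `x` is removed from `ys`; no later element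
-- can ask for it again, since sharing a partner would make that element `R`-related to `x`.
pigeonhole : (R : A → A → Set) (S : A → B → Set) → (∀ {x x′ y} → S x y → S x′ y → R x x′) →
             ∀ xs ys → AllPairs (λ a b → ¬ R a b) xs →
             (∀ {x} → x ∈ xs → ∃ λ y → y ∈ ys × S x y) → length xs ≤ length ys
pigeonhole R S inj [] ys _ f = z≤n
pigeonhole R S inj (x ∷ xs) ys (nx ∷ ps) f with f (here refl)
... | y , y∈ , sxy with ∈-∃++ y∈
... | ys₁ , ys₂ , refl = subst (suc (length xs) ≤_) (sym (Listₚ.length-++-sucʳ ys₁ y ys₂))
    (s≤s (pigeonhole R S inj xs (ys₁ ++ ys₂) ps g))
  where
  g : ∀ {x′} → x′ ∈ xs → ∃ λ y′ → y′ ∈ ys₁ ++ ys₂ × S x′ y′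
  g x′∈ with f (there x′∈)
  ... | y′ , y′∈ , s′ with ∈-++⁻ ys₁ y′∈
  ... | inj₁ p = y′ , ∈-++⁺ˡ p , s′
  ... | inj₂ (there p) = y′ , ∈-++⁺ʳ ys₁ p , s′
  ... | inj₂ (here refl) = ⊥-elim (All.lookup nx x′∈ (inj sxy s′))

-- A transversal of those components that meet `N`. A representative need not lie in `N` itself: in
-- a block graph only labels are counted, while `quot` may carry a label to a point.
record Reps (N : List A) (L : List (A × A)) (rs : List A) : Set where
  field
    separated : AllPairs (λ a b → ¬ (a ∼[ L ] b)) rs
    from      : ∀ {r} → r ∈ rs → ∃ λ x → x ∈ N × r ∼[ L ] x
    cover     : ∀ {x} → x ∈ N → ∃ λ r → r ∈ rs × x ∼[ L ] r

-- A relation that is total on `N` and reflects connectedness sends classes injectively to classes.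
-- It is a relation and not a function so that the inverse of a map can be used for the opposite
-- inequality.
Reps-≤ : {N : List A} {L : List (A × A)} {rs : List A} {N′ : List B} {L′ : List (B × B)} {rs′ : List B} →
         Reps N L rs → Reps N′ L′ rs′ → (F : A → B → Set) →
         (∀ {x} → x ∈ N → ∃ λ y → y ∈ N′ × F x y) →
         (∀ {x x′ y y′} → x ∈ N → x′ ∈ N → F x y → F x′ y′ → y ∼[ L′ ] y′ → x ∼[ L ] x′) →
         length rs ≤ length rs′
Reps-≤ {A = A} {B = B} {N} {L} {rs} {N′} {L′} {rs′} P P′ F tot refl∼ =
  pigeonhole (∼[]-rel L) S inj rs rs′ (Reps.separated P) f
  where
  S : A → B → Set
  S r r′ = ∃ λ x → ∃ λ y → x ∈ N × r ∼[ L ] x × F x y × y ∼[ L′ ] r′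
  inj : ∀ {x x′ y} → S x y → S x′ y → x ∼[ L ] x′
  inj (u , v , u∈ , r∼u , Fuv , v∼) (u′ , v′ , u′∈ , r∼u′ , Fuv′ , v′∼) =
    r∼u ◅◅ refl∼ u∈ u′∈ Fuv Fuv′ (v∼ ◅◅ ∼-sym v′∼) ◅◅ ∼-sym r∼u′
  f : ∀ {r} → r ∈ rs → ∃ λ r′ → r′ ∈ rs′ × S r r′
  f r∈ with Reps.from P r∈
  ... | x , x∈ , r∼x with tot x∈
  ... | y , y∈ , Fxy with Reps.cover P′ y∈
  ... | r′ , r′∈ , y∼r′ = r′ , r′∈ , x , y , x∈ , r∼x , Fxy , y∼r′

module Components {A : Set} (_≟_ : DecidableEquality A) where

  -- A canonical representative of the class of x under the equivalence generated by L.
  quot : List (A × A) → A → A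
  quot [] x = x
  quot ((a , b) ∷ L) x = if does (quot L x ≟ quot L a) then quot L b else quot L x

  opaque
    comps : List A → List (A × A) → ℕ
    comps N L = length (deduplicate _≟_ (map (quot L) N))

  quot-∼ : ∀ L x → x ∼[ L ] quot L x
  quot-∼ [] x = ε
  quot-∼ ((a , b) ∷ L) x with quot L x ≟ quot L a
  ... | no _ = ∼-weaken there (quot-∼ L x)
  ... | yes eq = ∼-weaken there (quot-∼ L x ◅◅ ≡⇒∼ eq ◅◅ ∼-sym (quot-∼ L a))
                 ◅◅ link (here refl) ◅◅ ∼-weaken there (quot-∼ L b)

  quot-link : ∀ L {a b} → (a , b) ∈ L → quot L a ≡ quot L b
  quot-link ((a , b) ∷ L) (here refl) with quot L a ≟ quot L a | quot L b ≟ quot L a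
  ... | yes _ | yes _ = refl
  ... | yes _ | no _ = refl
  ... | no ne | _ = ⊥-elim (ne refl)
  quot-link ((a , b) ∷ L) (there m) rewrite quot-link L m = refl

  ∼-quot : ∀ L {x y} → x ∼[ L ] y → quot L x ≡ quot L y
  ∼-quot L = ∼-fold (record { refl = refl ; sym = sym ; trans = trans }) (quot-link L)

  comps-reps : ∀ N L → Reps N L (deduplicate _≟_ (map (quot L) N))
  comps-reps N L = record
    { separated = sep (λ m → ∈-deduplicate⁻ _≟_ _ m) (UniqueDecₚ.deduplicate-! _≟_ (map (quot L) N))
    ; from = from
    ; cover = λ {x} x∈ → quot L x , ∈-deduplicate⁺ _≟_ (∈-map⁺ (quot L) x∈) , quot-∼ L x
    }
    where
    from : ∀ {r} → r ∈ deduplicate _≟_ (map (quot L) N) → ∃ λ x → x ∈ N × r ∼[ L ] x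
    from r∈ with ∈-map⁻ (quot L) (∈-deduplicate⁻ _≟_ (map (quot L) N) r∈)
    ... | x , x∈ , refl = x , x∈ , ∼-sym (quot-∼ L x)
    idem : ∀ {r} → r ∈ map (quot L) N → quot L r ≡ r
    idem r∈ with ∈-map⁻ (quot L) r∈
    ... | x , x∈ , refl = sym (∼-quot L (quot-∼ L x))
    sep : ∀ {rs} → (∀ {r} → r ∈ rs → r ∈ map (quot L) N) → Unique rs → AllPairs (λ a b → ¬ (a ∼[ L ] b)) rs
    sep sub [] = []
    sep sub (nx ∷ u) = All.tabulate (λ m r∼ → All.lookup nx m
      (trans (sym (idem (sub (here refl)))) (trans (∼-quot L r∼) (idem (sub (there m)))))) ∷ sep (sub ∘ there) u

  opaque
    unfolding comps

    -- Two transversals of the same graph have equal length, by the identity relation in both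
    -- directions. Hence a count can be read off any convenient transversal, independently of
    -- `quot`.
    comps-unique : ∀ {N L rs} → Reps N L rs → comps N L ≡ length rs
    comps-unique {N} {L} P = ℕₚ.≤-antisym
      (Reps-≤ (comps-reps N L) P _≡_ (λ m → _ , m , refl) (λ { _ _ refl refl r → r }))
      (Reps-≤ P (comps-reps N L) _≡_ (λ m → _ , m , refl) (λ { _ _ refl refl r → r }))

  -- No link crosses the border of `P`, so a path in the union stays on one side, and two
  -- transversals may simply be concatenated.
  comps-++ : (P : A → Set) (N₁ N₂ : List A) (L₁ L₂ : List (A × A)) →
    (∀ {x} → x ∈ N₁ → P x) → (∀ {x} → x ∈ N₂ → ¬ P x) →
    (∀ {a b} → (a , b) ∈ L₁ → P a × P b) → (∀ {a b} → (a , b) ∈ L₂ → ¬ P a × ¬ P b) →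
    comps (N₁ ++ N₂) (L₁ ++ L₂) ≡ comps N₁ L₁ ℕ.+ comps N₂ L₂
  comps-++ P N₁ N₂ L₁ L₂ PN₁ PN₂ PL₁ PL₂ = trans (comps-unique R) (trans (Listₚ.length-++ rs₁) (sym (cong₂ ℕ._+_ (comps-unique R₁) (comps-unique R₂))))
    where
    rs₁ = deduplicate _≟_ (map (quot L₁) N₁)
    rs₂ = deduplicate _≟_ (map (quot L₂) N₂)
    R₁ = comps-reps N₁ L₁
    R₂ = comps-reps N₂ L₂
    -- `P` is not assumed decidable, so a path cannot be sorted into a side. It is folded into
    -- implications instead; invariance of `P` is part of the relation because transitivity and
    -- symmetry of the other two parts need it.
    E : A → A → Set
    E x y = ((P x → P y) × (P y → P x)) × (P x → x ∼[ L₁ ] y) × (¬ P x → x ∼[ L₂ ] y)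
    Eeq : IsEquivalence E
    Eeq = record
      { refl = (id , id) , (λ _ → ε) , (λ _ → ε)
      ; sym = λ { ((f , g) , h , k) → (g , f) , (λ p → ∼-sym (h (g p))) , (λ n → ∼-sym (k (n ∘ f))) }
      ; trans = λ { ((f , g) , h , k) ((f′ , g′) , h′ , k′) →
          (f′ ∘ f , g ∘ g′) , (λ p → h p ◅◅ h′ (f p)) , (λ n → k n ◅◅ k′ (n ∘ g)) }
      }
    Elink : ∀ {a b} → (a , b) ∈ L₁ ++ L₂ → E a b
    Elink m with ∈-++⁻ L₁ m
    ... | inj₁ m₁ = ((λ _ → proj₂ (PL₁ m₁)) , (λ _ → proj₁ (PL₁ m₁))) , (λ _ → link m₁) , (λ n → ⊥-elim (n (proj₁ (PL₁ m₁))))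
    ... | inj₂ m₂ = ((λ p → ⊥-elim (proj₁ (PL₂ m₂) p)) , (λ p → ⊥-elim (proj₂ (PL₂ m₂) p)))
                  , (λ p → ⊥-elim (proj₁ (PL₂ m₂) p)) , (λ _ → link m₂)
    split : ∀ {x y} → x ∼[ L₁ ++ L₂ ] y → E x y
    split = ∼-fold Eeq Elink
    in₁ : ∀ {x y} → x ∼[ L₁ ] y → x ∼[ L₁ ++ L₂ ] y
    in₁ = ∼-weaken ∈-++⁺ˡ
    in₂ : ∀ {x y} → x ∼[ L₂ ] y → x ∼[ L₁ ++ L₂ ] y
    in₂ = ∼-weaken (∈-++⁺ʳ L₁)
    P₁ : ∀ {r} → r ∈ rs₁ → P r
    P₁ r∈ with Reps.from R₁ r∈
    ... | x , x∈ , r∼ = proj₂ (proj₁ (split (in₁ r∼))) (PN₁ x∈)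
    P₂ : ∀ {r} → r ∈ rs₂ → ¬ P r
    P₂ r∈ p with Reps.from R₂ r∈
    ... | x , x∈ , r∼ = PN₂ x∈ (proj₁ (proj₁ (split (in₂ r∼))) p)
    sub₁ : ∀ {rs} → (∀ {r} → r ∈ rs → P r) → AllPairs (λ a b → ¬ (a ∼[ L₁ ] b)) rs → AllPairs (λ a b → ¬ (a ∼[ L₁ ++ L₂ ] b)) rs
    sub₁ p [] = []
    sub₁ p (n ∷ ns) = All.map (λ k r → k (proj₁ (proj₂ (split r)) (p (here refl)))) n ∷ sub₁ (p ∘ there) ns
    sub₂ : ∀ {rs} → (∀ {r} → r ∈ rs → ¬ P r) → AllPairs (λ a b → ¬ (a ∼[ L₂ ] b)) rs → AllPairs (λ a b → ¬ (a ∼[ L₁ ++ L₂ ] b)) rs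
    sub₂ p [] = []
    sub₂ p (n ∷ ns) = All.map (λ k r → k (proj₂ (proj₂ (split r)) (p (here refl)))) n ∷ sub₂ (p ∘ there) ns
    fromR : ∀ {r} → r ∈ rs₁ ++ rs₂ → ∃ λ x → x ∈ N₁ ++ N₂ × r ∼[ L₁ ++ L₂ ] x
    fromR m with ∈-++⁻ rs₁ m
    ... | inj₁ m₁ = let x , x∈ , r∼ = Reps.from R₁ m₁ in x , ∈-++⁺ˡ x∈ , in₁ r∼
    ... | inj₂ m₂ = let x , x∈ , r∼ = Reps.from R₂ m₂ in x , ∈-++⁺ʳ N₁ x∈ , in₂ r∼
    coverR : ∀ {x} → x ∈ N₁ ++ N₂ → ∃ λ r → r ∈ rs₁ ++ rs₂ × x ∼[ L₁ ++ L₂ ] r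
    coverR m with ∈-++⁻ N₁ m
    ... | inj₁ m₁ = let r , r∈ , x∼ = Reps.cover R₁ m₁ in r , ∈-++⁺ˡ r∈ , in₁ x∼
    ... | inj₂ m₂ = let r , r∈ , x∼ = Reps.cover R₂ m₂ in r , ∈-++⁺ʳ rs₁ r∈ , in₂ x∼
    R : Reps (N₁ ++ N₂) (L₁ ++ L₂) (rs₁ ++ rs₂)
    R = record
      { separated = AllPairsₚ.++⁺ (sub₁ P₁ (Reps.separated R₁)) (sub₂ P₂ (Reps.separated R₂))
          (All.tabulate λ r∈ → All.tabulate λ s∈ r∼s → P₂ s∈ (proj₁ (proj₁ (split r∼s)) (P₁ r∈)))
      ; from = fromR
      ; cover = coverR
      }

module _ {A B : Set} (_≟_ : DecidableEquality A) (_≟′_ : DecidableEquality B) where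
  -- A homotopy equivalence on components: both maps send links to paths, and `σ ∘ ρ` moves a node
  -- of `N` only inside its component, so `ρ` separates components. Both graphs may have nodes
  -- outside `N` and `N′`, about which the last three conditions say nothing.
  comps-transfer : ∀ {N L N′ L′} (ρ : A → B) (σ : B → A) →
    (∀ {a b} → (a , b) ∈ L → ρ a ∼[ L′ ] ρ b) →
    (∀ {a b} → (a , b) ∈ L′ → σ a ∼[ L ] σ b) →
    (∀ {x} → x ∈ N → σ (ρ x) ∼[ L ] x) →
    (∀ {x} → x ∈ N → ∃ λ y → y ∈ N′ × ρ x ∼[ L′ ] y) →
    (∀ {y} → y ∈ N′ → ∃ λ x → x ∈ N × ρ x ∼[ L′ ] y) →
    Components.comps _≟_ N L ≡ Components.comps _≟′_ N′ L′
  comps-transfer {N} {L} {N′} {L′} ρ σ ρL σL σρ tot sur =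
    subst₂ _≡_ (sym (Components.comps-unique _≟_ RA)) (sym (Components.comps-unique _≟′_ RB)) (ℕₚ.≤-antisym
    (Reps-≤ RA RB (λ x y → ρ x ∼[ L′ ] y) tot
      (λ x∈ x′∈ F F′ r → ∼-sym (σρ x∈) ◅◅ ∼-map σ σL (F ◅◅ r ◅◅ ∼-sym F′) ◅◅ σρ x′∈))
    (Reps-≤ RB RA (λ y x → ρ x ∼[ L′ ] y)
      (λ y∈ → let x , x∈ , r = sur y∈ in x , x∈ , r)
      (λ _ _ F F′ r → ∼-sym F ◅◅ ∼-map ρ ρL r ◅◅ F′)))
    where
    RA = Components.comps-reps _≟_ N L
    RB = Components.comps-reps _≟′_ N′ L′

module _ {A : Set} (_≟_ : DecidableEquality A) where

  comps-cong : ∀ {N L N′ L′} →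
    (∀ {a b} → (a , b) ∈ L → a ∼[ L′ ] b) → (∀ {a b} → (a , b) ∈ L′ → a ∼[ L ] b) →
    (∀ {x} → x ∈ N → x ∈ N′) → (∀ {x} → x ∈ N′ → x ∈ N) →
    Components.comps _≟_ N L ≡ Components.comps _≟_ N′ L′
  comps-cong f g h k = comps-transfer _≟_ _≟_ id id f g (λ _ → ε) (λ m → _ , h m , ε) (λ m → _ , k m , ε)

-- Lists up to permutation

module PermSolver {A : Set} = CMSolver (Permₚ.++-commutativeMonoid {A = A})
open PermSolver using (solve; _⊜_; _⊕_)

-- For h which, like concatMap g, appends the values of g.
module Additive (g : A → List B) (h : List A → List B)
  (h-[] : h [] ≡ []) (h-∷ : ∀ x xs → h (x ∷ xs) ≡ g x ++ h xs) where

  ++-hom : ∀ xs {ys} → h (xs ++ ys) ≡ h xs ++ h ys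
  ++-hom [] {ys} = cong (_++ h ys) (sym h-[])
  ++-hom (x ∷ xs) {ys} = trans (h-∷ x (xs ++ ys)) (trans (cong (g x ++_) (++-hom xs))
    (trans (sym (Listₚ.++-assoc (g x) (h xs) (h ys))) (cong (_++ h ys) (sym (h-∷ x xs)))))

  ↭-hom : ∀ {xs ys} → xs ↭ ys → h xs ↭ h ys
  ↭-hom Perm.refl = ↭-refl
  ↭-hom (Perm.prep {xs} {ys} x p) rewrite h-∷ x xs | h-∷ x ys = Permₚ.++⁺ˡ (g x) (↭-hom p)
  ↭-hom (Perm.swap {xs} {ys} x y p) rewrite h-∷ x (y ∷ xs) | h-∷ y xs | h-∷ y (x ∷ ys) | h-∷ x ys =
    ↭-trans (solve 3 (λ a b c → (a ⊕ (b ⊕ c)) ⊜ (b ⊕ (a ⊕ c))) ↭-refl (g x) (g y) (h xs))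
      (Permₚ.++⁺ˡ (g y) (Permₚ.++⁺ˡ (g x) (↭-hom p)))
  ↭-hom (Perm.trans p q) = ↭-trans (↭-hom p) (↭-hom q)

Unique-↭ : {xs ys : List A} → xs ↭ ys → Unique xs → Unique ys
Unique-↭ p = PermSₚ.Unique-resp-↭ (setoid _) (Perm.↭⇒↭ₛ p)

↭⇒∈ : {xs ys : List A} → xs ↭ ys → ∀ {x} → x ∈ xs → x ∈ ys
↭⇒∈ p = Permₚ.∈-resp-↭ p

Unique-++⁻ʳ : (xs : List A) {ys : List A} → Unique (xs ++ ys) → Unique ys
Unique-++⁻ʳ [] u = u
Unique-++⁻ʳ (x ∷ xs) (_ ∷ u) = Unique-++⁻ʳ xs u

Unique-++⁻ˡ : (xs : List A) {ys : List A} → Unique (xs ++ ys) → Unique xs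
Unique-++⁻ˡ xs {ys} u = Unique-++⁻ʳ ys (Unique-↭ (Permₚ.++-comm xs ys) u)

Unique-disjoint : (xs : List A) {ys : List A} → Unique (xs ++ ys) → ∀ {x} → x ∈ xs → x ∉ ys
Unique-disjoint (x ∷ xs) (n ∷ u) (here refl) m = All.lookup n (∈-++⁺ʳ xs m) refl
Unique-disjoint (x ∷ xs) (n ∷ u) (there k) m = Unique-disjoint xs u k m

-- Points

_≟P_ : DecidableEquality Pt
pt a b c ≟P pt a′ b′ c′ with a ℕₚ.≟ a′ | b Boolₚ.≟ b′ | c Boolₚ.≟ c′
... | yes refl | yes refl | yes refl = yes refl
... | no n | _ | _ = no λ { refl → n refl }
... | yes _ | no n | _ = no λ { refl → n refl }
... | yes _ | yes _ | no n = no λ { refl → n refl }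

flat : List (A × A) → List A
flat [] = []
flat ((a , b) ∷ L) = a ∷ b ∷ flat L

module Flat {A : Set} = Additive {A × A} {A} (λ l → proj₁ l ∷ proj₂ l ∷ []) flat refl (λ _ _ → refl)

flat-++ : (L L′ : List (A × A)) → flat (L ++ L′) ≡ flat L ++ flat L′
flat-++ L L′ = Flat.++-hom L

flat-↭ : {L L′ : List (A × A)} → L ↭ L′ → flat L ↭ flat L′
flat-↭ = Flat.↭-hom

∈-flat₁ : {L : List (A × A)} {a b : A} → (a , b) ∈ L → a ∈ flat L
∈-flat₁ (here refl) = here refl
∈-flat₁ {L = _ ∷ _} (there m) = there (there (∈-flat₁ m))

∈-flat₂ : {L : List (A × A)} {a b : A} → (a , b) ∈ L → b ∈ flat L
∈-flat₂ (here refl) = there (here refl)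
∈-flat₂ {L = _ ∷ _} (there m) = there (there (∈-flat₂ m))

∈-flat⁻ : (L : List (A × A)) {x : A} → x ∈ flat L → ∃ λ y → (x , y) ∈ L ⊎ (y , x) ∈ L
∈-flat⁻ ((a , b) ∷ L) (here refl) = b , inj₁ (here refl)
∈-flat⁻ ((a , b) ∷ L) (there (here refl)) = a , inj₂ (here refl)
∈-flat⁻ ((a , b) ∷ L) (there (there m)) with ∈-flat⁻ L m
... | y , inj₁ k = y , inj₁ (there k)
... | y , inj₂ k = y , inj₂ (there k)

-- Gluing arcs along a matching

-- q and q′ are retracted onto p; only p, q, q′, b see the change.
module JoinArcs {p q q′ b : Pt} {L M : List (Pt × Pt)}
  (p≢q : p ≢ q) (p≢q′ : p ≢ q′) (q≢b : q ≢ b) (q′≢b : q′ ≢ b)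
  (qL : All (q ≢_) (flat L)) (q′L : All (q′ ≢_) (flat L))
  (qM : All (q ≢_) (flat M)) (q′M : All (q′ ≢_) (flat M)) where

  L₁ = ((p , q) ∷ (q′ , b) ∷ L) ++ (q , q′) ∷ M
  L₂ = ((p , b) ∷ L) ++ M
  ρ : Pt → Pt
  ρ x with x ≟P q | x ≟P q′
  ... | yes _ | _ = p
  ... | no _ | yes _ = p
  ... | no _ | no _ = x
  ρq : ρ q ≡ p
  ρq with q ≟P q
  ... | yes _ = refl
  ... | no n = ⊥-elim (n refl)
  ρq′ : ρ q′ ≡ p
  ρq′ with q′ ≟P q | q′ ≟P q′
  ... | yes _ | _ = refl
  ... | no _ | yes _ = refl
  ... | no _ | no n = ⊥-elim (n refl)
  ρo : ∀ {x} → q ≢ x → q′ ≢ x → ρ x ≡ x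
  ρo {x} n n′ with x ≟P q | x ≟P q′
  ... | yes e | _ = ⊥-elim (n (sym e))
  ... | no _ | yes e = ⊥-elim (n′ (sym e))
  ... | no _ | no _ = refl
  ρp = ρo (p≢q ∘ sym) (p≢q′ ∘ sym)
  old : ∀ {a c} → (a , c) ∈ L₂ → q ≢ a → q′ ≢ a → q ≢ c → q′ ≢ c → ρ a ∼[ L₂ ] ρ c
  old m n₁ n₂ n₃ n₄ = ≡⇒∼ (ρo n₁ n₂) ◅◅ link m ◅◅ ≡⇒∼ (sym (ρo n₃ n₄))
  ρL : ∀ {a c} → (a , c) ∈ L₁ → ρ a ∼[ L₂ ] ρ c
  ρL (here refl) = ≡⇒∼ (trans ρp (sym ρq))
  ρL (there (here refl)) = ≡⇒∼ ρq′ ◅◅ link (here refl) ◅◅ ≡⇒∼ (sym (ρo q≢b q′≢b))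
  ρL (there (there m)) with ∈-++⁻ L m
  ... | inj₁ k = old (∈-++⁺ˡ (there k)) (All.lookup qL (∈-flat₁ k)) (All.lookup q′L (∈-flat₁ k))
                   (All.lookup qL (∈-flat₂ k)) (All.lookup q′L (∈-flat₂ k))
  ... | inj₂ (here refl) = ≡⇒∼ (trans ρq (sym ρq′))
  ... | inj₂ (there k) = old (∈-++⁺ʳ ((p , b) ∷ L) k) (All.lookup qM (∈-flat₁ k)) (All.lookup q′M (∈-flat₁ k))
                   (All.lookup qM (∈-flat₂ k)) (All.lookup q′M (∈-flat₂ k))
  p∼q : p ∼[ L₁ ] q
  p∼q = link (here refl)
  q∼q′ : q ∼[ L₁ ] q′
  q∼q′ = link (∈-++⁺ʳ ((p , q) ∷ (q′ , b) ∷ L) (here refl))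
  σL : ∀ {a c} → (a , c) ∈ L₂ → a ∼[ L₁ ] c
  σL (here refl) = p∼q ◅◅ q∼q′ ◅◅ link (there (here refl))
  σL (there m) with ∈-++⁻ L m
  ... | inj₁ k = link (there (there (∈-++⁺ˡ k)))
  ... | inj₂ k = link (there (there (∈-++⁺ʳ L (there k))))
  σρ : ∀ {x} → x ∈ flat ((p , q) ∷ (q′ , b) ∷ L) → ρ x ∼[ L₁ ] x
  σρ {x} _ with x ≟P q | x ≟P q′
  ... | yes refl | _ = p∼q
  ... | no _ | yes refl = p∼q ◅◅ q∼q′
  ... | no _ | no _ = ε
  tot : ∀ {x} → x ∈ flat ((p , q) ∷ (q′ , b) ∷ L) → ∃ λ y → y ∈ flat ((p , b) ∷ L) × ρ x ∼[ L₂ ] y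
  tot (here refl) = p , here refl , ≡⇒∼ ρp
  tot (there (here refl)) = p , here refl , ≡⇒∼ ρq
  tot (there (there (here refl))) = p , here refl , ≡⇒∼ ρq′
  tot (there (there (there (here refl)))) = b , there (here refl) , ≡⇒∼ (ρo q≢b q′≢b)
  tot {x} (there (there (there (there m)))) = x , there (there m) , ≡⇒∼ (ρo (All.lookup qL m) (All.lookup q′L m))
  sur : ∀ {y} → y ∈ flat ((p , b) ∷ L) → ∃ λ x → x ∈ flat ((p , q) ∷ (q′ , b) ∷ L) × ρ x ∼[ L₂ ] y
  sur (here refl) = p , here refl , ≡⇒∼ ρp
  sur (there (here refl)) = b , there (there (there (here refl))) , ≡⇒∼ (ρo q≢b q′≢b)
  sur {y} (there (there m)) = y , there (there (there (there m))) , ≡⇒∼ (ρo (All.lookup qL m) (All.lookup q′L m))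

-- Inclusion as sets of unordered pairs. Components see no more than this, and a strand glued from
-- its far end reverses its arcs.
flipped : List (A × A) → List (A × A) → Set
flipped M M′ = ∀ {a b} → (a , b) ∈ M → (a , b) ∈ M′ ⊎ (b , a) ∈ M′

opaque
  -- The number of closed curves and open arcs obtained from the arcs L by joining endpoints as in M.
  curves : List (Pt × Pt) → List (Pt × Pt) → ℕ
  curves L M = Components.comps _≟P_ (flat L) (L ++ M)

  curves-flipped : ∀ {L L′ M M′} → flipped L L′ → flipped L′ L → flipped M M′ → flipped M′ M → curves L M ≡ curves L′ M′
  curves-flipped f f′ g g′ = comps-cong _≟P_ (links f g) (links f′ g′) (ends f) (ends f′)
    where
    related : ∀ {L L′ : List (Pt × Pt)} → flipped L L′ → ∀ {a b} → (a , b) ∈ L → a ∼[ L′ ] b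
    related f m = [ link , ∼-sym ∘ link ]′ (f m)
    links : ∀ {L L′ M M′ : List (Pt × Pt)} → flipped L L′ → flipped M M′ → ∀ {a b} → (a , b) ∈ L ++ M → a ∼[ L′ ++ M′ ] b
    links {L} {L′} f g m = [ ∼-weaken ∈-++⁺ˡ ∘ related f , ∼-weaken (∈-++⁺ʳ L′) ∘ related g ]′ (∈-++⁻ L m)
    ends : ∀ {L L′ : List (Pt × Pt)} → flipped L L′ → ∀ {x} → x ∈ flat L → x ∈ flat L′
    ends {L} f m with ∈-flat⁻ L m
    ... | y , inj₁ k = [ ∈-flat₁ , ∈-flat₂ ]′ (f k)
    ... | y , inj₂ k = [ ∈-flat₂ , ∈-flat₁ ]′ (f k)

  -- As endpoints are not repeated, `q` and `q′` meet no further link, and the path through `p`,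
  -- `q`, `q′`, `b` can be shortened to a single link.
  join-arcs : ∀ {p q q′ b L M} → Unique (flat ((p , q) ∷ (q′ , b) ∷ L)) → Unique (q ∷ q′ ∷ flat M) →
    curves ((p , q) ∷ (q′ , b) ∷ L) ((q , q′) ∷ M) ≡ curves ((p , b) ∷ L) M
  join-arcs {p} {q} {q′} {b} {L} {M} ((p≢q ∷ p≢q′ ∷ p≢b ∷ pL) ∷ (q≢q′ ∷ q≢b ∷ qL) ∷ (q′≢b ∷ q′L) ∷ _) ((_ ∷ qM) ∷ q′M ∷ _) =
    comps-transfer _≟P_ _≟P_ J.ρ id J.ρL J.σL J.σρ J.tot J.sur
    where module J = JoinArcs {p} {q} {q′} {b} {L} {M} p≢q p≢q′ q≢b q′≢b qL q′L qM q′M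

  -- Joining the two ends of one arc yields a circle without arrows. Its endpoints form a component
  -- of their own, which disappears from the graph; hence the `suc`.
  close-arc : ∀ {p q L M} → Unique (flat ((p , q) ∷ L)) → Unique (q ∷ p ∷ flat M) →
    curves ((p , q) ∷ L) ((q , p) ∷ M) ≡ suc (curves L M)
  close-arc {p} {q} {L} {M} ((p≢q ∷ pL) ∷ qL ∷ _) ((q≢p ∷ qM) ∷ pM ∷ _) =
    trans (comps-cong _≟P_ (link ∘ to) (link ∘ fro) id id)
      (trans (Components.comps-++ _≟P_ (λ x → x ∈ p ∷ q ∷ []) (p ∷ q ∷ []) (flat L) K (L ++ M) id outL inK outLM)
        (cong (ℕ._+ curves L M) one))
    where
    K : List (Pt × Pt)
    K = (p , q) ∷ (q , p) ∷ []
    to : ∀ {l} → l ∈ ((p , q) ∷ L) ++ (q , p) ∷ M → l ∈ K ++ (L ++ M)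
    to (here e) = here e
    to (there m) with ∈-++⁻ L m
    ... | inj₁ k = there (there (∈-++⁺ˡ k))
    ... | inj₂ (here e) = there (here e)
    ... | inj₂ (there k) = there (there (∈-++⁺ʳ L k))
    fro : ∀ {l} → l ∈ K ++ (L ++ M) → l ∈ ((p , q) ∷ L) ++ (q , p) ∷ M
    fro (here e) = here e
    fro (there (here e)) = there (∈-++⁺ʳ L (here e))
    fro (there (there m)) with ∈-++⁻ L m
    ... | inj₁ k = there (∈-++⁺ˡ k)
    ... | inj₂ k = there (∈-++⁺ʳ L (there k))
    outside : ∀ {x} → p ≢ x → q ≢ x → ¬ (x ∈ p ∷ q ∷ [])
    outside n n′ (here e) = n (sym e)
    outside n n′ (there (here e)) = n′ (sym e)
    outL : ∀ {x} → x ∈ flat L → ¬ (x ∈ p ∷ q ∷ [])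
    outL m = outside (All.lookup pL m) (All.lookup qL m)
    inK : ∀ {a b} → (a , b) ∈ K → a ∈ p ∷ q ∷ [] × b ∈ p ∷ q ∷ []
    inK (here refl) = here refl , there (here refl)
    inK (there (here refl)) = there (here refl) , here refl
    outLM : ∀ {a b} → (a , b) ∈ L ++ M → ¬ (a ∈ p ∷ q ∷ []) × ¬ (b ∈ p ∷ q ∷ [])
    outLM m with ∈-++⁻ L m
    ... | inj₁ k = outL (∈-flat₁ k) , outL (∈-flat₂ k)
    ... | inj₂ k = outside (All.lookup pM (∈-flat₁ k)) (All.lookup qM (∈-flat₁ k))
                 , outside (All.lookup pM (∈-flat₂ k)) (All.lookup qM (∈-flat₂ k))
    one : Components.comps _≟P_ (p ∷ q ∷ []) K ≡ 1
    one = Components.comps-unique _≟P_ {rs = p ∷ []} record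
      { separated = [] ∷ []
      ; from = λ { (here refl) → p , here refl , ε }
      ; cover = λ { (here refl) → p , here refl , ε ; (there (here refl)) → p , here refl , link (there (here refl)) }
      }

curves-↭ : ∀ {L L′ M M′} → L ↭ L′ → M ↭ M′ → curves L M ≡ curves L′ M′
curves-↭ p q = curves-flipped (λ m → inj₁ (↭⇒∈ p m)) (λ m → inj₁ (↭⇒∈ (↭-sym p) m))
  (λ m → inj₁ (↭⇒∈ q m)) (λ m → inj₁ (↭⇒∈ (↭-sym q) m))

curves-flippedˡ : ∀ {L L′ M} → flipped L L′ → flipped L′ L → curves L M ≡ curves L′ M
curves-flippedˡ f g = curves-flipped f g inj₁ inj₁

curves-flippedʳ : ∀ {L M M′} → flipped M M′ → flipped M′ M → curves L M ≡ curves L M′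
curves-flippedʳ f g = curves-flipped inj₁ inj₁ f g

flipped-++ : {X Y Z : List (A × A)} → flipped X Y → flipped (X ++ Z) (Y ++ Z)
flipped-++ {X = X} {Y} f m with ∈-++⁻ X m
... | inj₂ k = inj₁ (∈-++⁺ʳ Y k)
... | inj₁ k = [ inj₁ ∘ ∈-++⁺ˡ , inj₂ ∘ ∈-++⁺ˡ ]′ (f k)

curves-swap : ∀ L {L₀ M} → curves (map swap L ++ L₀) M ≡ curves (L ++ L₀) M
curves-swap L = curves-flippedˡ (flipped-++ {X = map swap L} back) (flipped-++ {X = L} (λ m → inj₂ (∈-map⁺ swap m)))
  where
  back : flipped (map swap L) L
  back m with ∈-map⁻ swap m
  ... | _ , k , refl = inj₂ k

-- Words as chains of arcs

pts : List Ent → List Pt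
pts [] = []
pts (x ∷ w) = entryPt x ∷ exitPt x ∷ pts w

pts-++ : ∀ u {v} → pts (u ++ v) ≡ pts u ++ pts v
pts-++ = Additive.++-hom (λ x → entryPt x ∷ exitPt x ∷ []) pts refl (λ _ _ → refl)

-- Only the arcs between consecutive arrows are recorded. How the endpoints of an arrow are
-- connected with each other is the choice that a state makes.
arcsFrom : Pt → List Ent → Pt → List (Pt × Pt)
arcsFrom p [] q = (p , q) ∷ []
arcsFrom p (x ∷ w) q = (p , entryPt x) ∷ arcsFrom (exitPt x) w q

circleArcs : List Ent → List (Pt × Pt)
circleArcs [] = []
circleArcs (x ∷ w) = arcsFrom (exitPt x) w (entryPt x)

bare : List Ent → ℕ
bare [] = 1
bare (_ ∷ _) = 0

flat-arcsFrom : ∀ p w q → flat (arcsFrom p w q) ↭ p ∷ q ∷ pts w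
flat-arcsFrom p [] q = ↭-refl
flat-arcsFrom p (x ∷ w) q = ↭-trans (prep p (prep (entryPt x) (flat-arcsFrom (exitPt x) w q)))
  (solve 5 (λ a b c d e → (a ⊕ (b ⊕ (c ⊕ (d ⊕ e)))) ⊜ (a ⊕ (d ⊕ (b ⊕ (c ⊕ e))))) ↭-refl
    [ p ] [ entryPt x ] [ exitPt x ] [ q ] (pts w))

flat-circleArcs : ∀ w → flat (circleArcs w) ↭ pts w
flat-circleArcs [] = ↭-refl
flat-circleArcs (x ∷ w) = ↭-trans (flat-arcsFrom (exitPt x) w (entryPt x)) (Perm.swap _ _ ↭-refl)

flat-++-↭ : {X Y : List (A × A)} {xs ys : List A} → flat X ↭ xs → flat Y ↭ ys → flat (X ++ Y) ↭ xs ++ ys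
flat-++-↭ {X = X} {Y} p q = ↭-trans (Perm.↭-reflexive (flat-++ X Y)) (Permₚ.++⁺ p q)

arcsFrom-++ : ∀ p u x v q → arcsFrom p (u ++ x ∷ v) q ≡ arcsFrom p u (entryPt x) ++ arcsFrom (exitPt x) v q
arcsFrom-++ p [] x v q = refl
arcsFrom-++ p (y ∷ u) x v q = cong (_ ∷_) (arcsFrom-++ (exitPt y) u x v q)

-- `flipE` exchanges the entry and the exit point of an arrow, so the reversed word walks along the
-- same arcs backwards.
arcsFrom-revW : ∀ p w q → arcsFrom q (revW w) p ↭ map swap (arcsFrom p w q)
arcsFrom-revW p [] q = ↭-refl
arcsFrom-revW p (x@(ent l s f) ∷ w) q
  rewrite Listₚ.unfold-reverse (flipE x) (map flipE w) | arcsFrom-++ q (revW w) (flipE x) [] p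
        | Boolₚ.not-involutive f =
  ↭-trans (Permₚ.++-comm (arcsFrom q (revW w) (pt l s f)) [ (entryPt x , p) ])
    (prep _ (arcsFrom-revW (exitPt x) w q))

flat-fuse : ∀ w {p q q′ r w′ L} → flat (arcsFrom p w q ++ arcsFrom q′ w′ r ++ L) ↭
  q ∷ q′ ∷ flat (arcsFrom p (w ++ w′) r ++ L)
flat-fuse w {p} {q} {q′} {r} {w′} {L} =
  ↭-trans (flat-++-↭ (flat-arcsFrom p w q) (flat-++-↭ (flat-arcsFrom q′ w′ r) (↭-refl {x = flat L})))
  (↭-trans (solve 7 (λ p q w q′ r w′ L → ((p ⊕ (q ⊕ w)) ⊕ ((q′ ⊕ (r ⊕ w′)) ⊕ L)) ⊜ (q ⊕ (q′ ⊕ ((p ⊕ (r ⊕ (w ⊕ w′))) ⊕ L))))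
     ↭-refl [ p ] [ q ] (pts w) [ q′ ] [ r ] (pts w′) (flat L))
   (prep q (prep q′ (↭-sym (flat-++-↭ (↭-trans (flat-arcsFrom p (w ++ w′) r)
      (Perm.↭-reflexive (cong (λ z → p ∷ r ∷ z) (pts-++ w)))) (↭-refl {x = flat L}))))))

-- Only the last arc of `w` takes part. The induction moves the earlier arcs aside into `L`, until
-- `join-arcs` applies to the last one.
curves-fuse : ∀ w {p q q′ r w′ L M} → Unique (flat (arcsFrom p w q ++ arcsFrom q′ w′ r ++ L)) →
  Unique (q ∷ q′ ∷ flat M) →
  curves (arcsFrom p w q ++ arcsFrom q′ w′ r ++ L) ((q , q′) ∷ M) ≡ curves (arcsFrom p (w ++ w′) r ++ L) M
curves-fuse [] {w′ = []} uL uM = join-arcs uL uM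
curves-fuse [] {w′ = y ∷ w′} uL uM = join-arcs uL uM
curves-fuse (x ∷ w) {p} {q} {q′} {r} {w′} {L} {M} uL uM =
  trans (curves-↭ {M = (q , q′) ∷ M} perm ↭-refl)
    (trans (curves-fuse w (Unique-↭ (flat-↭ perm) uL) uM)
      (curves-↭ {M = M} (Permₚ.shift (p , entryPt x) (arcsFrom (exitPt x) (w ++ w′) r) L) ↭-refl))
  where
  perm : (p , entryPt x) ∷ arcsFrom (exitPt x) w q ++ arcsFrom q′ w′ r ++ L ↭
         arcsFrom (exitPt x) w q ++ arcsFrom q′ w′ r ++ (p , entryPt x) ∷ L
  perm = solve 4 (λ a b c d → (a ⊕ (b ⊕ (c ⊕ d))) ⊜ (b ⊕ (c ⊕ (a ⊕ d)))) ↭-refl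
    [ (p , entryPt x) ] (arcsFrom (exitPt x) w q) (arcsFrom q′ w′ r) L

flat-close : ∀ {p w q L} → flat (arcsFrom p w q ++ L) ↭ q ∷ p ∷ flat (circleArcs w ++ L)
flat-close {p} {w} {q} {L} = ↭-trans (flat-++-↭ (flat-arcsFrom p w q) (↭-refl {x = flat L}))
  (↭-trans (Perm.swap p q ↭-refl) (prep q (prep p (↭-sym (flat-++-↭ (flat-circleArcs w) (↭-refl {x = flat L}))))))

-- If there is an arrow `x` on the strand, the arc before it is moved to the end and fused with the
-- final arc, so that the circle is read from `x`. Without an arrow the strand closes to a bare
-- circle.
curves-close : ∀ w {p q L M} → Unique (flat (arcsFrom p w q ++ L)) → Unique (q ∷ p ∷ flat M) →
  curves (arcsFrom p w q ++ L) ((q , p) ∷ M) ≡ bare w ℕ.+ curves (circleArcs w ++ L) M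
curves-close [] uL uM = close-arc uL uM
curves-close (x ∷ w) {p} {q} {L} {M} uL uM =
  trans (curves-↭ {M = (q , p) ∷ M} perm ↭-refl)
    (trans (curves-fuse w {w′ = []} (Unique-↭ (flat-↭ perm) uL) uM)
      (cong (λ z → curves (arcsFrom (exitPt x) z (entryPt x) ++ L) M) (Listₚ.++-identityʳ w)))
  where
  perm : (p , entryPt x) ∷ arcsFrom (exitPt x) w q ++ L ↭ arcsFrom (exitPt x) w q ++ (p , entryPt x) ∷ L
  perm = ↭-sym (Permₚ.shift (p , entryPt x) (arcsFrom (exitPt x) w q) L)

-- Gluing strands

≡ᵇ-sound : ∀ {m n} → (m ≡ᵇ n) ≡ true → m ≡ n
≡ᵇ-sound {m} {n} e = ℕₚ.≡ᵇ⇒≡ m n (subst T (sym e) _)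

≡ᵇ-refl : ∀ n → (n ≡ᵇ n) ≡ true
≡ᵇ-refl zero = refl
≡ᵇ-refl (suc n) = ≡ᵇ-refl n

≡ᵇ-false : ∀ {m n} → m ≢ n → (m ≡ᵇ n) ≡ false
≡ᵇ-false {m} {n} ne with m ≡ᵇ n in e
... | true = ⊥-elim (ne (≡ᵇ-sound e))
... | false = refl

beq-sound : ∀ {b b′} → beq b b′ ≡ true → b ≡ b′
beq-sound {false} {false} _ = refl
beq-sound {true} {true} _ = refl

beq-refl : ∀ b → beq b b ≡ true
beq-refl false = refl
beq-refl true = refl

eqP-sound : ∀ {p q} → eqP p q ≡ true → p ≡ q
eqP-sound {pt a b c} {pt a′ b′ c′} e with a ≡ᵇ a′ in e₁ | beq b b′ in e₂ | beq c c′ in e₃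
... | true | true | true rewrite ≡ᵇ-sound {a} {a′} e₁ | beq-sound {b} {b′} e₂ | beq-sound {c} {c′} e₃ = refl

eqP-refl : ∀ p → eqP p p ≡ true
eqP-refl (pt a b c) rewrite ≡ᵇ-refl a | beq-refl b | beq-refl c = refl

strandArcs : List Strand → List (Pt × Pt)
strandArcs [] = []
strandArcs (t ∷ S) = arcsFrom (start t) (word t) (stop t) ++ strandArcs S

strandPts : List Strand → List Pt
strandPts [] = []
strandPts (t ∷ S) = pts (word t) ++ strandPts S

ends : List Strand → List Pt
ends [] = []
ends (t ∷ S) = start t ∷ stop t ∷ ends S

strandPts-↭ : ∀ {S S′} → S ↭ S′ → strandPts S ↭ strandPts S′
strandPts-↭ = Additive.↭-hom (pts ∘ word) strandPts refl (λ _ _ → refl)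

module StrandArcs = Additive (λ t → arcsFrom (start t) (word t) (stop t)) strandArcs refl (λ _ _ → refl)
open StrandArcs using () renaming (↭-hom to strandArcs-↭; ++-hom to strandArcs-++)

ends-↭ : ∀ {S S′} → S ↭ S′ → ends S ↭ ends S′
ends-↭ = Additive.↭-hom (λ t → start t ∷ stop t ∷ []) ends refl (λ _ _ → refl)

flat-strandArcs : ∀ S → flat (strandArcs S) ↭ ends S ++ strandPts S
flat-strandArcs [] = ↭-refl
flat-strandArcs (t ∷ S) = ↭-trans (flat-++-↭ (flat-arcsFrom (start t) (word t) (stop t)) (flat-strandArcs S))
  (solve 5 (λ p q w e s → ((p ⊕ (q ⊕ w)) ⊕ (e ⊕ s)) ⊜ ((p ⊕ (q ⊕ e)) ⊕ (w ⊕ s))) ↭-refl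
    [ start t ] [ stop t ] (pts (word t)) (ends S) (strandPts S))

pts-revW : ∀ w → pts (revW w) ↭ pts w
pts-revW [] = ↭-refl
pts-revW (x@(ent l s f) ∷ w) rewrite Listₚ.unfold-reverse (flipE x) (map flipE w) | pts-++ (revW w) {flipE x ∷ []}
   | Boolₚ.not-involutive f =
  ↭-trans (Permₚ.++-comm (pts (revW w)) (pt l s f ∷ pt l s (not f) ∷ [])) (Perm.swap _ _ (pts-revW w))

data Oriented (t : Strand) (p : Pt) (w : List Ent) (q : Pt) : Set where
  forward  : t ≡ strand p w q → Oriented t p w q
  backward : ∀ v → w ≡ revW v → t ≡ strand q v p → Oriented t p w q

record Taken (p : Pt) (S : List Strand) (w : List Ent) (q : Pt) (S′ : List Strand) : Set where
  constructor taken
  field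
    picked   : Strand
    perm     : S ↭ picked ∷ S′
    oriented : Oriented picked p w q

extract-just : ∀ p S {w q S′} → extract p S ≡ just (w , q , S′) → Taken p S w q S′
extract-just p (s ∷ ss) h with eqP (start s) p in e₁ | eqP (stop s) p in e₂ | extract p ss in e₃
extract-just p (s ∷ ss) refl | true | _ | _ rewrite sym (eqP-sound {start s} e₁) = taken s ↭-refl (forward refl)
extract-just p (s ∷ ss) refl | false | true | _ rewrite sym (eqP-sound {stop s} e₂) = taken s ↭-refl (backward (word s) refl refl)
extract-just p (s ∷ ss) refl | false | false | just (w , q , ss′) with extract-just p ss e₃
... | taken t r o = taken t (↭-trans (prep s r) (Perm.swap s t ↭-refl)) o

extract-nothing : ∀ p S → extract p S ≡ nothing → p ∉ ends S
extract-nothing p (s ∷ ss) h m with eqP (start s) p in e₁ | eqP (stop s) p in e₂ | extract p ss in e₃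
extract-nothing p (s ∷ ss) h (here refl) | false | false | nothing with trans (sym e₁) (eqP-refl p)
... | ()
extract-nothing p (s ∷ ss) h (there (here refl)) | false | false | nothing with trans (sym e₂) (eqP-refl p)
... | ()
extract-nothing p (s ∷ ss) h (there (there m)) | false | false | nothing = extract-nothing p ss e₃ m

taken-ends : ∀ {p S w q S′} → Taken p S w q S′ → ends S ↭ p ∷ q ∷ ends S′
taken-ends (taken _ r (forward refl)) = ends-↭ r
taken-ends (taken _ r (backward v _ refl)) = ↭-trans (ends-↭ r) (Perm.swap _ _ ↭-refl)

taken-pts : ∀ {p S w q S′} → Taken p S w q S′ → strandPts S ↭ pts w ++ strandPts S′
taken-pts (taken _ r (forward refl)) = strandPts-↭ r
taken-pts (taken _ r (backward v refl refl)) = ↭-trans (strandPts-↭ r) (Permₚ.++⁺ʳ _ (↭-sym (pts-revW v)))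

circlePts : List (List Ent × List Pt) → List Pt
circlePts [] = []
circlePts (c ∷ T) = pts (proj₁ c) ++ circlePts T

tracks : List (List Ent × List Pt) → List Pt
tracks [] = []
tracks (c ∷ T) = proj₂ c ++ tracks T

circlesArcs : List (List Ent × List Pt) → List (Pt × Pt)
circlesArcs [] = []
circlesArcs (c ∷ T) = circleArcs (proj₁ c) ++ circlesArcs T

bares : List (List Ent × List Pt) → ℕ
bares [] = 0
bares (c ∷ T) = bare (proj₁ c) ℕ.+ bares T

module Gluing (idf : Pt → Pt) where

  -- The invariant under which gluing never gets stuck: on the ends not yet joined, `idf` is an
  -- involution without fixed points.
  record Paired (X : List Pt) : Set where
    field
      unique     : Unique X
      closed     : ∀ {x} → x ∈ X → idf x ∈ X
      involutive : ∀ {x} → x ∈ X → idf (idf x) ≡ x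
      fixfree    : ∀ {x} → x ∈ X → idf x ≢ x

  Paired-drop : ∀ {X a b Y} → X ↭ a ∷ b ∷ Y → idf a ≡ b → Paired X → Paired Y
  Paired-drop {X} {a} {b} {Y} r e P with Unique-↭ r (Paired.unique P)
  ... | (a≢b ∷ na) ∷ nb ∷ u = record
    { unique = u
    ; closed = λ m → in-Y m (↭⇒∈ r (Paired.closed P (up m)))
    ; involutive = Paired.involutive P ∘ up
    ; fixfree = Paired.fixfree P ∘ up
    }
    where
    up : ∀ {x} → x ∈ Y → x ∈ X
    up m = ↭⇒∈ (↭-sym r) (there (there m))
    idf-b : idf b ≡ a
    idf-b = trans (cong idf (sym e)) (Paired.involutive P (↭⇒∈ (↭-sym r) (here refl)))
    in-Y : ∀ {x} → x ∈ Y → idf x ∈ a ∷ b ∷ Y → idf x ∈ Y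
    in-Y m (here i) = ⊥-elim (All.lookup nb m (trans (trans (sym e) (cong idf (sym i))) (Paired.involutive P (up m))))
    in-Y m (there (here i)) = ⊥-elim (All.lookup na m (trans (trans (sym idf-b) (cong idf (sym i))) (Paired.involutive P (up m))))
    in-Y m (there (there k)) = k

  -- The graph of closeLoop; the last index lists the pairs of endpoints which it joins.
  data Closes (s₀ : Pt) : Pt → List Ent → List Pt → List Strand → List Ent × List Pt → List Strand → List (Pt × Pt) → Set where
    close : ∀ {e acc ps S} → idf e ≡ s₀ → Closes s₀ e acc ps S (acc , ps) S ((e , s₀) ∷ [])
    step  : ∀ {e acc ps S p w q S′ c S″ M} → idf e ≡ p → Taken p S w q S′ →
            Closes s₀ q (acc ++ w) (p ∷ q ∷ ps) S′ c S″ M → Closes s₀ e acc ps S c S″ ((e , p) ∷ M)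

  data Glued : List Strand → List (List Ent × List Pt) → List (Pt × Pt) → Set where
    []  : Glued [] [] []
    _∷_ : ∀ {s S c S′ M T M′} → Closes (start s) (stop s) (word s) (start s ∷ stop s ∷ []) S c S′ M →
          Glued S′ T M′ → Glued (s ∷ S) (c ∷ T) (M ++ M′)

  record LoopClosed (s₀ e : Pt) (acc : List Ent) (ps : List Pt) (S : List Strand)
                    (r : (List Ent × List Pt) × List Strand) : Set where
    field
      matching : List (Pt × Pt)
      closes   : Closes s₀ e acc ps S (proj₁ r) (proj₂ r) matching
      paired   : Paired (ends (proj₂ r))
      shorter  : length (proj₂ r) ≤ length S

  -- Each step uses up a strand, so `length S` is enough fuel. The search cannot fail: `idf e` is
  -- not `s₀`, as the test has just shown, and not `e`, as there are no fixed points; so it is an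
  -- end of a remaining strand.
  closeLoop-closes : ∀ n {s₀ e acc ps} S → length S ≤ n → Paired (s₀ ∷ e ∷ ends S) →
    LoopClosed s₀ e acc ps S (closeLoop idf n s₀ e acc ps S)
  closeLoop-closes n {s₀} {e} {acc} {ps} S len P with eqP (idf e) s₀ in eq
  ... | true = record
    { matching = _ ; closes = close (eqP-sound eq)
    ; paired = Paired-drop (Perm.swap s₀ e ↭-refl) (eqP-sound eq) P ; shorter = ℕₚ.≤-refl }
  ... | false = go n len (extract (idf e) S) refl
    where
    idf-e∈ : idf e ∈ ends S
    idf-e∈ with Paired.closed P (there (here refl))
    ... | here i = ⊥-elim (contra (trans (sym eq) (trans (cong (eqP (idf e)) (sym i)) (eqP-refl (idf e)))))
      where
      contra : false ≢ true
      contra ()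
    ... | there (here i) = ⊥-elim (Paired.fixfree P (there (here refl)) i)
    ... | there (there m) = m
    go : ∀ n → length S ≤ n → (r : _) → extract (idf e) S ≡ r → LoopClosed s₀ e acc ps S (closeStep idf n s₀ e acc ps S r)
    go n len nothing er = ⊥-elim (extract-nothing (idf e) S er idf-e∈)
    go n len (just (w , q , S′)) er with extract-just (idf e) S er
    go zero len (just (w , q , S′)) er | t with ℕₚ.≤-trans (ℕₚ.≤-reflexive (sym (Permₚ.↭-length (Taken.perm t)))) len
    ... | ()
    go (suc n) len (just (w , q , S′)) er | t with
      closeLoop-closes n {s₀} {q} {acc ++ w} {idf e ∷ q ∷ ps} S′
        (ℕₚ.≤-pred (ℕₚ.≤-trans (ℕₚ.≤-reflexive (sym (Permₚ.↭-length (Taken.perm t)))) len))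
        (Paired-drop (↭-trans (prep s₀ (prep e (taken-ends t)))
           (solve 5 (λ s e p q S → (s ⊕ (e ⊕ (p ⊕ (q ⊕ S)))) ⊜ (e ⊕ (p ⊕ (s ⊕ (q ⊕ S))))) ↭-refl
             [ s₀ ] [ e ] [ idf e ] [ q ] (ends S′))) refl P)
    ... | r = record
      { matching = _ ; closes = step refl t (LoopClosed.closes r) ; paired = LoopClosed.paired r
      ; shorter = ℕₚ.≤-trans (LoopClosed.shorter r) (ℕₚ.≤-trans (ℕₚ.n≤1+n _) (ℕₚ.≤-reflexive (sym (Permₚ.↭-length (Taken.perm t))))) }

  glueAll-glued : ∀ n S → length S ≤ n → Paired (ends S) → ∃ λ M → Glued S (glueAll idf n S) M
  glueAll-glued zero [] len P = [] , []
  glueAll-glued (suc n) [] len P = [] , []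
  glueAll-glued (suc n) (s ∷ S) (s≤s len) P
    with closeLoop idf (length S) (start s) (stop s) (word s) (start s ∷ stop s ∷ []) S
       | closeLoop-closes (length S) {start s} {stop s} {word s} {start s ∷ stop s ∷ []} S ℕₚ.≤-refl P
  ... | (c , S′) | r with glueAll-glued n S′ (ℕₚ.≤-trans (LoopClosed.shorter r) len) (LoopClosed.paired r)
  ... | M , g = _ , LoopClosed.closes r ∷ g

  glue-glued : ∀ S → Paired (ends S) → ∃ λ M → Glued S (glue idf S) M
  glue-glued S = glueAll-glued (length S) S ℕₚ.≤-refl

  closes-ends : ∀ {s₀ e acc ps S c S′ M} → Closes s₀ e acc ps S c S′ M → s₀ ∷ e ∷ ends S ↭ flat M ++ ends S′
  closes-ends (close _) = Perm.swap _ _ ↭-refl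
  closes-ends {s₀} {e} (step {p = p} {q = q} {S′ = S′} _ t k) =
    ↭-trans (prep s₀ (prep e (taken-ends t)))
      (↭-trans (solve 5 (λ s e p q S → (s ⊕ (e ⊕ (p ⊕ (q ⊕ S)))) ⊜ (e ⊕ (p ⊕ (s ⊕ (q ⊕ S))))) ↭-refl
                 [ s₀ ] [ e ] [ p ] [ q ] (ends S′))
        (prep e (prep p (closes-ends k))))

  glued-ends : ∀ {S T M} → Glued S T M → ends S ↭ flat M
  glued-ends [] = ↭-refl
  glued-ends {M = M} (_∷_ {M = M₁} {M′ = M₂} k g) = ↭-trans (closes-ends k)
    (↭-trans (Permₚ.++⁺ˡ (flat M₁) (glued-ends g)) (Perm.↭-reflexive (sym (flat-++ M₁ M₂))))

  closes-pts : ∀ {s₀ e acc ps S c S′ M} → Closes s₀ e acc ps S c S′ M →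
    pts acc ++ strandPts S ↭ pts (proj₁ c) ++ strandPts S′
  closes-pts (close _) = ↭-refl
  closes-pts {acc = acc} (step {w = w} {S′ = S′} _ t k) =
    ↭-trans (Permₚ.++⁺ˡ (pts acc) (taken-pts t))
      (↭-trans (Perm.↭-reflexive (trans (sym (Listₚ.++-assoc (pts acc) (pts w) (strandPts S′)))
                  (cong (_++ strandPts S′) (sym (pts-++ acc))))) (closes-pts k))

  glued-pts : ∀ {S T M} → Glued S T M → strandPts S ↭ circlePts T
  glued-pts [] = ↭-refl
  glued-pts (_∷_ {c = c} k g) = ↭-trans (closes-pts k) (Permₚ.++⁺ˡ (pts (proj₁ c)) (glued-pts g))

  closes-track : ∀ {s₀ e acc ps S c S′ M} → Closes s₀ e acc ps S c S′ M → ps ++ ends S ↭ proj₂ c ++ ends S′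
  closes-track (close _) = ↭-refl
  closes-track {ps = ps} (step {p = p} {q = q} {S′ = S′} _ t k) =
    ↭-trans (Permₚ.++⁺ˡ ps (taken-ends t))
      (↭-trans (solve 4 (λ a p q s → (a ⊕ (p ⊕ (q ⊕ s))) ⊜ (p ⊕ (q ⊕ (a ⊕ s)))) ↭-refl ps [ p ] [ q ] (ends S′))
        (closes-track k))

  glued-tracks : ∀ {S T M} → Glued S T M → ends S ↭ tracks T
  glued-tracks [] = ↭-refl
  glued-tracks (_∷_ {c = c} k g) = ↭-trans (closes-track k) (Permₚ.++⁺ˡ (proj₂ c) (glued-tracks g))

  closes-matching : ∀ {s₀ e acc ps S c S′ M} → Closes s₀ e acc ps S c S′ M → ∀ {a b} → (a , b) ∈ M → b ≡ idf a
  closes-matching (close i) (here refl) = sym i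
  closes-matching (step i t k) (here refl) = sym i
  closes-matching (step i t k) (there m) = closes-matching k m

  glued-matching : ∀ {S T M} → Glued S T M → ∀ {a b} → (a , b) ∈ M → b ≡ idf a
  glued-matching (_∷_ {M = M} k g) m with ∈-++⁻ M m
  ... | inj₁ l = closes-matching k l
  ... | inj₂ l = glued-matching g l

  closes-pair : ∀ {s₀ e acc ps S c S′ M} → Closes s₀ e acc ps S c S′ M → s₀ ∈ ps → e ∈ ps →
    ∃ λ x → x ∈ proj₂ c × idf x ∈ proj₂ c
  closes-pair (close i) s∈ e∈ = _ , e∈ , subst (_∈ _) (sym i) s∈
  closes-pair (step i t k) s∈ e∈ = closes-pair k (there (there s∈)) (there (here refl))

  -- This justifies the block label given to a new circle. Of two matched endpoints, one has side
  -- `false` in a contraction and one belongs to `f` in a 2-sum, so a known arrow lies on every new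
  -- circle.
  glued-pair : ∀ {S T M} → Glued S T M → ∀ {c} → c ∈ T → ∃ λ x → x ∈ proj₂ c × idf x ∈ proj₂ c
  glued-pair (k ∷ g) (here refl) = closes-pair k (here refl) (there (here refl))
  glued-pair (k ∷ g) (there m) = glued-pair g m

  -- An equivalence respected by the strands and by `idf` is constant on each new circle. It is kept
  -- general because it serves both for connectedness in the block graph and for equality of the new
  -- block labels.
  module Class {_≈_ : Pt → Pt → Set} (eq : IsEquivalence _≈_) where
    open IsEquivalence eq renaming (refl to ≈-refl; sym to ≈-sym; trans to ≈-trans)

    Coherent : List Strand → Set
    Coherent S = ∀ {t} → t ∈ S → start t ≈ stop t × (∀ {x} → x ∈ pts (word t) → start t ≈ x)

    Linked : List Strand → Set
    Linked S = ∀ {x} → x ∈ ends S → x ≈ idf x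

    taken-coherent : ∀ {p S w q S′} → Taken p S w q S′ → Coherent S →
      (p ≈ q) × (∀ {x} → x ∈ pts w → p ≈ x) × Coherent S′
    taken-coherent (taken _ r o) C = proj₁ (ori o) , proj₂ (ori o) , (λ m → C (↭⇒∈ (↭-sym r) (there m)))
      where
      ori : ∀ {p w q} → Oriented _ p w q → (p ≈ q) × (∀ {x} → x ∈ pts w → p ≈ x)
      ori (forward refl) = C (↭⇒∈ (↭-sym r) (here refl))
      ori (backward v refl refl) with C (↭⇒∈ (↭-sym r) (here refl))
      ... | qp , f = ≈-sym qp , λ m → ≈-trans (≈-sym qp) (f (↭⇒∈ (pts-revW v) m))

    closes-class : ∀ {s₀ e acc ps S c S′ M} → Closes s₀ e acc ps S c S′ M → Coherent S →
      e ≈ idf e → Linked S → s₀ ≈ e →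
      (∀ {x} → x ∈ pts acc → s₀ ≈ x) → (∀ {x} → x ∈ ps → s₀ ≈ x) →
      (∀ {x} → x ∈ pts (proj₁ c) → s₀ ≈ x) × (∀ {x} → x ∈ proj₂ c → s₀ ≈ x) × Coherent S′ × Linked S′
    closes-class (close _) C _ K _ fa fp = fa , fp , C , K
    closes-class {s₀} {acc = acc} (step {p = p} {w = w} {q = q} refl t k) C ei K se fa fp with taken-coherent t C
    ... | pq , fw , C′ = closes-class k C′ (K (q∈ (there (here refl)))) (λ m → K (q∈ (there (there m)))) sq fa′ fp′
      where
      q∈ : ∀ {x} → x ∈ p ∷ q ∷ ends _ → x ∈ ends _
      q∈ m = ↭⇒∈ (↭-sym (taken-ends t)) m
      sp : s₀ ≈ p
      sp = ≈-trans se ei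
      sq : s₀ ≈ q
      sq = ≈-trans sp pq
      fa′ : ∀ {x} → x ∈ pts (acc ++ w) → s₀ ≈ x
      fa′ m with ∈-++⁻ (pts acc) (subst (_ ∈_) (pts-++ acc) m)
      ... | inj₁ l = fa l
      ... | inj₂ l = ≈-trans sp (fw l)
      fp′ : ∀ {x} → x ∈ p ∷ q ∷ _ → s₀ ≈ x
      fp′ (here refl) = sp
      fp′ (there (here refl)) = sq
      fp′ (there (there m)) = fp m

    glued-class : ∀ {S T M} → Glued S T M → Coherent S → Linked S → ∀ {c} → c ∈ T →
      ∀ {x y} → x ∈ proj₂ c → y ∈ pts (proj₁ c) ⊎ y ∈ proj₂ c → x ≈ y
    glued-class (_∷_ {s = s} k g) C K m with
      closes-class k (C ∘ there) (K (there (here refl))) (λ l → K (there (there l))) (proj₁ (C (here refl)))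
        (proj₂ (C (here refl))) (λ { (here refl) → ≈-refl ; (there (here refl)) → proj₁ (C (here refl)) })
    glued-class (k ∷ g) C K (here refl) | fw , fp , C′ , K′ = λ { x∈ (inj₁ y∈) → ≈-trans (≈-sym (fp x∈)) (fw y∈)
                                                              ; x∈ (inj₂ y∈) → ≈-trans (≈-sym (fp x∈)) (fp y∈) }
    glued-class (k ∷ g) C K (there m) | fw , fp , C′ , K′ = glued-class g C′ K′ m

  -- For a strand taken from its far end, the arcs of the reversed word are the old arcs with both
  -- ends exchanged, which `curves-swap` ignores.
  curves-taken : ∀ {p S w q S′ L L′ M} → Taken p S w q S′ →
    curves (L ++ strandArcs S ++ L′) M ≡ curves (L ++ arcsFrom p w q ++ strandArcs S′ ++ L′) M
  curves-taken {p} {S} {w} {q} {S′} {L} {L′} {M} (taken t r o) = trans (curves-↭ (Permₚ.++⁺ˡ L (Permₚ.++⁺ʳ L′ (strandArcs-↭ r))) (↭-refl {x = M})) (ori o)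
    where
    ori : Oriented t p w q → curves (L ++ (arcsFrom (start t) (word t) (stop t) ++ strandArcs S′) ++ L′) M
                            ≡ curves (L ++ arcsFrom p w q ++ strandArcs S′ ++ L′) M
    ori (forward refl) = cong (λ z → curves (L ++ z) M) (Listₚ.++-assoc (arcsFrom p w q) (strandArcs S′) L′)
    ori (backward v refl refl) =
      trans (curves-↭ {M = M} (solve 4 (λ a b c d → (a ⊕ ((b ⊕ c) ⊕ d)) ⊜ (b ⊕ (a ⊕ (c ⊕ d)))) ↭-refl
               L (arcsFrom q v p) (strandArcs S′) L′) ↭-refl)
        (trans (sym (curves-swap (arcsFrom q v p)))
          (curves-↭ {M = M} (↭-trans (Permₚ.++⁺ʳ _ (↭-sym (arcsFrom-revW q v p)))
             (solve 4 (λ a b c d → (b ⊕ (a ⊕ (c ⊕ d))) ⊜ (a ⊕ (b ⊕ (c ⊕ d)))) ↭-refl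
               L (arcsFrom p (revW v) q) (strandArcs S′) L′)) ↭-refl))

  flat-taken : ∀ {p S w q S′ L L′} → Taken p S w q S′ →
    flat (L ++ strandArcs S ++ L′) ↭ flat (L ++ arcsFrom p w q ++ strandArcs S′ ++ L′)
  flat-taken {p} {S} {w} {q} {S′} {L} {L′} t = ↭-trans
    (flat-++-↭ {X = L} ↭-refl (flat-++-↭ (↭-trans (flat-strandArcs S) (Permₚ.++⁺ (taken-ends t) (taken-pts t))) (↭-refl {x = flat L′})))
    (↭-trans (solve 7 (λ a p q e w s d → (a ⊕ ((p ⊕ (q ⊕ e)) ⊕ (w ⊕ s)) ⊕ d) ⊜ (a ⊕ ((p ⊕ (q ⊕ w)) ⊕ ((e ⊕ s) ⊕ d)))) ↭-refl
       (flat L) [ p ] [ q ] (ends S′) (pts w) (strandPts S′) (flat L′))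
      (↭-sym (flat-++-↭ {X = L} ↭-refl (flat-++-↭ (flat-arcsFrom p w q) (flat-++-↭ (flat-strandArcs S′) (↭-refl {x = flat L′}))))))

  closes-curves : ∀ {s₀ e acc ps S c S′ M L M₀} → Closes s₀ e acc ps S c S′ M →
    Unique (flat (arcsFrom s₀ acc e ++ strandArcs S ++ L)) → Unique (flat (M ++ M₀)) →
    curves (arcsFrom s₀ acc e ++ strandArcs S ++ L) (M ++ M₀)
      ≡ bare (proj₁ c) ℕ.+ curves (circleArcs (proj₁ c) ++ strandArcs S′ ++ L) M₀
    × Unique (flat (circleArcs (proj₁ c) ++ strandArcs S′ ++ L))
  closes-curves {acc = acc} (close i) uL uM = curves-close acc uL uM , Unique-++⁻ʳ (_ ∷ _ ∷ []) (Unique-↭ (flat-close {w = acc}) uL)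
  closes-curves {s₀} {e} {acc} {L = L} {M₀} (step {w = w} {M = M} i t k) uL uM
    with Unique-↭ (flat-taken {L = arcsFrom s₀ acc e} {L′ = L} t) uL
  ... | u with closes-curves {L = L} {M₀ = M₀} k (Unique-++⁻ʳ (_ ∷ _ ∷ []) (Unique-↭ (flat-fuse acc) u)) (Unique-++⁻ʳ (_ ∷ _ ∷ []) uM)
  ... | eq , u′ = trans (curves-taken {L = arcsFrom s₀ acc e} {L′ = L} t) (trans (curves-fuse acc u uM) eq) , u′

  -- Every pair joined on the way is a fusion and every completed loop a closure, so a run of the
  -- algorithm is a chain of moves on the graph. `L` holds the arcs of circles that were not cut and
  -- `M₀` the matching of the edges still present.
  glued-curves : ∀ {S T M L M₀} → Glued S T M → Unique (flat (strandArcs S ++ L)) → Unique (flat (M ++ M₀)) →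
    curves (strandArcs S ++ L) (M ++ M₀) ≡ bares T ℕ.+ curves (circlesArcs T ++ L) M₀
  glued-curves [] uL uM = refl
  glued-curves {L = L} {M₀} (_∷_ {s = s} {S} {c} {S′} {M} {T} {M′} k g) uL uM
    rewrite Listₚ.++-assoc (arcsFrom (start s) (word s) (stop s)) (strandArcs S) L | Listₚ.++-assoc M M′ M₀
    with closes-curves {L = L} {M₀ = M′ ++ M₀} k uL uM
  ... | eq , u = trans eq (trans (cong (bare (proj₁ c) ℕ.+_)
      (trans (curves-↭ {M = M′ ++ M₀} perm ↭-refl)
        (trans (glued-curves {L = circleArcs (proj₁ c) ++ L} {M₀} g (Unique-↭ (flat-↭ perm) u) uM′)
          (cong (bares T ℕ.+_) (curves-↭ {M = M₀} perm′ ↭-refl)))))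
      (sym (ℕₚ.+-assoc (bare (proj₁ c)) (bares T) _)))
    where
    perm : circleArcs (proj₁ c) ++ strandArcs S′ ++ L ↭ strandArcs S′ ++ circleArcs (proj₁ c) ++ L
    perm = solve 3 (λ a b c → (a ⊕ (b ⊕ c)) ⊜ (b ⊕ (a ⊕ c))) ↭-refl (circleArcs (proj₁ c)) (strandArcs S′) L
    perm′ : circlesArcs T ++ circleArcs (proj₁ c) ++ L ↭ (circleArcs (proj₁ c) ++ circlesArcs T) ++ L
    perm′ = solve 3 (λ a b c → (a ⊕ (b ⊕ c)) ⊜ ((b ⊕ a) ⊕ c)) ↭-refl (circlesArcs T) (circleArcs (proj₁ c)) L
    uM′ : Unique (flat (M′ ++ M₀))
    uM′ = Unique-++⁻ʳ (flat M) (subst Unique (flat-++ M (M′ ++ M₀)) uM)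

-- Cutting circles at marked arrows

entries-∈ : ∀ w {p} → p ∈ pts w → ∃ λ x → x ∈ w × (p ≡ entryPt x ⊎ p ≡ exitPt x)
entries-∈ (x ∷ w) (here refl) = x , here refl , inj₁ refl
entries-∈ (x ∷ w) (there (here refl)) = x , here refl , inj₂ refl
entries-∈ (x ∷ w) (there (there m)) with entries-∈ w m
... | y , k , e = y , there k , e

∈-entryPt : ∀ {w x} → x ∈ w → entryPt x ∈ pts w
∈-entryPt (here refl) = here refl
∈-entryPt (there m) = there (there (∈-entryPt m))

∈-exitPt : ∀ {w x} → x ∈ w → exitPt x ∈ pts w
∈-exitPt (here refl) = there (here refl)
∈-exitPt (there m) = there (there (∈-exitPt m))

pts-mono : ∀ {v w} → (∀ {x} → x ∈ v → x ∈ w) → ∀ {p} → p ∈ pts v → p ∈ pts w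
pts-mono {v} f m with entries-∈ v m
... | x , k , inj₁ refl = ∈-entryPt (f k)
... | x , k , inj₂ refl = ∈-exitPt (f k)

lab-pts : ∀ w {p} → p ∈ pts w → ∃ λ x → x ∈ w × plab p ≡ lab x
lab-pts w m with entries-∈ w m
... | x , k , inj₁ refl = x , k , refl
... | x , k , inj₂ refl = x , k , refl

arcs : VPAP → List (Pt × Pt)
arcs [] = []
arcs (c ∷ G) = circleArcs (proj₂ c) ++ arcs G

points : VPAP → List Pt
points [] = []
points (c ∷ G) = pts (proj₂ c) ++ points G

empties : VPAP → ℕ
empties [] = 0
empties (c ∷ G) = bare (proj₂ c) ℕ.+ empties G

flat-arcs : ∀ G → flat (arcs G) ↭ points G
flat-arcs [] = ↭-refl
flat-arcs (c ∷ G) = flat-++-↭ (flat-circleArcs (proj₂ c)) (flat-arcs G)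

∈-points⁺ : ∀ {G c p} → c ∈ G → p ∈ pts (proj₂ c) → p ∈ points G
∈-points⁺ (here refl) m = ∈-++⁺ˡ m
∈-points⁺ {d ∷ G} (there k) m = ∈-++⁺ʳ (pts (proj₂ d)) (∈-points⁺ k m)

∈-points⁻ : ∀ G {p} → p ∈ points G → ∃ λ c → c ∈ G × p ∈ pts (proj₂ c)
∈-points⁻ (c ∷ G) m with ∈-++⁻ (pts (proj₂ c)) m
... | inj₁ k = c , here refl , k
... | inj₂ k with ∈-points⁻ G k
... | d , d∈ , l = d , there d∈ , l

module Arcs = Additive (circleArcs ∘ proj₂) arcs refl (λ _ _ → refl)
open Arcs using () renaming (↭-hom to arcs-↭; ++-hom to arcs-++)

module Points = Additive (pts ∘ proj₂) points refl (λ _ _ → refl)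
open Points using () renaming (↭-hom to points-↭; ++-hom to points-++)

empties-++ : ∀ G {H} → empties (G ++ H) ≡ empties G ℕ.+ empties H
empties-++ [] = refl
empties-++ (c ∷ G) = trans (cong (bare (proj₂ c) ℕ.+_) (empties-++ G)) (sym (ℕₚ.+-assoc (bare (proj₂ c)) (empties G) _))

Unique-++⁺ : {xs ys : List A} → Unique xs → Unique ys → (∀ {x} → x ∈ xs → x ∉ ys) → Unique (xs ++ ys)
Unique-++⁺ u v d = AllPairsₚ.++⁺ u v (All.tabulate λ m → All.tabulate λ k e → d m (subst (_∈ _) (sym e) k))

true≢false : true ≢ false
true≢false ()

module Cutting (r : ℕ → Bool) where

  Marked Unmarked : Pt → Set
  Marked p = r (plab p) ≡ true
  Unmarked p = r (plab p) ≡ false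

  record StrandOf (w : List Ent) (t : Strand) : Set where
    field
      start∈ : start t ∈ pts w
      stop∈  : stop t ∈ pts w
      start! : Marked (start t)
      stop!  : Marked (stop t)
      word∈  : ∀ {p} → p ∈ pts (word t) → p ∈ pts w
      word!  : ∀ {p} → p ∈ pts (word t) → Unmarked p

  cutGo-arcs : ∀ R₀ R acc ys → strandArcs (cutGo (r ∘ lab) R₀ R acc ys) ≡ arcsFrom (exitPt R) (reverse acc ++ ys) (entryPt R₀)
  cutGo-arcs R₀ R acc [] = trans (Listₚ.++-identityʳ _) (cong (λ z → arcsFrom (exitPt R) z (entryPt R₀)) (sym (Listₚ.++-identityʳ (reverse acc))))
  cutGo-arcs R₀ R acc (y ∷ ys) with r (lab y)
  ... | true = trans (cong (arcsFrom (exitPt R) (reverse acc) (entryPt y) ++_) (cutGo-arcs R₀ y [] ys))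
                     (sym (arcsFrom-++ (exitPt R) (reverse acc) y ys (entryPt R₀)))
  ... | false = trans (cutGo-arcs R₀ R (y ∷ acc) ys) (cong (λ z → arcsFrom (exitPt R) z (entryPt R₀))
                  (trans (cong (_++ ys) (Listₚ.unfold-reverse y acc)) (Listₚ.++-assoc (reverse acc) (y ∷ []) ys)))

  cutGo-strands : ∀ {w} R₀ R acc ys → R₀ ∈ w → r (lab R₀) ≡ true → R ∈ w → r (lab R) ≡ true →
    (∀ {x} → x ∈ acc → x ∈ w × r (lab x) ≡ false) → (∀ {x} → x ∈ ys → x ∈ w) →
    ∀ {t} → t ∈ cutGo (r ∘ lab) R₀ R acc ys → StrandOf w t
  cutGo-strands {w} R₀ R acc [] R₀∈ r₀ R∈ rR fa fy (here refl) = record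
    { start∈ = ∈-exitPt R∈ ; stop∈ = ∈-entryPt R₀∈ ; start! = rR ; stop! = r₀
    ; word∈ = pts-mono (proj₁ ∘ fa ∘ ↭⇒∈ (Permₚ.↭-reverse acc))
    ; word! = λ m → let x , k , e = lab-pts (reverse acc) m in trans (cong r e) (proj₂ (fa (↭⇒∈ (Permₚ.↭-reverse acc) k))) }
  cutGo-strands {w} R₀ R acc (y ∷ ys) R₀∈ r₀ R∈ rR fa fy m with r (lab y) in ry
  cutGo-strands {w} R₀ R acc (y ∷ ys) R₀∈ r₀ R∈ rR fa fy (here refl) | true = record
    { start∈ = ∈-exitPt R∈ ; stop∈ = ∈-entryPt (fy (here refl)) ; start! = rR ; stop! = ry
    ; word∈ = pts-mono (proj₁ ∘ fa ∘ ↭⇒∈ (Permₚ.↭-reverse acc))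
    ; word! = λ m → let x , k , e = lab-pts (reverse acc) m in trans (cong r e) (proj₂ (fa (↭⇒∈ (Permₚ.↭-reverse acc) k))) }
  cutGo-strands {w} R₀ R acc (y ∷ ys) R₀∈ r₀ R∈ rR fa fy (there m) | true =
    cutGo-strands R₀ y [] ys R₀∈ r₀ (fy (here refl)) ry (λ ()) (fy ∘ there) m
  cutGo-strands {w} R₀ R acc (y ∷ ys) R₀∈ r₀ R∈ rR fa fy m | false =
    cutGo-strands R₀ R (y ∷ acc) ys R₀∈ r₀ R∈ rR (λ { (here refl) → fy (here refl) , ry ; (there k) → fa k }) (fy ∘ there) m

  cutGo-nonempty : ∀ R₀ R acc ys → ∃ λ t → t ∈ cutGo (r ∘ lab) R₀ R acc ys
  cutGo-nonempty R₀ R acc [] = _ , here refl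
  cutGo-nonempty R₀ R acc (y ∷ ys) with r (lab y)
  ... | true = _ , here refl
  ... | false = cutGo-nonempty R₀ R (y ∷ acc) ys

  data Span (w : List Ent) : List Ent × List Ent → Set where
    uncut : (∀ {x} → x ∈ w → r (lab x) ≡ false) → Span w (w , [])
    hit   : ∀ {A R B} → w ≡ A ++ R ∷ B → r (lab R) ≡ true → Span w (A , R ∷ B)

  spanNot-span : ∀ w → Span w (spanNot (r ∘ lab) w)
  spanNot-span [] = uncut λ ()
  spanNot-span (x ∷ w) with r (lab x) in rx | spanNot (r ∘ lab) w | spanNot-span w
  ... | true | _ | _ = hit {A = []} refl rx
  ... | false | _ | uncut f = uncut λ { (here refl) → rx ; (there m) → f m }
  ... | false | _ | hit refl rR = hit refl rR

  data CircleCut (w : List Ent) : Maybe (List Strand) → Set where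
    uncut : (∀ {x} → x ∈ w → r (lab x) ≡ false) → CircleCut w nothing
    cut   : ∀ {S} → bare w ≡ 0 → circleArcs w ↭ strandArcs S → (∀ {t} → t ∈ S → StrandOf w t) →
            (∃ λ t → t ∈ S) → CircleCut w (just S)

  cutCircle-cut : ∀ w → CircleCut w (cutCircle (r ∘ lab) w)
  cutCircle-cut w with spanNot (r ∘ lab) w | spanNot-span w
  ... | _ | uncut f = uncut f
  ... | _ | hit {A} {R} {B} refl rR = cut (bare-mid A) (↭-trans (rotate A) (Perm.↭-reflexive (sym (cutGo-arcs R R [] (B ++ A)))))
      (cutGo-strands R R [] (B ++ A) (∈-insert A) rR (∈-insert A) rR (λ ()) in-w) (cutGo-nonempty R R [] (B ++ A))
    where
    bare-mid : ∀ A → bare (A ++ R ∷ B) ≡ 0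
    bare-mid [] = refl
    bare-mid (_ ∷ _) = refl
    -- The cut starts at the first marked arrow `R` and not at the recorded starting point of the
    -- circle; reading the cyclic word from `R` only permutes its arcs.
    rotate : ∀ A → circleArcs (A ++ R ∷ B) ↭ arcsFrom (exitPt R) (B ++ A) (entryPt R)
    rotate [] = Perm.↭-reflexive (cong (λ z → arcsFrom (exitPt R) z (entryPt R)) (sym (Listₚ.++-identityʳ B)))
    rotate (a ∷ A) = ↭-trans (Perm.↭-reflexive (arcsFrom-++ (exitPt a) A R B (entryPt a)))
      (↭-trans (Permₚ.++-comm (arcsFrom (exitPt a) A (entryPt R)) (arcsFrom (exitPt R) B (entryPt a)))
        (Perm.↭-reflexive (sym (arcsFrom-++ (exitPt R) B a A (entryPt R)))))
    in-w : ∀ {x} → x ∈ B ++ A → x ∈ A ++ R ∷ B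
    in-w m with ∈-++⁻ B m
    ... | inj₁ k = ∈-++⁺ʳ A (there k)
    ... | inj₂ k = ∈-++⁺ˡ k

  record CutOf (G U : VPAP) (S : List Strand) : Set where
    field
      arcs↭    : arcs G ↭ arcs U ++ strandArcs S
      empties≡ : empties G ≡ empties U
      rest     : ∀ {c} → c ∈ U → c ∈ G × (∀ {x} → x ∈ proj₂ c → r (lab x) ≡ false)
      strands  : ∀ {t} → t ∈ S → ∃ λ c → c ∈ G × StrandOf (proj₂ c) t
      either   : ∀ {c} → c ∈ G → c ∈ U ⊎ (∃ λ t → t ∈ S × start t ∈ pts (proj₂ c))

  cutAll-cut : ∀ G → CutOf G (proj₁ (cutAll (r ∘ lab) G)) (proj₂ (cutAll (r ∘ lab) G))
  cutAll-cut [] = record { arcs↭ = ↭-refl ; empties≡ = refl ; rest = λ () ; strands = λ () ; either = λ () }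
  cutAll-cut ((l , w) ∷ G) with cutAll (r ∘ lab) G | cutAll-cut G | cutCircle (r ∘ lab) w | cutCircle-cut w
  ... | U , S | I | nothing | uncut f = record
    { arcs↭ = ↭-trans (Permₚ.++⁺ˡ (circleArcs w) (CutOf.arcs↭ I)) (Perm.↭-reflexive (sym (Listₚ.++-assoc (circleArcs w) (arcs U) (strandArcs S))))
    ; empties≡ = cong (bare w ℕ.+_) (CutOf.empties≡ I)
    ; rest = λ { (here refl) → here refl , f ; (there m) → there (proj₁ (CutOf.rest I m)) , proj₂ (CutOf.rest I m) }
    ; strands = λ m → let c , c∈ , o = CutOf.strands I m in c , there c∈ , o
    ; either = λ { (here refl) → inj₁ (here refl) ; (there m) → [ inj₁ ∘ there , inj₂ ]′ (CutOf.either I m) }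
    }
  ... | U , S | I | just S′ | cut b p o (t₀ , t₀∈) = record
    { arcs↭ = ↭-trans (Permₚ.++⁺ p (CutOf.arcs↭ I)) (↭-trans
        (solve 3 (λ a b c → (a ⊕ (b ⊕ c)) ⊜ (b ⊕ (a ⊕ c))) ↭-refl (strandArcs S′) (arcs U) (strandArcs S))
        (Permₚ.++⁺ˡ (arcs U) (Perm.↭-reflexive (sym (strandArcs-++ S′)))))
    ; empties≡ = trans (cong (ℕ._+ empties G) b) (CutOf.empties≡ I)
    ; rest = λ m → there (proj₁ (CutOf.rest I m)) , proj₂ (CutOf.rest I m)
    ; strands = strands′
    ; either = λ { (here refl) → inj₂ (t₀ , ∈-++⁺ˡ t₀∈ , StrandOf.start∈ (o t₀∈))
                 ; (there m) → [ inj₁ , (λ { (t , t∈ , s∈) → inj₂ (t , ∈-++⁺ʳ S′ t∈ , s∈) }) ]′ (CutOf.either I m) }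
    }
    where
    strands′ : ∀ {t} → t ∈ S′ ++ S → ∃ λ c → c ∈ (l , w) ∷ G × StrandOf (proj₂ c) t
    strands′ m with ∈-++⁻ S′ m
    ... | inj₁ k = (l , w) , here refl , o k
    ... | inj₂ k with CutOf.strands I k
    ... | c , c∈ , o′ = c , there c∈ , o′

  module CutFacts {G U : VPAP} {S : List Strand} (I : CutOf G U S) where

    marked-ends : ∀ {p} → p ∈ ends S → Marked p
    marked-ends = go S (λ m → _ , proj₂ (proj₂ (CutOf.strands I m)))
      where
      go : ∀ S → (∀ {t} → (m : t ∈ S) → ∃ λ w → StrandOf w t) → ∀ {p} → p ∈ ends S → Marked p
      go (t ∷ S) f (here refl) = StrandOf.start! (proj₂ (f (here refl)))
      go (t ∷ S) f (there (here refl)) = StrandOf.stop! (proj₂ (f (here refl)))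
      go (t ∷ S) f (there (there m)) = go S (f ∘ there) m

    unmarked-words : ∀ {p} → p ∈ strandPts S → Unmarked p
    unmarked-words = go S (λ m → _ , proj₂ (proj₂ (CutOf.strands I m)))
      where
      go : ∀ S → (∀ {t} → (m : t ∈ S) → ∃ λ w → StrandOf w t) → ∀ {p} → p ∈ strandPts S → Unmarked p
      go (t ∷ S) f m with ∈-++⁻ (pts (word t)) m
      ... | inj₁ k = StrandOf.word! (proj₂ (f (here refl))) k
      ... | inj₂ k = go S (f ∘ there) k

    unmarked-U : ∀ {p} → p ∈ points U → Unmarked p
    unmarked-U m with ∈-points⁻ U m
    ... | c , c∈ , k with lab-pts (proj₂ c) k
    ... | x , x∈ , e = trans (cong r e) (proj₂ (CutOf.rest I c∈) x∈)

    points↭ : points G ↭ ends S ++ points U ++ strandPts S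
    points↭ = ↭-trans (↭-sym (flat-arcs G)) (↭-trans (flat-↭ (CutOf.arcs↭ I))
      (↭-trans (flat-++-↭ (flat-arcs U) (flat-strandArcs S))
        (solve 3 (λ a b c → (a ⊕ (b ⊕ c)) ⊜ (b ⊕ (a ⊕ c))) ↭-refl (points U) (ends S) (strandPts S))))

    ∈-ends : ∀ {p} → p ∈ points G → Marked p → p ∈ ends S
    ∈-ends m mk with ∈-++⁻ (ends S) (↭⇒∈ points↭ m)
    ... | inj₁ k = k
    ... | inj₂ k with ∈-++⁻ (points U) k
    ... | inj₁ j = ⊥-elim (true≢false (trans (sym mk) (unmarked-U j)))
    ... | inj₂ j = ⊥-elim (true≢false (trans (sym mk) (unmarked-words j)))

    ends⊆ : ∀ {p} → p ∈ ends S → p ∈ points G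
    ends⊆ m = ↭⇒∈ (↭-sym points↭) (∈-++⁺ˡ m)

  record Removes (G R : VPAP) : Set where
    field
      unique : Unique (points R)
      keeps  : ∀ {p} → p ∈ points G → Unmarked p → p ∈ points R
      only   : ∀ {p} → p ∈ points R → p ∈ points G × Unmarked p

-- Cutting out arrows and regluing the strands

curveCount : VPAP → List (Pt × Pt) → ℕ
curveCount G M = empties G ℕ.+ curves (arcs G) M

module Regluing (r : ℕ → Bool) (idf : Pt → Pt) (G : VPAP) where
  open Cutting r public
  open Gluing idf public

  U : VPAP
  U = proj₁ (cutAll (r ∘ lab) G)

  S : List Strand
  S = proj₂ (cutAll (r ∘ lab) G)

  circles : List (List Ent × List Pt)
  circles = glue idf S

  cutOf : CutOf G U S
  cutOf = cutAll-cut G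

  open CutFacts cutOf public

  -- The labels of the new circles are left open, since contraction and 2-sum choose them
  -- differently.
  reglued : (List Ent × List Pt → ℕ) → VPAP
  reglued lbl = U ++ map (λ c → lbl c , proj₁ c) circles

  arcs-circles : (lbl : List Ent × List Pt → ℕ) → ∀ T → arcs (map (λ c → lbl c , proj₁ c) T) ≡ circlesArcs T
  arcs-circles lbl [] = refl
  arcs-circles lbl (c ∷ T) = cong (circleArcs (proj₁ c) ++_) (arcs-circles lbl T)

  points-circles : (lbl : List Ent × List Pt → ℕ) → ∀ T → points (map (λ c → lbl c , proj₁ c) T) ≡ circlePts T
  points-circles lbl [] = refl
  points-circles lbl (c ∷ T) = cong (pts (proj₁ c) ++_) (points-circles lbl T)

  empties-circles : (lbl : List Ent × List Pt → ℕ) → ∀ T → empties (map (λ c → lbl c , proj₁ c) T) ≡ bares T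
  empties-circles lbl [] = refl
  empties-circles lbl (c ∷ T) = cong (bare (proj₁ c) ℕ.+_) (empties-circles lbl T)

  module _ (uG : Unique (points G)) (P : Paired (ends S)) where

    glued : ∃ λ M → Glued S circles M
    glued = glue-glued S P

    reglued-points : ∀ lbl → points G ↭ ends S ++ points (reglued lbl)
    reglued-points lbl = ↭-trans points↭ (Permₚ.++⁺ˡ (ends S) (↭-trans (Permₚ.++⁺ˡ (points U) (glued-pts (proj₂ glued)))
      (Perm.↭-reflexive (trans (cong (points U ++_) (sym (points-circles lbl circles))) (sym (points-++ U))))))

    reglued-removes : ∀ lbl → Removes G (reglued lbl)
    reglued-removes lbl = record
      { unique = Unique-++⁻ʳ (ends S) (Unique-↭ (reglued-points lbl) uG)
      ; keeps = λ m un → [ (λ k → ⊥-elim (true≢false (trans (sym (marked-ends k)) un))) , id ]′ (∈-++⁻ (ends S) (↭⇒∈ (reglued-points lbl) m))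
      ; only = λ m → ↭⇒∈ (↭-sym (reglued-points lbl)) (∈-++⁺ʳ (ends S) m) , un m
      }
      where
      un : ∀ {p} → p ∈ points (reglued lbl) → Unmarked p
      un m with ∈-++⁻ (points U) (subst (_ ∈_) (points-++ U) m)
      ... | inj₁ k = unmarked-U k
      ... | inj₂ k = unmarked-words (↭⇒∈ (↭-sym (glued-pts (proj₂ glued))) (subst (_ ∈_) (points-circles lbl circles) k))

    -- The run of the algorithm yields its own list `M` of joined pairs, in the order and direction
    -- of traversal. Both `M` and the explicit matching `N` list the pairs of `idf` on all ends, so
    -- they agree up to flips.
    reglued-curveCount : ∀ lbl {N M₀} → Unique (flat M₀) → (∀ {p} → p ∈ flat M₀ → Unmarked p) →
      (∀ {a b} → (a , b) ∈ N → b ≡ idf a × a ∈ ends S) →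
      (∀ {p} → p ∈ ends S → (p , idf p) ∈ N ⊎ (idf p , p) ∈ N) →
      curveCount (reglued lbl) M₀ ≡ curveCount G (N ++ M₀)
    reglued-curveCount lbl {N} {M₀} uM un N⁻ N⁺ = sym (begin
      empties G ℕ.+ curves (arcs G) (N ++ M₀)
        ≡⟨ cong₂ ℕ._+_ (CutOf.empties≡ cutOf) (trans (curves-flippedʳ to fro) (curves-↭ {M = M ++ M₀} perm ↭-refl)) ⟩
      empties U ℕ.+ curves (strandArcs S ++ arcs U) (M ++ M₀)
        ≡⟨ cong (empties U ℕ.+_) (glued-curves {L = arcs U} {M₀} g
             (Unique-↭ (↭-trans (↭-sym (flat-arcs G)) (flat-↭ perm)) uG) uMM₀) ⟩
      empties U ℕ.+ (bares circles ℕ.+ curves (circlesArcs circles ++ arcs U) M₀)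
        ≡⟨ sym (ℕₚ.+-assoc (empties U) (bares circles) _) ⟩
      (empties U ℕ.+ bares circles) ℕ.+ curves (circlesArcs circles ++ arcs U) M₀
        ≡⟨ cong₂ ℕ._+_ (trans (cong (empties U ℕ.+_) (sym (empties-circles lbl circles))) (sym (empties-++ U)))
             (curves-↭ {M = M₀} (↭-trans (Permₚ.++-comm (circlesArcs circles) (arcs U))
               (Perm.↭-reflexive (trans (cong (arcs U ++_) (sym (arcs-circles lbl circles))) (sym (arcs-++ U))))) ↭-refl) ⟩
      empties (reglued lbl) ℕ.+ curves (arcs (reglued lbl)) M₀ ∎)
      where
      open ≡-Reasoning
      M : List (Pt × Pt)
      M = proj₁ glued
      g : Glued S circles M
      g = proj₂ glued
      perm : arcs G ↭ strandArcs S ++ arcs U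
      perm = ↭-trans (CutOf.arcs↭ cutOf) (Permₚ.++-comm (arcs U) (strandArcs S))
      flatM : ends S ↭ flat M
      flatM = glued-ends g
      M⁻ : ∀ {a b} → (a , b) ∈ M → b ≡ idf a
      M⁻ = glued-matching g
      uMM₀ : Unique (flat (M ++ M₀))
      uMM₀ = subst Unique (sym (flat-++ M M₀)) (Unique-++⁺ (Unique-↭ flatM (Paired.unique P)) uM
        (λ m k → true≢false (trans (sym (marked-ends (↭⇒∈ (↭-sym flatM) m))) (un k))))
      to : flipped (N ++ M₀) (M ++ M₀)
      to m with ∈-++⁻ N m
      ... | inj₂ k = inj₁ (∈-++⁺ʳ M k)
      ... | inj₁ k with N⁻ k
      ... | refl , a∈ with ∈-flat⁻ M (↭⇒∈ flatM a∈)
      ... | y , inj₁ j with M⁻ j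
      ... | refl = inj₁ (∈-++⁺ˡ j)
      to m | inj₁ k | refl , a∈ | y , inj₂ j with M⁻ j
      ... | refl rewrite Paired.involutive P (↭⇒∈ (↭-sym flatM) (∈-flat₁ j)) = inj₂ (∈-++⁺ˡ j)
      fro : flipped (M ++ M₀) (N ++ M₀)
      fro m with ∈-++⁻ M m
      ... | inj₂ k = inj₁ (∈-++⁺ʳ N k)
      ... | inj₁ k with M⁻ k
      ... | refl with N⁺ (↭⇒∈ (↭-sym flatM) (∈-flat₁ k))
      ... | inj₁ j = inj₁ (∈-++⁺ˡ j)
      ... | inj₂ j = inj₂ (∈-++⁺ˡ j)

-- Deletion as links across the removed arrows

module Deleting (r : ℕ → Bool) where
  open Cutting r public

  kept : List Ent → List Ent
  kept = filterᵇ (λ x → not (r (lab x)))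

  -- Deletion removes an arrow but leaves its arc, which in terms of endpoints is a link from one
  -- end of the arrow to the other.
  bypass : List Ent → List (Pt × Pt)
  bypass [] = []
  bypass (x ∷ w) = if r (lab x) then (entryPt x , exitPt x) ∷ bypass w else bypass w

  kept-arcs : ∀ w {p q L M} → Unique (flat (arcsFrom p w q ++ L)) → Unique (flat (bypass w ++ M)) →
    curves (arcsFrom p w q ++ L) (bypass w ++ M) ≡ curves (arcsFrom p (kept w) q ++ L) M
  kept-arcs [] uL uM = refl
  kept-arcs (x ∷ w) {p} {q} {L} {M} uL uM with r (lab x)
  ... | true = trans (curves-fuse [] {w′ = w} uL uM) (kept-arcs w (Unique-++⁻ʳ (_ ∷ _ ∷ []) (Unique-↭ (flat-fuse [] {w′ = w}) uL)) (Unique-++⁻ʳ (_ ∷ _ ∷ []) uM))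
  ... | false = trans (curves-↭ {M = bypass w ++ M} (perm w) ↭-refl)
      (trans (kept-arcs w (Unique-↭ (flat-↭ (perm w)) uL) uM) (sym (curves-↭ {M = M} (perm (kept w)) ↭-refl)))
    where
    perm : ∀ v → (p , entryPt x) ∷ arcsFrom (exitPt x) v q ++ L ↭ arcsFrom (exitPt x) v q ++ (p , entryPt x) ∷ L
    perm v = ↭-sym (Permₚ.shift (p , entryPt x) (arcsFrom (exitPt x) v q) L)

  -- The first arrow is the base point of the recorded circle. If it goes, its link closes the
  -- remaining strand, possibly to a bare circle, and the next arrow becomes the base point; if it
  -- stays, so does the base point.
  kept-circle : ∀ w {L M} → Unique (flat (circleArcs w ++ L)) → Unique (flat (bypass w ++ M)) →
    bare w ℕ.+ curves (circleArcs w ++ L) (bypass w ++ M) ≡ bare (kept w) ℕ.+ curves (circleArcs (kept w) ++ L) M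
  kept-circle [] uL uM = refl
  kept-circle (x ∷ w) {L} {M} uL uM with r (lab x)
  ... | true = trans (curves-close w uL uM) (kept-circle w (Unique-++⁻ʳ (_ ∷ _ ∷ []) (Unique-↭ (flat-close {w = w}) uL)) (Unique-++⁻ʳ (_ ∷ _ ∷ []) uM))
  ... | false = kept-arcs w uL uM

  pts-kept : ∀ w {X} → Unique (pts w ++ X) → Unique (pts (kept w) ++ X)
  pts-kept w {X} u = Unique-++⁺ (go w (Unique-++⁻ˡ (pts w) u)) (Unique-++⁻ʳ (pts w) u)
      (λ m k → Unique-disjoint (pts w) u (sub w m) k)
    where
    sub : ∀ w {p} → p ∈ pts (kept w) → p ∈ pts w
    sub (x ∷ w) m with r (lab x)
    sub (x ∷ w) m | true = there (there (sub w m))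
    sub (x ∷ w) (here e) | false = here e
    sub (x ∷ w) (there (here e)) | false = there (here e)
    sub (x ∷ w) (there (there m)) | false = there (there (sub w m))
    go : ∀ w → Unique (pts w) → Unique (pts (kept w))
    go [] u = u
    go (x ∷ w) ((n ∷ ns) ∷ ms ∷ u) with r (lab x)
    ... | true = go w u
    ... | false = (n ∷ All.tabulate (λ k → All.lookup ns (sub w k))) ∷ All.tabulate (λ k → All.lookup ms (sub w k)) ∷ go w u

  deleted : VPAP → VPAP
  deleted = map (λ c → proj₁ c , kept (proj₂ c))

  bypasses : VPAP → List (Pt × Pt)
  bypasses [] = []
  bypasses (c ∷ G) = bypass (proj₂ c) ++ bypasses G

  -- The list `L` is what makes the induction work: it receives the circles already processed, so
  -- that the link lists always belong to the circles still ahead.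
  deleted-curves : ∀ G {L M} → Unique (flat (arcs G ++ L)) → Unique (flat (bypasses G ++ M)) →
    empties G ℕ.+ curves (arcs G ++ L) (bypasses G ++ M) ≡ empties (deleted G) ℕ.+ curves (arcs (deleted G) ++ L) M
  deleted-curves [] uL uM = refl
  deleted-curves ((l , w) ∷ G) {L} {M} uL uM
    rewrite Listₚ.++-assoc (bypass w) (bypasses G) M
          | Listₚ.++-assoc (circleArcs w) (arcs G) L = begin
      (bare w ℕ.+ empties G) ℕ.+ curves (circleArcs w ++ arcs G ++ L) (bypass w ++ bypasses G ++ M)
        ≡⟨ flipAdd (bare w) (empties G) _ ⟩
      empties G ℕ.+ (bare w ℕ.+ curves (circleArcs w ++ arcs G ++ L) (bypass w ++ bypasses G ++ M))
        ≡⟨ cong (empties G ℕ.+_) (kept-circle w uL uM) ⟩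
      empties G ℕ.+ (bare (kept w) ℕ.+ curves (circleArcs (kept w) ++ arcs G ++ L) (bypasses G ++ M))
        ≡⟨ sym (flipAdd (bare (kept w)) (empties G) _) ⟩
      (bare (kept w) ℕ.+ empties G) ℕ.+ curves (circleArcs (kept w) ++ arcs G ++ L) (bypasses G ++ M)
        ≡⟨ trans (ℕₚ.+-assoc (bare (kept w)) (empties G) _) (cong (λ z → bare (kept w) ℕ.+ (empties G ℕ.+ z)) (curves-↭ {M = bypasses G ++ M} perm ↭-refl)) ⟩
      bare (kept w) ℕ.+ (empties G ℕ.+ curves (arcs G ++ circleArcs (kept w) ++ L) (bypasses G ++ M))
        ≡⟨ cong (bare (kept w) ℕ.+_) (deleted-curves G {circleArcs (kept w) ++ L} uL′ uM′) ⟩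
      bare (kept w) ℕ.+ (empties (deleted G) ℕ.+ curves (arcs (deleted G) ++ circleArcs (kept w) ++ L) M)
        ≡⟨ trans (sym (ℕₚ.+-assoc (bare (kept w)) (empties (deleted G)) _)) (cong (bare (kept w) ℕ.+ empties (deleted G) ℕ.+_) (curves-↭ {M = M} perm′ ↭-refl)) ⟩
      (bare (kept w) ℕ.+ empties (deleted G)) ℕ.+ curves ((circleArcs (kept w) ++ arcs (deleted G)) ++ L) M ∎
    where
    open ≡-Reasoning
    flipAdd : ∀ a b c → (a ℕ.+ b) ℕ.+ c ≡ b ℕ.+ (a ℕ.+ c)
    flipAdd a b c = trans (cong (ℕ._+ c) (ℕₚ.+-comm a b)) (ℕₚ.+-assoc b a c)
    perm : circleArcs (kept w) ++ arcs G ++ L ↭ arcs G ++ circleArcs (kept w) ++ L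
    perm = solve 3 (λ a b c → (a ⊕ (b ⊕ c)) ⊜ (b ⊕ (a ⊕ c))) ↭-refl (circleArcs (kept w)) (arcs G) L
    perm′ : arcs (deleted G) ++ circleArcs (kept w) ++ L ↭ (circleArcs (kept w) ++ arcs (deleted G)) ++ L
    perm′ = solve 3 (λ a b c → (b ⊕ (a ⊕ c)) ⊜ ((a ⊕ b) ⊕ c)) ↭-refl (circleArcs (kept w)) (arcs (deleted G)) L
    uL′ : Unique (flat (arcs G ++ circleArcs (kept w) ++ L))
    uL′ = Unique-↭ (flat-↭ perm) (Unique-↭ (↭-sym (flat-++-↭ (flat-circleArcs (kept w)) (↭-refl {x = flat (arcs G ++ L)})))
      (pts-kept w (Unique-↭ (flat-++-↭ (flat-circleArcs w) (↭-refl {x = flat (arcs G ++ L)})) uL)))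
    uM′ : Unique (flat (bypasses G ++ M))
    uM′ = Unique-++⁻ʳ (flat (bypass w)) (subst Unique (flat-++ (bypass w) (bypasses G ++ M)) uM)

  kept-only : ∀ w {p} → p ∈ pts (kept w) → p ∈ pts w × Unmarked p
  kept-only (x ∷ w) m with r (lab x) in rx
  kept-only (x ∷ w) m | true = there (there (proj₁ (kept-only w m))) , proj₂ (kept-only w m)
  kept-only (x ∷ w) (here refl) | false = here refl , rx
  kept-only (x ∷ w) (there (here refl)) | false = there (here refl) , rx
  kept-only (x ∷ w) (there (there m)) | false = there (there (proj₁ (kept-only w m))) , proj₂ (kept-only w m)

  kept-keeps : ∀ w {p} → p ∈ pts w → Unmarked p → p ∈ pts (kept w)
  kept-keeps (x ∷ w) m un with r (lab x) in rx
  kept-keeps (x ∷ w) (here refl) un | true = ⊥-elim (true≢false (trans (sym rx) un))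
  kept-keeps (x ∷ w) (there (here refl)) un | true = ⊥-elim (true≢false (trans (sym rx) un))
  kept-keeps (x ∷ w) (there (there m)) un | true = kept-keeps w m un
  kept-keeps (x ∷ w) (here refl) un | false = here refl
  kept-keeps (x ∷ w) (there (here refl)) un | false = there (here refl)
  kept-keeps (x ∷ w) (there (there m)) un | false = there (there (kept-keeps w m un))

  deleted-removes : ∀ G → Unique (points G) → Removes G (deleted G)
  deleted-removes G u = record { unique = go G u ; keeps = keeps G ; only = only G }
    where
    keeps : ∀ G {p} → p ∈ points G → Unmarked p → p ∈ points (deleted G)
    keeps (c ∷ G) m un with ∈-++⁻ (pts (proj₂ c)) m
    ... | inj₁ k = ∈-++⁺ˡ (kept-keeps (proj₂ c) k un)
    ... | inj₂ k = ∈-++⁺ʳ (pts (kept (proj₂ c))) (keeps G k un)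
    only : ∀ G {p} → p ∈ points (deleted G) → p ∈ points G × Unmarked p
    only (c ∷ G) m with ∈-++⁻ (pts (kept (proj₂ c))) m
    ... | inj₁ k = ∈-++⁺ˡ (proj₁ (kept-only (proj₂ c) k)) , proj₂ (kept-only (proj₂ c) k)
    ... | inj₂ k = ∈-++⁺ʳ (pts (proj₂ c)) (proj₁ (only G k)) , proj₂ (only G k)
    go : ∀ G → Unique (points G) → Unique (points (deleted G))
    go [] u = u
    go (c ∷ G) u = Unique-++⁺ (Unique-++⁻ˡ (pts (kept (proj₂ c))) (pts-kept (proj₂ c) u)) (go G (Unique-++⁻ʳ (pts (proj₂ c)) u))
      (λ m k → Unique-disjoint (pts (proj₂ c)) u (proj₁ (kept-only (proj₂ c) m)) (proj₁ (only G k)))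

  ∈-bypass⁻ : ∀ w {a b} → (a , b) ∈ bypass w → ∃ λ x → x ∈ w × r (lab x) ≡ true × a ≡ entryPt x × b ≡ exitPt x
  ∈-bypass⁻ (x ∷ w) m with r (lab x) in rx
  ∈-bypass⁻ (x ∷ w) (here refl) | true = x , here refl , rx , refl , refl
  ∈-bypass⁻ (x ∷ w) (there m) | true = let y , y∈ , e = ∈-bypass⁻ w m in y , there y∈ , e
  ∈-bypass⁻ (x ∷ w) m | false = let y , y∈ , e = ∈-bypass⁻ w m in y , there y∈ , e

  ∈-bypass⁺ : ∀ w {x} → x ∈ w → r (lab x) ≡ true → (entryPt x , exitPt x) ∈ bypass w
  ∈-bypass⁺ (x ∷ w) (here refl) rx rewrite rx = here refl
  ∈-bypass⁺ (x ∷ w) (there m) ry with r (lab x)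
  ... | true = there (∈-bypass⁺ w m ry)
  ... | false = ∈-bypass⁺ w m ry

  ∈-bypasses⁻ : ∀ G {a b} → (a , b) ∈ bypasses G → ∃ λ x → entryPt x ∈ points G × exitPt x ∈ points G × r (lab x) ≡ true × a ≡ entryPt x × b ≡ exitPt x
  ∈-bypasses⁻ (c ∷ G) m with ∈-++⁻ (bypass (proj₂ c)) m
  ... | inj₁ k = let x , x∈ , e = ∈-bypass⁻ (proj₂ c) k in x , ∈-++⁺ˡ (∈-entryPt x∈) , ∈-++⁺ˡ (∈-exitPt x∈) , e
  ... | inj₂ k = let x , x∈ , x∈′ , e = ∈-bypasses⁻ G k in x , ∈-++⁺ʳ (pts (proj₂ c)) x∈ , ∈-++⁺ʳ (pts (proj₂ c)) x∈′ , e

  ∈-bypasses⁺ : ∀ G {p} → p ∈ points G → Marked p →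
    ∃ λ x → (entryPt x , exitPt x) ∈ bypasses G × (p ≡ entryPt x ⊎ p ≡ exitPt x)
  ∈-bypasses⁺ (c ∷ G) m mk with ∈-++⁻ (pts (proj₂ c)) m
  ... | inj₂ k = let x , x∈ , e = ∈-bypasses⁺ G k mk in x , ∈-++⁺ʳ (bypass (proj₂ c)) x∈ , e
  ... | inj₁ k with entries-∈ (proj₂ c) k
  ... | x , x∈ , inj₁ refl = x , ∈-++⁺ˡ (∈-bypass⁺ (proj₂ c) x∈ mk) , inj₁ refl
  ... | x , x∈ , inj₂ refl = x , ∈-++⁺ˡ (∈-bypass⁺ (proj₂ c) x∈ mk) , inj₂ refl

  flat-bypass⊆ : ∀ w {p} → p ∈ flat (bypass w) → p ∈ pts w × Marked p
  flat-bypass⊆ w m with ∈-flat⁻ (bypass w) m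
  ... | y , inj₁ k with ∈-bypass⁻ w k
  ... | x , x∈ , rx , refl , refl = ∈-entryPt x∈ , rx
  flat-bypass⊆ w m | y , inj₂ k with ∈-bypass⁻ w k
  ... | x , x∈ , rx , refl , refl = ∈-exitPt x∈ , rx

  Unique-bypass : ∀ w → Unique (pts w) → Unique (flat (bypass w))
  Unique-bypass [] u = u
  Unique-bypass (x ∷ w) ((n ∷ ns) ∷ ms ∷ u) with r (lab x)
  ... | true = (n ∷ All.tabulate (λ k → All.lookup ns (proj₁ (flat-bypass⊆ w k)))) ∷ All.tabulate (λ k → All.lookup ms (proj₁ (flat-bypass⊆ w k))) ∷ Unique-bypass w u
  ... | false = Unique-bypass w u

  flat-bypasses⊆ : ∀ G {p} → p ∈ flat (bypasses G) → p ∈ points G × Marked p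
  flat-bypasses⊆ (c ∷ G) m with ∈-++⁻ (flat (bypass (proj₂ c))) (subst (_ ∈_) (flat-++ (bypass (proj₂ c)) (bypasses G)) m)
  ... | inj₁ k = ∈-++⁺ˡ (proj₁ (flat-bypass⊆ (proj₂ c) k)) , proj₂ (flat-bypass⊆ (proj₂ c) k)
  ... | inj₂ k = ∈-++⁺ʳ (pts (proj₂ c)) (proj₁ (flat-bypasses⊆ G k)) , proj₂ (flat-bypasses⊆ G k)

  Unique-bypasses : ∀ G → Unique (points G) → Unique (flat (bypasses G))
  Unique-bypasses [] u = u
  Unique-bypasses (c ∷ G) u = subst Unique (sym (flat-++ (bypass (proj₂ c)) (bypasses G)))
    (Unique-++⁺ (Unique-bypass (proj₂ c) (Unique-++⁻ˡ (pts (proj₂ c)) u)) (Unique-bypasses G (Unique-++⁻ʳ (pts (proj₂ c)) u))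
      (λ m k → Unique-disjoint (pts (proj₂ c)) u (proj₁ (flat-bypass⊆ (proj₂ c) m)) (proj₁ (flat-bypasses⊆ G k))))

  deleted-curveCount : ∀ G {N M₀} → Unique (points G) → Unique (flat M₀) → (∀ {p} → p ∈ flat M₀ → Unmarked p) →
    flipped (bypasses G) N → flipped N (bypasses G) →
    curveCount (deleted G) M₀ ≡ curveCount G (N ++ M₀)
  deleted-curveCount G {N} {M₀} uG uM un f g = sym (trans
    (cong (empties G ℕ.+_) (trans (curves-flippedʳ (flipped-++ {X = N} g) (flipped-++ {X = bypasses G} f)) (cong (λ z → curves z (bypasses G ++ M₀)) (sym (Listₚ.++-identityʳ (arcs G))))))
    (trans (deleted-curves G {[]} uL uBM) (cong (λ z → empties (deleted G) ℕ.+ curves z M₀) (Listₚ.++-identityʳ (arcs (deleted G))))))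
    where
    uL : Unique (flat (arcs G ++ []))
    uL = subst (λ z → Unique (flat z)) (sym (Listₚ.++-identityʳ (arcs G))) (Unique-↭ (↭-sym (flat-arcs G)) uG)
    uBM : Unique (flat (bypasses G ++ M₀))
    uBM = subst Unique (sym (flat-++ (bypasses G) M₀)) (Unique-++⁺ (Unique-bypasses G uG) uM
      (λ m k → true≢false (trans (sym (proj₂ (flat-bypasses⊆ G m))) (un k))))

-- Counting blocks

relabel : (ℕ → ℕ) → VPAP → VPAP
relabel θ = map (λ c → θ (proj₁ c) , proj₂ c)

arcs-relabel : ∀ θ G → arcs (relabel θ G) ≡ arcs G
arcs-relabel θ [] = refl
arcs-relabel θ (c ∷ G) = cong (circleArcs (proj₂ c) ++_) (arcs-relabel θ G)

points-relabel : ∀ θ G → points (relabel θ G) ≡ points G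
points-relabel θ [] = refl
points-relabel θ (c ∷ G) = cong (pts (proj₂ c) ++_) (points-relabel θ G)

empties-relabel : ∀ θ G → empties (relabel θ G) ≡ empties G
empties-relabel θ [] = refl
empties-relabel θ (c ∷ G) = cong (bare (proj₂ c) ℕ.+_) (empties-relabel θ G)

curveCount-relabel : ∀ θ G M → curveCount (relabel θ G) M ≡ curveCount G M
curveCount-relabel θ G M = cong₂ (λ n L → n ℕ.+ curves L M) (empties-relabel θ G) (arcs-relabel θ G)

-- Block labels and points are the nodes of the graph whose components are the blocks.
Node : Set
Node = ℕ ⊎ Pt

_≟N_ : DecidableEquality Node
_≟N_ = Sumₚ.≡-dec ℕₚ._≟_ _≟P_

blockLinks : VPAP → List (Node × Node)
blockLinks [] = []
blockLinks (c ∷ G) = map (λ p → inj₁ (proj₁ c) , inj₂ p) (pts (proj₂ c)) ++ blockLinks G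

onPoints : List (Pt × Pt) → List (Node × Node)
onPoints = map (λ l → inj₂ (proj₁ l) , inj₂ (proj₂ l))

labels : VPAP → List Node
labels = map (inj₁ ∘ proj₁)

blockGraph : VPAP → List (Pt × Pt) → List (Node × Node)
blockGraph G J = blockLinks G ++ onPoints J

-- Only labels are counted. The points let `J` prescribe which blocks to merge without naming
-- labels, which other operations may have replaced in the meantime.
blockCount : VPAP → List (Pt × Pt) → ℕ
blockCount G J = Components.comps _≟N_ (labels G) (blockGraph G J)

∈-blockLinks⁺ : ∀ {G c p} → c ∈ G → p ∈ pts (proj₂ c) → (inj₁ (proj₁ c) , inj₂ p) ∈ blockLinks G
∈-blockLinks⁺ (here refl) m = ∈-++⁺ˡ (∈-map⁺ _ m)
∈-blockLinks⁺ {d ∷ G} (there k) m = ∈-++⁺ʳ (map _ (pts (proj₂ d))) (∈-blockLinks⁺ k m)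

data BlockEdge (G : VPAP) (J : List (Pt × Pt)) : Node → Node → Set where
  inside : ∀ {c p} → c ∈ G → p ∈ pts (proj₂ c) → BlockEdge G J (inj₁ (proj₁ c)) (inj₂ p)
  joined : ∀ {p q} → (p , q) ∈ J → BlockEdge G J (inj₂ p) (inj₂ q)

blockEdge : ∀ G {J a b} → (a , b) ∈ blockGraph G J → BlockEdge G J a b
blockEdge [] m with ∈-map⁻ _ m
... | l , k , refl = joined k
blockEdge (c ∷ G) {J} m with ∈-++⁻ (map (λ p → inj₁ (proj₁ c) , inj₂ p) (pts (proj₂ c)))
  (subst (_ ∈_) (Listₚ.++-assoc (map (λ p → inj₁ (proj₁ c) , inj₂ p) (pts (proj₂ c))) (blockLinks G) (onPoints J)) m)
... | inj₁ k with ∈-map⁻ _ k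
... | p , p∈ , refl = inside (here refl) p∈
blockEdge (c ∷ G) {J} m | inj₂ k with blockEdge G k
... | inside d∈ p∈ = inside (there d∈) p∈
... | joined j = joined j

inside∼ : ∀ {G J c p} → c ∈ G → p ∈ pts (proj₂ c) → inj₁ (proj₁ c) ∼[ blockGraph G J ] inj₂ p
inside∼ c∈ p∈ = link (∈-++⁺ˡ (∈-blockLinks⁺ c∈ p∈))

joined∼ : ∀ {G J p q} → (p , q) ∈ J → inj₂ p ∼[ blockGraph G J ] inj₂ q
joined∼ {G} j = link (∈-++⁺ʳ (blockLinks G) (∈-map⁺ _ j))

isArrow : ℕ → Bool → Ent → Bool
isArrow l s x = (lab x ≡ᵇ l) ∧ beq (side x) s

∧-true : ∀ {a b} → (a ∧ b) ≡ true → a ≡ true × b ≡ true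
∧-true {true} {true} _ = refl , refl

any-∈⁻ : (f : A → Bool) (w : List A) → any f w ≡ true → ∃ λ x → x ∈ w × f x ≡ true
any-∈⁻ f (x ∷ w) e with f x in fx
... | true = x , here refl , fx
... | false = let y , y∈ , fy = any-∈⁻ f w e in y , there y∈ , fy

any-∈⁺ : (f : A → Bool) {w : List A} {x : A} → x ∈ w → f x ≡ true → any f w ≡ true
any-∈⁺ f (here refl) e rewrite e = refl
any-∈⁺ f {y ∷ w} (there m) e with f y
... | true = refl
... | false = any-∈⁺ f m e

inCircle⁺ : ∀ {c p} → p ∈ pts (proj₂ c) → inCircle (plab p) (pside p) c ≡ true
inCircle⁺ {l , w} m with entries-∈ w m
... | x , x∈ , inj₁ refl = any-∈⁺ (isArrow (lab x) (side x)) x∈ (cong₂ _∧_ (≡ᵇ-refl (lab x)) (beq-refl (side x)))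
... | x , x∈ , inj₂ refl = any-∈⁺ (isArrow (lab x) (side x)) x∈ (cong₂ _∧_ (≡ᵇ-refl (lab x)) (beq-refl (side x)))

Bool-split : ∀ (a b : Bool) → a ≡ b ⊎ a ≡ not b
Bool-split false false = inj₁ refl
Bool-split false true = inj₂ refl
Bool-split true false = inj₂ refl
Bool-split true true = inj₁ refl

inCircle⁻ : ∀ {c} p → inCircle (plab p) (pside p) c ≡ true → p ∈ pts (proj₂ c)
inCircle⁻ {l , w} (pt a s h) e with any-∈⁻ (isArrow a s) w e
... | ent a′ s′ f , x∈ , ex with ∧-true {a′ ≡ᵇ a} ex
... | e₁ , e₂ rewrite ≡ᵇ-sound {a′} {a} e₁ | beq-sound {s′} {s} e₂ with Bool-split h f
... | inj₁ refl = ∈-exitPt x∈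
... | inj₂ refl = ∈-entryPt x∈

block : VPAP → Pt → ℕ
block G p = blockOf (plab p) (pside p) G

-- `blockOf` stops at the first circle that contains the arrow; as no endpoint is repeated, there is
-- no other.
block-circle : ∀ {G c p} → Unique (points G) → c ∈ G → p ∈ pts (proj₂ c) → block G p ≡ proj₁ c
block-circle {G = d ∷ G} {c} {p} u (here refl) m rewrite inCircle⁺ {d} m = refl
block-circle {G = d ∷ G} {c} {p} u (there k) m with inCircle (plab p) (pside p) d in eq
... | true = ⊥-elim (Unique-disjoint (pts (proj₂ d)) u (inCircle⁻ {d} p eq) (∈-points⁺ k m))
... | false = block-circle (Unique-++⁻ʳ (pts (proj₂ d)) u) k m

block∼ : ∀ {G J p} → Unique (points G) → p ∈ points G → inj₁ (block G p) ∼[ blockGraph G J ] inj₂ p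
block∼ {G} u m with ∈-points⁻ G m
... | c , c∈ , k = ≡⇒∼ (cong inj₁ (block-circle u c∈ k)) ◅◅ inside∼ c∈ k

-- How the operations change the number of blocks

module _ (r : ℕ → Bool) where
  open Cutting r

  -- The pattern behind all operations: the joins `J` among marked points, which vanish, are
  -- absorbed into the relabelling `θ`. A vanished point is sent by `ρ` to the new label of its
  -- block; in the other direction the identity serves, because `sound` says that `θ` moves a label
  -- only within its component.
  module BlockTransfer {G R : VPAP} (θ : ℕ → ℕ) (J J₀ : List (Pt × Pt))
    (uG : Unique (points G)) (rem : Removes G R)
    (labelled : ∀ {d p} → d ∈ R → p ∈ pts (proj₂ d) →
                proj₁ d ≡ θ (block G p) × inj₁ (proj₁ d) ∼[ blockGraph G (J ++ J₀) ] inj₂ p)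
    (tot : ∀ {c} → c ∈ G → ∃ λ d → d ∈ R × proj₁ d ≡ θ (proj₁ c))
    (sur : ∀ {d} → d ∈ R → ∃ λ c → c ∈ G × proj₁ d ≡ θ (proj₁ c))
    (marked : ∀ {a b} → (a , b) ∈ J → Marked a × Marked b × θ (block G a) ≡ θ (block G b))
    (unmarked : ∀ {a b} → (a , b) ∈ J₀ → Unmarked a × Unmarked b)
    (sound : ∀ {c} → c ∈ G → inj₁ (θ (proj₁ c)) ∼[ blockGraph G (J ++ J₀) ] inj₁ (proj₁ c)) where

    ρ : Node → Node
    ρ (inj₁ l) = inj₁ (θ l)
    ρ (inj₂ p) = if r (plab p) then inj₁ (θ (block G p)) else inj₂ p

    ρ-marked : ∀ {p} → Marked p → ρ (inj₂ p) ≡ inj₁ (θ (block G p))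
    ρ-marked m rewrite m = refl

    ρ-unmarked : ∀ {p} → Unmarked p → ρ (inj₂ p) ≡ inj₂ p
    ρ-unmarked m rewrite m = refl

    forth : ∀ {a b} → BlockEdge G (J ++ J₀) a b → ρ a ∼[ blockGraph R J₀ ] ρ b
    forth (inside {c} {p} c∈ p∈) with r (plab p) in rp
    ... | true = ≡⇒∼ (cong (inj₁ ∘ θ) (sym (block-circle uG c∈ p∈)))
    ... | false with ∈-points⁻ R (Removes.keeps rem (∈-points⁺ c∈ p∈) rp)
    ... | d , d∈ , k = ≡⇒∼ (cong inj₁ (trans (cong θ (sym (block-circle uG c∈ p∈))) (sym (proj₁ (labelled d∈ k))))) ◅◅ inside∼ d∈ k
    forth (joined j) with ∈-++⁻ J j
    ... | inj₁ k with marked k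
    ... | ma , mb , e = ≡⇒∼ (trans (ρ-marked ma) (trans (cong inj₁ e) (sym (ρ-marked mb))))
    forth (joined j) | inj₂ k with unmarked k
    ... | ua , ub = ≡⇒∼ (ρ-unmarked ua) ◅◅ joined∼ {R} {J₀} k ◅◅ ≡⇒∼ (sym (ρ-unmarked ub))

    back : ∀ {a b} → BlockEdge R J₀ a b → a ∼[ blockGraph G (J ++ J₀) ] b
    back (inside d∈ p∈) = proj₂ (labelled d∈ p∈)
    back (joined j) = joined∼ {G} (∈-++⁺ʳ J j)

    blockCount≡ : blockCount G (J ++ J₀) ≡ blockCount R J₀
    blockCount≡ = comps-transfer _≟N_ _≟N_ ρ id (forth ∘ blockEdge G) (back ∘ blockEdge R) σρ tot′ sur′
      where
      σρ : ∀ {x} → x ∈ labels G → ρ x ∼[ blockGraph G (J ++ J₀) ] x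
      σρ m with ∈-map⁻ _ m
      ... | c , c∈ , refl = sound c∈
      tot′ : ∀ {x} → x ∈ labels G → ∃ λ y → y ∈ labels R × ρ x ∼[ blockGraph R J₀ ] y
      tot′ m with ∈-map⁻ _ m
      ... | c , c∈ , refl = let d , d∈ , e = tot c∈ in _ , ∈-map⁺ _ d∈ , ≡⇒∼ (cong inj₁ (sym e))
      sur′ : ∀ {y} → y ∈ labels R → ∃ λ x → x ∈ labels G × ρ x ∼[ blockGraph R J₀ ] y
      sur′ m with ∈-map⁻ _ m
      ... | d , d∈ , refl = let c , c∈ , e = sur d∈ in _ , ∈-map⁺ _ c∈ , ≡⇒∼ (cong inj₁ (sym e))

Removes-relabel : ∀ {r G R} θ → Cutting.Removes r G R → Cutting.Removes r G (relabel θ R)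
Removes-relabel {r} {G} {R} θ rem = record
  { unique = subst Unique (sym (points-relabel θ R)) (Cutting.Removes.unique rem)
  ; keeps = λ m un → subst (_ ∈_) (sym (points-relabel θ R)) (Cutting.Removes.keeps rem m un)
  ; only = λ m → Cutting.Removes.only rem (subst (_ ∈_) (points-relabel θ R) m)
  }

module _ (r : ℕ → Bool) (idf : Pt → Pt) (G : VPAP) where
  open Regluing r idf G

  module ReglueClass
    (uG : Unique (points G)) (P : Paired (ends S))
    {_≈_ : Pt → Pt → Set} (eq : IsEquivalence _≈_)
    (same : ∀ {c p q} → c ∈ G → p ∈ pts (proj₂ c) → q ∈ pts (proj₂ c) → p ≈ q)
    (linked : ∀ {p} → p ∈ ends S → p ≈ idf p) where

    private
      coherent : Class.Coherent eq S
      coherent t∈ with CutOf.strands cutOf t∈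
      ... | c , c∈ , o = same c∈ (StrandOf.start∈ o) (StrandOf.stop∈ o)
                       , (λ m → same c∈ (StrandOf.start∈ o) (StrandOf.word∈ o m))

    class : ∀ {c} → c ∈ circles → ∀ {x y} → x ∈ proj₂ c → y ∈ pts (proj₁ c) ⊎ y ∈ proj₂ c → x ≈ y
    class = Class.glued-class eq (proj₂ (glued uG P)) coherent linked

∈-tracks⁻ : ∀ T {p} → p ∈ tracks T → ∃ λ c → c ∈ T × p ∈ proj₂ c
∈-tracks⁻ (c ∷ T) m with ∈-++⁻ (proj₂ c) m
... | inj₁ k = c , here refl , k
... | inj₂ k = let d , d∈ , l = ∈-tracks⁻ T k in d , there d∈ , l

∈-tracks⁺ : ∀ {T c p} → c ∈ T → p ∈ proj₂ c → p ∈ tracks T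
∈-tracks⁺ (here refl) m = ∈-++⁺ˡ m
∈-tracks⁺ {d ∷ T} (there k) m = ∈-++⁺ʳ (proj₂ d) (∈-tracks⁺ k m)

track-end : ∀ {idf S T M c p} → Gluing.Glued idf S T M → c ∈ T → p ∈ proj₂ c → p ∈ ends S
track-end {idf} g c∈ m = ↭⇒∈ (↭-sym (Gluing.glued-tracks idf g)) (∈-tracks⁺ c∈ m)

module _ (r : ℕ → Bool) (idf : Pt → Pt) (G : VPAP) where
  open Regluing r idf G

  -- Two compatibilities of `idf` are required: `linked∼` keeps each new circle within one component
  -- of the old graph, and `linkedθ` makes all points of a new circle agree on one new label.
  module ReglueBlocks
    (uG : Unique (points G)) (P : Paired (ends S))
    (θ : ℕ → ℕ) (lbl : List Ent × List Pt → ℕ) (J J₀ : List (Pt × Pt))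
    (marked : ∀ {a b} → (a , b) ∈ J → Marked a × Marked b × θ (block G a) ≡ θ (block G b))
    (unmarked : ∀ {a b} → (a , b) ∈ J₀ → Unmarked a × Unmarked b)
    (sound : ∀ {c} → c ∈ G → inj₁ (θ (proj₁ c)) ∼[ blockGraph G (J ++ J₀) ] inj₁ (proj₁ c))
    (linked∼ : ∀ {p} → p ∈ ends S → inj₂ p ∼[ blockGraph G (J ++ J₀) ] inj₂ (idf p))
    (linkedθ : ∀ {p} → p ∈ ends S → θ (block G p) ≡ θ (block G (idf p)))
    where

    private
      g : Glued S circles (proj₁ (glued uG P))
      g = proj₂ (glued uG P)

      class∼ : ∀ {c} → c ∈ circles → ∀ {x y} → x ∈ proj₂ c → y ∈ pts (proj₁ c) ⊎ y ∈ proj₂ c →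
        inj₂ x ∼[ blockGraph G (J ++ J₀) ] inj₂ y
      class∼ = ReglueClass.class r idf G uG P (On.isEquivalence inj₂ (EqC.isEquivalence (λ a b → (a , b) ∈ blockGraph G (J ++ J₀))))
        (λ c∈ p∈ q∈ → ∼-sym (inside∼ c∈ p∈) ◅◅ inside∼ c∈ q∈) linked∼

      classθ : ∀ {c} → c ∈ circles → ∀ {x y} → x ∈ proj₂ c → y ∈ pts (proj₁ c) ⊎ y ∈ proj₂ c →
        θ (block G x) ≡ θ (block G y)
      classθ = ReglueClass.class r idf G uG P (On.isEquivalence (λ p → θ (block G p)) (isEquivalence {A = ℕ}))
        (λ c∈ p∈ q∈ → cong θ (trans (block-circle uG c∈ p∈) (sym (block-circle uG c∈ q∈)))) linkedθ

    module _ (lbl-from : ∀ {c} → c ∈ circles → ∃ λ p → p ∈ proj₂ c × lbl c ≡ block G p) where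

      private
        split : ∀ {d} → d ∈ relabel θ (reglued lbl) →
          (∃ λ c → c ∈ U × d ≡ (θ (proj₁ c) , proj₂ c)) ⊎ (∃ λ c → c ∈ circles × d ≡ (θ (lbl c) , proj₁ c))
        split m with ∈-map⁻ _ m
        ... | c , k , refl with ∈-++⁻ U k
        ... | inj₁ j = inj₁ (c , j , refl)
        ... | inj₂ j with ∈-map⁻ _ j
        ... | c′ , j′ , refl = inj₂ (c′ , j′ , refl)

        labelled : ∀ {d p} → d ∈ relabel θ (reglued lbl) → p ∈ pts (proj₂ d) →
          proj₁ d ≡ θ (block G p) × inj₁ (proj₁ d) ∼[ blockGraph G (J ++ J₀) ] inj₂ p
        labelled m p∈ with split m
        ... | inj₁ (c , c∈ , refl) = cong θ (sym (block-circle uG c∈G p∈)) , sound c∈G ◅◅ inside∼ c∈G p∈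
          where c∈G = proj₁ (CutOf.rest cutOf c∈)
        ... | inj₂ (c , c∈ , refl) with lbl-from c∈
        ... | x , x∈ , e with ∈-points⁻ G (ends⊆ (track-end g c∈ x∈))
        ... | b , b∈ , k = trans (cong θ e) (classθ c∈ x∈ (inj₁ p∈)) ,
            ≡⇒∼ (cong inj₁ (cong θ (trans e (block-circle uG b∈ k)))) ◅◅ sound b∈ ◅◅ inside∼ b∈ k ◅◅ class∼ c∈ x∈ (inj₁ p∈)

        tot : ∀ {c} → c ∈ G → ∃ λ d → d ∈ relabel θ (reglued lbl) × proj₁ d ≡ θ (proj₁ c)
        tot {c} c∈ with CutOf.either cutOf c∈
        ... | inj₁ k = _ , ∈-map⁺ _ (∈-++⁺ˡ k) , refl
        -- A circle that was cut has left a strand behind, and the new circle through the start of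
        -- that strand carries the required label.
        ... | inj₂ (t , t∈ , s∈) with ∈-tracks⁻ circles (↭⇒∈ (glued-tracks g) (∈-ends (∈-points⁺ c∈ s∈) (StrandOf.start! (proj₂ (proj₂ (CutOf.strands cutOf t∈))))))
        ... | b , b∈ , k with lbl-from b∈
        ... | x , x∈ , e = _ , ∈-map⁺ _ (∈-++⁺ʳ U (∈-map⁺ _ b∈)) ,
            trans (cong θ e) (trans (classθ b∈ x∈ (inj₂ k)) (cong θ (block-circle uG c∈ s∈)))

        sur : ∀ {d} → d ∈ relabel θ (reglued lbl) → ∃ λ c → c ∈ G × proj₁ d ≡ θ (proj₁ c)
        sur m with split m
        ... | inj₁ (c , c∈ , refl) = c , proj₁ (CutOf.rest cutOf c∈) , refl
        ... | inj₂ (c , c∈ , refl) with lbl-from c∈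
        ... | x , x∈ , e with ∈-points⁻ G (ends⊆ (track-end g c∈ x∈))
        ... | b , b∈ , k = b , b∈ , cong θ (trans e (block-circle uG b∈ k))

      reglued-blockCount : blockCount (relabel θ (reglued lbl)) J₀ ≡ blockCount G (J ++ J₀)
      reglued-blockCount = sym (BlockTransfer.blockCount≡ r {G} {relabel θ (reglued lbl)} θ J J₀ uG
        (Removes-relabel {r} θ (reglued-removes uG P lbl)) labelled tot sur marked unmarked sound)

module _ (r : ℕ → Bool) (G : VPAP) where
  open Deleting r

  module DeleteBlocks
    (uG : Unique (points G)) (θ : ℕ → ℕ) (J J₀ : List (Pt × Pt))
    (marked : ∀ {a b} → (a , b) ∈ J → Marked a × Marked b × θ (block G a) ≡ θ (block G b))
    (unmarked : ∀ {a b} → (a , b) ∈ J₀ → Unmarked a × Unmarked b)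
    (sound : ∀ {c} → c ∈ G → inj₁ (θ (proj₁ c)) ∼[ blockGraph G (J ++ J₀) ] inj₁ (proj₁ c)) where

    private
      from : ∀ {d} → d ∈ relabel θ (deleted G) → ∃ λ c → c ∈ G × d ≡ (θ (proj₁ c) , kept (proj₂ c))
      from m with ∈-map⁻ _ m
      ... | c , k , refl with ∈-map⁻ _ k
      ... | c′ , k′ , refl = c′ , k′ , refl

      labelled : ∀ {d p} → d ∈ relabel θ (deleted G) → p ∈ pts (proj₂ d) →
        proj₁ d ≡ θ (block G p) × inj₁ (proj₁ d) ∼[ blockGraph G (J ++ J₀) ] inj₂ p
      labelled m p∈ with from m
      ... | c , c∈ , refl with kept-only (proj₂ c) p∈
      ... | k , _ = cong θ (sym (block-circle uG c∈ k)) , sound c∈ ◅◅ inside∼ c∈ k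

    deleted-blockCount : blockCount (relabel θ (deleted G)) J₀ ≡ blockCount G (J ++ J₀)
    deleted-blockCount = sym (BlockTransfer.blockCount≡ r {G} {relabel θ (deleted G)} θ J J₀ uG
      (Removes-relabel {r} θ (deleted-removes G uG)) labelled
      (λ c∈ → _ , ∈-map⁺ _ (∈-map⁺ _ c∈) , refl)
      (λ d∈ → let c , c∈ , e = from d∈ in c , c∈ , cong proj₁ e) marked unmarked sound)

-- Deletion and contraction of one edge

data Op : Set where
  del con pen mdel : Op

app : Op → ℕ → VPAP → VPAP
app del  = delete
app con  = contract
app pen  = penrose
app mdel = mdelete

-- `g` tells which end of the second arrow a given end of the first is joined to: the opposite one
-- (`not`) in a contraction, the like one (`id`) in a Penrose-contraction.
cross : (Bool → Bool) → ℕ → List (Pt × Pt)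
cross g e = (pt e false false , pt e true (g false)) ∷ (pt e false true , pt e true (g true)) ∷ []

shortcut : ℕ → List (Pt × Pt)
shortcut e = (pt e false false , pt e false true) ∷ (pt e true false , pt e true true) ∷ []

matching : Op → ℕ → List (Pt × Pt)
matching del  = shortcut
matching con  = cross not
matching pen  = cross id
matching mdel = shortcut

both : ℕ → List (Pt × Pt)
both e = (pt e false false , pt e true false) ∷ []

-- This is the only place where deletion and merge-deletion differ. The tails of the two arrows
-- stand for the vertices incident with the edge.
joins : Op → ℕ → List (Pt × Pt)
joins del e = []
joins con e = both e
joins pen e = both e
joins mdel e = both e

-- Well-formedness in terms of endpoints: an edge has all four of them or none, and each occurs
-- once. In this form it passes to every result of an operation, since whole edges are removed.
record Proper (G : VPAP) : Set where
  field
    unique : Unique (points G)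
    full   : ∀ {p} → p ∈ points G → ∀ s h → pt (plab p) s h ∈ points G

Off : ℕ → List (Pt × Pt) → Set
Off e M = ∀ {p} → p ∈ flat M → (plab p ≡ᵇ e) ≡ false

offLinks : ∀ {e M a b} → Off e M → (a , b) ∈ M → (plab a ≡ᵇ e) ≡ false × (plab b ≡ᵇ e) ≡ false
offLinks o m = o (∈-flat₁ m) , o (∈-flat₂ m)

∼-block : ∀ {G J} → Unique (points G) → ∀ {p q} → p ∈ points G → q ∈ points G → block G p ≡ block G q →
  inj₂ p ∼[ blockGraph G J ] inj₂ q
∼-block {G} {J} u m k e = ∼-sym (block∼ {G} {J} u m) ◅◅ ≡⇒∼ (cong inj₁ e) ◅◅ block∼ {G} {J} u k

module EdgeOps (G : VPAP) (pG : Proper G) (e : ℕ) (e∈ : pt e false false ∈ points G) where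
  open Proper pG

  r : ℕ → Bool
  r l = l ≡ᵇ e

  open Deleting r public

  Lu Lv : ℕ
  Lu = blockOf e false G
  Lv = blockOf e true G

  θ : ℕ → ℕ
  θ l = if l ≡ᵇ Lv then Lu else l

  θ-Lv : θ Lv ≡ Lu
  θ-Lv rewrite ≡ᵇ-refl Lv = refl

  θ-Lu : θ Lu ≡ Lu
  θ-Lu with Lu ≡ᵇ Lv
  ... | true = refl
  ... | false = refl

  θ-edge : ∀ s h → θ (block G (pt e s h)) ≡ Lu
  θ-edge false h = θ-Lu
  θ-edge true h = θ-Lv

  e∈s : ∀ s h → pt e s h ∈ points G
  e∈s = full e∈

  marked-form : ∀ {p} → Marked p → p ≡ pt e (pside p) (phead p)
  marked-form {pt l s h} m rewrite ≡ᵇ-sound {l} {e} m = refl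

  marked-e : ∀ s h → Marked (pt e s h)
  marked-e s h = ≡ᵇ-refl e

  joined-both : ∀ {J s h s′ h′} → inj₂ (pt e s h) ∼[ blockGraph G (both e ++ J) ] inj₂ (pt e s′ h′)
  joined-both {J} {s} {h} {s′} {h′} = to-base s h ◅◅ ∼-sym (to-base s′ h′)
    where
    to-base : ∀ s h → inj₂ (pt e s h) ∼[ blockGraph G (both e ++ J) ] inj₂ (pt e false false)
    to-base false h = ∼-block {G} {both e ++ J} unique (e∈s false h) e∈ refl
    to-base true h = ∼-block {G} {both e ++ J} unique (e∈s true h) (e∈s true false) refl
      ◅◅ ∼-sym (joined∼ {G} {both e ++ J} (here refl))

  -- `θ` moves no label except `Lv`, and the link in `both e` joins the block `Lv` to its new name
  -- `Lu`.
  θ-sound : ∀ {J c} → c ∈ G → inj₁ (θ (proj₁ c)) ∼[ blockGraph G (both e ++ J) ] inj₁ (proj₁ c)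
  θ-sound {J} {c} c∈ with proj₁ c ≡ᵇ Lv in eq
  ... | false = ε
  ... | true = block∼ {G} {both e ++ J} unique (e∈s false false) ◅◅ joined-both {J} ◅◅ ∼-sym (block∼ {G} {both e ++ J} unique (e∈s true false))
      ◅◅ ≡⇒∼ (cong inj₁ (sym (≡ᵇ-sound eq)))

  marked-both : ∀ {a b} → (a , b) ∈ both e → Marked a × Marked b × θ (block G a) ≡ θ (block G b)
  marked-both (here refl) = marked-e false false , marked-e true false , trans θ-Lu (sym θ-Lv)

  bypass-shortcut : flipped (bypasses G) (shortcut e)
  bypass-shortcut m with ∈-bypasses⁻ G m
  ... | ent l s f , _ , _ , rx , refl , refl with ≡ᵇ-sound {l} {e} rx
  bypass-shortcut m | ent l false false , _ , _ , rx , refl , refl | refl = inj₂ (here refl)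
  bypass-shortcut m | ent l false true , _ , _ , rx , refl , refl | refl = inj₁ (here refl)
  bypass-shortcut m | ent l true false , _ , _ , rx , refl , refl | refl = inj₂ (there (here refl))
  bypass-shortcut m | ent l true true , _ , _ , rx , refl , refl | refl = inj₁ (there (here refl))

  shortcut-side : ∀ s → (pt e s false , pt e s true) ∈ bypasses G ⊎ (pt e s true , pt e s false) ∈ bypasses G
  shortcut-side s with ∈-bypasses⁺ G (e∈s s false) (marked-e s false)
  ... | ent l s′ false , k , inj₂ refl = inj₂ k
  ... | ent l s′ true , k , inj₁ refl = inj₁ k

  shortcut-bypass : flipped (shortcut e) (bypasses G)
  shortcut-bypass (here refl) = shortcut-side false
  shortcut-bypass (there (here refl)) = shortcut-side true

  -- The two contractions differ in `g` alone and are treated together.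
  module Contraction (g : Bool → Bool) (gg : ∀ h → g (g h) ≡ h) (idf : Pt → Pt)
    (idf-e : ∀ s h → idf (pt e s h) ≡ pt e (not s) (g h)) where

    module R = Regluing r idf G
    open R using (S; Paired)

    end-form : ∀ {p} → p ∈ ends S → p ≡ pt e (pside p) (phead p)
    end-form m = marked-form (R.marked-ends m)

    end-e : ∀ s h → pt e s h ∈ ends S
    end-e s h = R.∈-ends (e∈s s h) (marked-e s h)

    paired : Paired (ends S)
    paired = record
      { unique = Unique-++⁻ˡ (ends S) (Unique-↭ R.points↭ unique)
      ; closed = λ m → subst (λ z → idf z ∈ ends S) (sym (end-form m)) (subst (_∈ ends S) (sym (idf-e _ _)) (end-e _ _))
      ; involutive = λ m → subst (λ z → idf (idf z) ≡ z) (sym (end-form m)) (inv _ _)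
      ; fixfree = λ m → subst (λ z → idf z ≢ z) (sym (end-form m)) (fix _ _)
      }
      where
      inv : ∀ s h → idf (idf (pt e s h)) ≡ pt e s h
      inv s h rewrite idf-e s h | idf-e (not s) (g h) | gg h | Boolₚ.not-involutive s = refl
      fix : ∀ s h → idf (pt e s h) ≢ pt e s h
      fix false h i with trans (sym (idf-e false h)) i
      ... | ()
      fix true h i with trans (sym (idf-e true h)) i
      ... | ()

    crossing⁻ : ∀ {a b} → (a , b) ∈ cross g e → b ≡ idf a × a ∈ ends S
    crossing⁻ (here refl) = sym (idf-e false false) , end-e false false
    crossing⁻ (there (here refl)) = sym (idf-e false true) , end-e false true

    crossing⁺ : ∀ {p} → p ∈ ends S → (p , idf p) ∈ cross g e ⊎ (idf p , p) ∈ cross g e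
    crossing⁺ m = subst (λ p → (p , idf p) ∈ cross g e ⊎ (idf p , p) ∈ cross g e) (sym (end-form m)) (go _ _)
      where
      go : ∀ s h → (pt e s h , idf (pt e s h)) ∈ cross g e ⊎ (idf (pt e s h) , pt e s h) ∈ cross g e
      go false false rewrite idf-e false false = inj₁ (here refl)
      go false true rewrite idf-e false true = inj₁ (there (here refl))
      go true h rewrite idf-e true h with g h in eq
      ... | false = inj₂ (here (cong (λ z → pt e false false , pt e true z) (trans (sym (gg h)) (cong g eq))))
      ... | true = inj₂ (there (here (cong (λ z → pt e false true , pt e true z) (trans (sym (gg h)) (cong g eq)))))

    result : VPAP
    result = R.reglued (λ _ → Lu)

    curveCount≡ : ∀ {M₀} → Unique (flat M₀) → Off e M₀ → curveCount (contractBy idf e G) M₀ ≡ curveCount G (cross g e ++ M₀)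
    curveCount≡ {M₀} uM off = trans (curveCount-relabel θ result M₀)
      (R.reglued-curveCount unique paired (λ _ → Lu) uM off crossing⁻ crossing⁺)

    blockCount≡ : ∀ {J₀} → Off e J₀ → blockCount (contractBy idf e G) J₀ ≡ blockCount G (both e ++ J₀)
    blockCount≡ {J₀} off = B.reglued-blockCount from
      where
      module B = ReglueBlocks r idf G unique paired θ (λ _ → Lu) (both e) J₀ marked-both (offLinks off) (θ-sound {J₀})
        (λ m → subst (λ z → inj₂ z ∼[ blockGraph G (both e ++ J₀) ] inj₂ (idf z)) (sym (end-form m))
                 (subst (λ z → inj₂ (pt e _ _) ∼[ blockGraph G (both e ++ J₀) ] inj₂ z) (sym (idf-e _ _)) (joined-both {J₀})))
        (λ {p} m → subst (λ z → θ (block G z) ≡ θ (block G (idf z))) (sym (end-form m))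
                 (trans (θ-edge (pside p) (phead p)) (trans (sym (θ-edge (not (pside p)) (g (phead p)))) (cong (θ ∘ block G) (sym (idf-e _ _))))))
      -- `idf` changes the side, so one of two matched endpoints lies on the arrow of side `false`,
      -- whose block is `Lu`.
      pick : ∀ {X : List Pt} s h → pt e s h ∈ X → idf (pt e s h) ∈ X → ∃ λ p → p ∈ X × Lu ≡ block G p
      pick false h m _ = _ , m , refl
      pick true h _ k = _ , k , cong (block G) (sym (idf-e true h))
      from : ∀ {c} → c ∈ R.circles → ∃ λ p → p ∈ proj₂ c × Lu ≡ block G p
      from {c} c∈ with R.glued-pair (proj₂ (R.glued unique paired)) c∈
      ... | x , x∈ , k with track-end (proj₂ (R.glued unique paired)) c∈ x∈
      ... | m = pick (pside x) (phead x) (subst (_∈ _) (end-form m) x∈) (subst (λ z → idf z ∈ _) (end-form m) k)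

    removes : Removes G (contractBy idf e G)
    removes = Removes-relabel {r} θ (R.reglued-removes unique paired (λ _ → Lu))

  idfContract-e : ∀ s h → idfContract e (pt e s h) ≡ pt e (not s) (not h)
  idfContract-e s h rewrite ≡ᵇ-refl e = refl

  idfPenrose-e : ∀ s h → idfPenrose e (pt e s h) ≡ pt e (not s) h
  idfPenrose-e s h rewrite ≡ᵇ-refl e = refl

  module Con = Contraction not Boolₚ.not-involutive (idfContract e) idfContract-e
  module Pen = Contraction id (λ _ → refl) (idfPenrose e) idfPenrose-e

  relabel-id : ∀ H → relabel id H ≡ H
  relabel-id H = Listₚ.map-id H

  app-removes : ∀ o → Removes G (app o e G)
  app-removes del = deleted-removes G unique
  app-removes con = Con.removes
  app-removes pen = Pen.removes
  app-removes mdel = Removes-relabel {r} θ (deleted-removes G unique)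

  app-curveCount : ∀ o {M₀} → Unique (flat M₀) → Off e M₀ → curveCount (app o e G) M₀ ≡ curveCount G (matching o e ++ M₀)
  app-curveCount del uM off = deleted-curveCount G {shortcut e} unique uM off bypass-shortcut shortcut-bypass
  app-curveCount con uM off = Con.curveCount≡ uM off
  app-curveCount pen uM off = Pen.curveCount≡ uM off
  app-curveCount mdel {M₀} uM off = trans (curveCount-relabel θ (deleted G) M₀)
    (deleted-curveCount G {shortcut e} unique uM off bypass-shortcut shortcut-bypass)

  app-blockCount : ∀ o {J₀} → Off e J₀ → blockCount (app o e G) J₀ ≡ blockCount G (joins o e ++ J₀)
  app-blockCount del {J₀} off = trans (cong (λ z → blockCount z J₀) (sym (relabel-id (deleted G))))
    (DeleteBlocks.deleted-blockCount r G unique id [] J₀ (λ ()) (offLinks off) (λ _ → ε))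
  app-blockCount con off = Con.blockCount≡ off
  app-blockCount pen off = Pen.blockCount≡ off
  app-blockCount mdel {J₀} off =
    DeleteBlocks.deleted-blockCount r G unique θ (both e) J₀ marked-both (offLinks off) (θ-sound {J₀})

  app-proper : ∀ o → Proper (app o e G)
  app-proper o = record
    { unique = Removes.unique rem
    ; full = λ m s h → Removes.keeps rem (full (proj₁ (Removes.only rem m)) s h) (proj₂ (Removes.only rem m))
    }
    where rem = app-removes o

-- The 2-sum

sumMatching : ℕ → ℕ → Coupling → List (Pt × Pt)
sumMatching f e φ = (pt f false false , pt e (false xor φ) false) ∷ (pt f false true , pt e (false xor φ) true)
                  ∷ (pt f true false , pt e (true xor φ) false) ∷ (pt f true true , pt e (true xor φ) true) ∷ []

sumJoins : ℕ → ℕ → Coupling → List (Pt × Pt)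
sumJoins f e φ = (pt f false false , pt e (false xor φ) false) ∷ (pt f true false , pt e (true xor φ) false) ∷ []

∈-sumMatching : ∀ f e φ s h → (pt f s h , pt e (s xor φ) h) ∈ sumMatching f e φ
∈-sumMatching f e φ false false = here refl
∈-sumMatching f e φ false true = there (here refl)
∈-sumMatching f e φ true false = there (there (here refl))
∈-sumMatching f e φ true true = there (there (there (here refl)))

∈-sumJoins : ∀ f e φ s → (pt f s false , pt e (s xor φ) false) ∈ sumJoins f e φ
∈-sumJoins f e φ false = here refl
∈-sumJoins f e φ true = there (here refl)

xor-xor : ∀ s φ → (s xor φ) xor φ ≡ s
xor-xor false false = refl
xor-xor false true = refl
xor-xor true false = refl
xor-xor true true = refl

replace : ℕ → ℕ → ℕ → ℕ
replace a b l = if l ≡ᵇ a then b else l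

replace-hit : ∀ a b → replace a b a ≡ b
replace-hit a b rewrite ≡ᵇ-refl a = refl

replace-miss : ∀ {a b l} → l ≢ a → replace a b l ≡ l
replace-miss n rewrite ≡ᵇ-false n = refl

Disjoint : VPAP → VPAP → Set
Disjoint G H = (∀ {p q} → p ∈ points G → q ∈ points H → plab p ≢ plab q)
             × (∀ {c d} → c ∈ G → d ∈ H → proj₁ c ≢ proj₁ d)

Proper-++ : ∀ {G H} → Proper G → Proper H → Disjoint G H → Proper (G ++ H)
Proper-++ {G} {H} pG pH (dp , _) = record
  { unique = subst Unique (sym (points-++ G)) (Unique-++⁺ (Proper.unique pG) (Proper.unique pH) (λ m k → dp m k refl))
  ; full = λ m s h → subst (_ ∈_) (sym (points-++ G))
      ([ (λ k → ∈-++⁺ˡ (Proper.full pG k s h)) , (λ k → ∈-++⁺ʳ (points G) (Proper.full pH k s h)) ]′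
        (∈-++⁻ (points G) (subst (_ ∈_) (points-++ G) m)))
  }

-- A 2-sum cuts the disjoint union at both edges at once and glues once. It is therefore handled
-- like a contraction, with two marked labels and an involution that exchanges them.
module TwoSum (G H : VPAP) (pG : Proper G) (pH : Proper H) (dis : Disjoint G H) (f e : ℕ) (φ : Coupling)
  (f∈ : pt f false false ∈ points G) (e∈ : pt e false false ∈ points H) where

  K : VPAP
  K = G ++ H

  pK : Proper K
  pK = Proper-++ pG pH dis

  open Proper pK

  r : ℕ → Bool
  r l = (l ≡ᵇ f) ∨ (l ≡ᵇ e)

  idf : Pt → Pt
  idf = idfSum f e φ

  module R = Regluing r idf K
  open R using (S; circles; Paired; Marked; Unmarked)

  Lu Lv Lu′ Lv′ : ℕ
  Lu  = blockOf f false G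
  Lv  = blockOf f true G
  Lu′ = blockOf e φ H
  Lv′ = blockOf e (not φ) H

  G⊆ : ∀ {p} → p ∈ points G → p ∈ points K
  G⊆ m = subst (_ ∈_) (sym (points-++ G)) (∈-++⁺ˡ m)

  H⊆ : ∀ {p} → p ∈ points H → p ∈ points K
  H⊆ m = subst (_ ∈_) (sym (points-++ G)) (∈-++⁺ʳ (points G) m)

  blockG : ∀ {p} → p ∈ points G → block K p ≡ block G p
  blockG m with ∈-points⁻ G m
  ... | c , c∈ , k = trans (block-circle unique (∈-++⁺ˡ c∈) k) (sym (block-circle (Proper.unique pG) c∈ k))

  blockH : ∀ {p} → p ∈ points H → block K p ≡ block H p
  blockH m with ∈-points⁻ H m
  ... | c , c∈ , k = trans (block-circle unique (∈-++⁺ʳ G c∈) k) (sym (block-circle (Proper.unique pH) c∈ k))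

  labels-apart : ∀ {p q} → p ∈ points G → q ∈ points H → block G p ≢ block H q
  labels-apart m k with ∈-points⁻ G m | ∈-points⁻ H k
  ... | c , c∈ , a | d , d∈ , b = λ i → proj₂ dis c∈ d∈
    (trans (sym (block-circle (Proper.unique pG) c∈ a)) (trans i (block-circle (Proper.unique pH) d∈ b)))

  f∈s : ∀ s h → pt f s h ∈ points G
  f∈s = Proper.full pG f∈

  e∈s : ∀ s h → pt e s h ∈ points H
  e∈s = Proper.full pH e∈

  f≢e : f ≢ e
  f≢e = proj₁ dis f∈ e∈

  marked-f : ∀ s h → Marked (pt f s h)
  marked-f s h rewrite ≡ᵇ-refl f = refl

  marked-e : ∀ s h → Marked (pt e s h)
  marked-e s h rewrite ≡ᵇ-refl e = Boolₚ.∨-zeroʳ (e ≡ᵇ f)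

  idf-f : ∀ s h → idf (pt f s h) ≡ pt e (s xor φ) h
  idf-f s h rewrite ≡ᵇ-refl f = refl

  idf-e : ∀ s h → idf (pt e s h) ≡ pt f (s xor φ) h
  idf-e s h rewrite ≡ᵇ-false (f≢e ∘ sym) | ≡ᵇ-refl e = refl

  data EndForm : Pt → Set where
    atF : ∀ s h → EndForm (pt f s h)
    atE : ∀ s h → EndForm (pt e s h)

  marked-form : ∀ {p} → Marked p → EndForm p
  marked-form {pt l s h} m with l ≡ᵇ f in eqf | l ≡ᵇ e in eqe
  ... | true | _ rewrite ≡ᵇ-sound {l} {f} eqf = atF s h
  ... | false | true rewrite ≡ᵇ-sound {l} {e} eqe = atE s h

  end-form : ∀ {p} → p ∈ ends S → EndForm p
  end-form m = marked-form (R.marked-ends m)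

  end-f : ∀ s h → pt f s h ∈ ends S
  end-f s h = R.∈-ends (G⊆ (f∈s s h)) (marked-f s h)

  end-e : ∀ s h → pt e s h ∈ ends S
  end-e s h = R.∈-ends (H⊆ (e∈s s h)) (marked-e s h)

  paired : Paired (ends S)
  paired = record
    { unique = Unique-++⁻ˡ (ends S) (Unique-↭ R.points↭ unique)
    ; closed = λ m → closed (end-form m)
    ; involutive = λ m → involutive (end-form m)
    ; fixfree = λ m → fixfree (end-form m)
    }
    where
    closed : ∀ {p} → EndForm p → idf p ∈ ends S
    closed (atF s h) = subst (_∈ ends S) (sym (idf-f s h)) (end-e _ _)
    closed (atE s h) = subst (_∈ ends S) (sym (idf-e s h)) (end-f _ _)
    involutive : ∀ {p} → EndForm p → idf (idf p) ≡ p
    involutive (atF s h) = trans (cong idf (idf-f s h)) (trans (idf-e (s xor φ) h) (cong (λ z → pt f z h) (xor-xor s φ)))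
    involutive (atE s h) = trans (cong idf (idf-e s h)) (trans (idf-f (s xor φ) h) (cong (λ z → pt e z h) (xor-xor s φ)))
    fixfree : ∀ {p} → EndForm p → idf p ≢ p
    fixfree (atF s h) i = f≢e (sym (cong plab (trans (sym (idf-f s h)) i)))
    fixfree (atE s h) i = f≢e (cong plab (trans (sym (idf-e s h)) i))

  matching⁻ : ∀ {a b} → (a , b) ∈ sumMatching f e φ → b ≡ idf a × a ∈ ends S
  matching⁻ (here refl) = sym (idf-f _ _) , end-f _ _
  matching⁻ (there (here refl)) = sym (idf-f _ _) , end-f _ _
  matching⁻ (there (there (here refl))) = sym (idf-f _ _) , end-f _ _
  matching⁻ (there (there (there (here refl)))) = sym (idf-f _ _) , end-f _ _

  matching⁺ : ∀ {p} → EndForm p → (p , idf p) ∈ sumMatching f e φ ⊎ (idf p , p) ∈ sumMatching f e φ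
  matching⁺ (atF s h) = inj₁ (subst (λ z → (pt f s h , z) ∈ sumMatching f e φ) (sym (idf-f s h)) (∈-sumMatching f e φ s h))
  matching⁺ (atE s h) = inj₂ (subst (λ z → (z , pt e s h) ∈ sumMatching f e φ) (sym (idf-e s h))
    (subst (λ z → (pt f (s xor φ) h , pt e z h) ∈ sumMatching f e φ) (xor-xor s φ) (∈-sumMatching f e φ (s xor φ) h)))

  lbl : List Ent × List Pt → ℕ
  lbl c = if hasArrowPt f false (proj₂ c) then Lu else Lv

  merge : Bool
  merge = (Lu′ ≡ᵇ Lv′) ∨ any (λ c → hasArrowPt f false (proj₂ c) ∧ hasArrowPt f true (proj₂ c)) circles

  θ₀ θ : ℕ → ℕ
  θ₀ l = replace Lv′ Lv (replace Lu′ Lu l)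
  θ l = if merge then replace Lv Lu (θ₀ l) else θ₀ l

  twoSum≡ : twoSum G H f e φ ≡ relabel θ (R.reglued lbl)
  twoSum≡ = go merge (R.reglued lbl)
    where
    twice : ∀ X → relabel (replace Lv′ Lv) (relabel (replace Lu′ Lu) X) ≡ relabel θ₀ X
    twice X = sym (Listₚ.map-∘ X)
    go : ∀ m X → (if m then relabel (replace Lv Lu) (relabel (replace Lv′ Lv) (relabel (replace Lu′ Lu) X))
                       else relabel (replace Lv′ Lv) (relabel (replace Lu′ Lu) X))
                 ≡ relabel (λ l → if m then replace Lv Lu (θ₀ l) else θ₀ l) X
    go true X = trans (cong (relabel (replace Lv Lu)) (twice X)) (sym (Listₚ.map-∘ X))
    go false X = twice X

  θ₀-Lu : θ₀ Lu ≡ Lu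
  θ₀-Lu = trans (cong (replace Lv′ Lv) (replace-miss (labels-apart (f∈s false false) (e∈s φ false))))
            (replace-miss (labels-apart (f∈s false false) (e∈s (not φ) false)))

  θ₀-Lv : θ₀ Lv ≡ Lv
  θ₀-Lv = trans (cong (replace Lv′ Lv) (replace-miss (labels-apart (f∈s true false) (e∈s φ false))))
            (replace-miss (labels-apart (f∈s true false) (e∈s (not φ) false)))

  θ₀-Lu′ : θ₀ Lu′ ≡ Lu
  θ₀-Lu′ = trans (cong (replace Lv′ Lv) (replace-hit Lu′ Lu)) (replace-miss (labels-apart (f∈s false false) (e∈s (not φ) false)))

  replace-Lu : replace Lv Lu Lu ≡ Lu
  replace-Lu with Lu ≡ᵇ Lv
  ... | true = refl
  ... | false = refl

  θ-u : θ Lu ≡ θ Lu′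
  θ-u = cong (λ l → if merge then replace Lv Lu l else l) (trans θ₀-Lu (sym θ₀-Lu′))

  merged : Lu′ ≡ Lv′ → merge ≡ true
  merged i = cong (_∨ any (λ c → hasArrowPt f false (proj₂ c) ∧ hasArrowPt f true (proj₂ c)) circles)
    (trans (cong (Lu′ ≡ᵇ_) (sym i)) (≡ᵇ-refl Lu′))

  θ-merged : merge ≡ true → ∀ l → θ l ≡ replace Lv Lu (θ₀ l)
  θ-merged i l = cong (λ b → if b then replace Lv Lu (θ₀ l) else θ₀ l) i

  -- If `Lu′` and `Lv′` coincide, the first replacement has already turned `Lv′` into `Lu`, and the
  -- second finds nothing left to do; only the final merge then identifies the result with `Lv`.
  θ-v : θ Lv ≡ θ Lv′
  θ-v with Lu′ ℕₚ.≟ Lv′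
  ... | yes i = trans (trans (θ-merged (merged i) Lv) (trans (cong (replace Lv Lu) θ₀-Lv) (replace-hit Lv Lu)))
      (sym (trans (θ-merged (merged i) Lv′) (trans (cong (replace Lv Lu) (trans (cong θ₀ (sym i)) θ₀-Lu′)) replace-Lu)))
  ... | no n = cong (λ l → if merge then replace Lv Lu l else l)
      (trans θ₀-Lv (sym (trans (cong (replace Lv′ Lv) (replace-miss (n ∘ sym))) (replace-hit Lv′ Lv))))

  block-f : ∀ s h → block K (pt f s h) ≡ blockOf f s G
  block-f s h = blockG (f∈s s h)

  block-e : ∀ s h → block K (pt e s h) ≡ blockOf e s H
  block-e s h = blockH (e∈s s h)

  θ-linked : ∀ s → θ (blockOf f s G) ≡ θ (blockOf e (s xor φ) H)
  θ-linked false = θ-u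
  θ-linked true = θ-v

  θ-fe : ∀ s h h′ → θ (block K (pt f s h)) ≡ θ (block K (pt e (s xor φ) h′))
  θ-fe s h h′ = trans (cong θ (block-f s h)) (trans (θ-linked s) (cong θ (sym (block-e (s xor φ) h′))))

  module _ (J₀ : List (Pt × Pt)) where

    Bᴷ : List (Node × Node)
    Bᴷ = blockGraph K (sumJoins f e φ ++ J₀)

    J : List (Pt × Pt)
    J = sumJoins f e φ ++ J₀

    fe∼ : ∀ s h h′ → inj₂ (pt f s h) ∼[ Bᴷ ] inj₂ (pt e (s xor φ) h′)
    fe∼ s h h′ = ∼-block {K} {J} unique (G⊆ (f∈s s h)) (G⊆ (f∈s s false)) refl
      ◅◅ joined∼ {K} {J} (∈-++⁺ˡ (∈-sumJoins f e φ s))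
      ◅◅ ∼-block {K} {J} unique (H⊆ (e∈s (s xor φ) false)) (H⊆ (e∈s (s xor φ) h′)) refl

    linked∼ : ∀ {p} → EndForm p → inj₂ p ∼[ Bᴷ ] inj₂ (idf p)
    linked∼ (atF s h) = fe∼ s h h ◅◅ ≡⇒∼ (cong inj₂ (sym (idf-f s h)))
    linked∼ (atE s h) = ≡⇒∼ (cong (λ z → inj₂ (pt e z h)) (sym (xor-xor s φ)))
      ◅◅ ∼-sym (fe∼ (s xor φ) h h) ◅◅ ≡⇒∼ (cong inj₂ (sym (idf-e s h)))

    linkedθ : ∀ {p} → EndForm p → θ (block K p) ≡ θ (block K (idf p))
    linkedθ (atF s h) = trans (θ-fe s h h) (cong (θ ∘ block K) (sym (idf-f s h)))
    linkedθ (atE s h) = trans (cong (λ z → θ (block K (pt e z h))) (sym (xor-xor s φ)))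
      (trans (sym (θ-fe (s xor φ) h h)) (cong (θ ∘ block K) (sym (idf-e s h))))

    Lf∼ : ∀ s → inj₁ (blockOf f s G) ∼[ Bᴷ ] inj₂ (pt f s false)
    Lf∼ s = ≡⇒∼ (cong inj₁ (sym (block-f s false))) ◅◅ block∼ {K} {J} unique (G⊆ (f∈s s false))

    Le∼ : ∀ s → inj₁ (blockOf e s H) ∼[ Bᴷ ] inj₂ (pt e s false)
    Le∼ s = ≡⇒∼ (cong inj₁ (sym (block-e s false))) ◅◅ block∼ {K} {J} unique (H⊆ (e∈s s false))

    Lfe∼ : ∀ s → inj₁ (blockOf f s G) ∼[ Bᴷ ] inj₁ (blockOf e (s xor φ) H)
    Lfe∼ s = Lf∼ s ◅◅ fe∼ s false false ◅◅ ∼-sym (Le∼ (s xor φ))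

    replace∼ : ∀ {a b} → inj₁ a ∼[ Bᴷ ] inj₁ b → ∀ l → inj₁ (replace b a l) ∼[ Bᴷ ] inj₁ l
    replace∼ {a} {b} s l with l ≡ᵇ b in eq
    ... | true = s ◅◅ ≡⇒∼ (cong inj₁ (sym (≡ᵇ-sound {l} {b} eq)))
    ... | false = ε

    hasArrowPt⁻ : ∀ s {ps} → hasArrowPt f s ps ≡ true → ∃ λ h → pt f s h ∈ ps
    hasArrowPt⁻ s {ps} i with any-∈⁻ (λ p → (plab p ≡ᵇ f) ∧ beq (pside p) s) ps i
    ... | pt l s′ h , m , j with ∧-true {l ≡ᵇ f} j
    ... | j₁ , j₂ rewrite ≡ᵇ-sound {l} {f} j₁ | beq-sound {s′} {s} j₂ = h , m

    -- The merge identifies only blocks that are connected anyway: either the two arrows of `e`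
    -- share a block of `H`, or some new circle runs through both arrows of `f`, and a new circle
    -- lies in a single component.
    uv∼ : merge ≡ true → inj₁ Lu ∼[ Bᴷ ] inj₁ Lv
    uv∼ i with Lu′ ≡ᵇ Lv′ in eq
    ... | true = Lfe∼ false ◅◅ ≡⇒∼ (cong inj₁ (≡ᵇ-sound {Lu′} {Lv′} eq)) ◅◅ ∼-sym (Lfe∼ true)
    ... | false with any-∈⁻ _ circles i
    ... | c , c∈ , j with ∧-true {hasArrowPt f false (proj₂ c)} j
    ... | j₁ , j₂ with hasArrowPt⁻ false j₁ | hasArrowPt⁻ true j₂
    ... | h₁ , m₁ | h₂ , m₂ = Lf∼ false ◅◅ ∼-block {K} {J} unique (G⊆ (f∈s false false)) (G⊆ (f∈s false h₁)) refl
        ◅◅ ReglueClass.class r idf K unique paired (On.isEquivalence inj₂ (EqC.isEquivalence (λ a b → (a , b) ∈ Bᴷ)))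
             (λ d∈ p∈ q∈ → ∼-sym (inside∼ {J = J} d∈ p∈) ◅◅ inside∼ {J = J} d∈ q∈) (linked∼ ∘ end-form) c∈ m₁ (inj₂ m₂)
        ◅◅ ∼-block {K} {J} unique (G⊆ (f∈s true h₂)) (G⊆ (f∈s true false)) refl ◅◅ ∼-sym (Lf∼ true)

    θ-sound : ∀ l → inj₁ (θ l) ∼[ Bᴷ ] inj₁ l
    θ-sound l = top ◅◅ replace∼ (Lfe∼ true) (replace Lu′ Lu l) ◅◅ replace∼ (Lfe∼ false) l
      where
      top : inj₁ (θ l) ∼[ Bᴷ ] inj₁ (θ₀ l)
      top = go merge refl
        where
        go : ∀ b → merge ≡ b → inj₁ (if b then replace Lv Lu (θ₀ l) else θ₀ l) ∼[ Bᴷ ] inj₁ (θ₀ l)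
        go true i = replace∼ (uv∼ i) (θ₀ l)
        go false i = ε

    at-true : ∀ {ps} → hasArrowPt f false ps ≡ false → ∀ s {h} → pt f s h ∈ ps → ∃ λ p → p ∈ ps × Lv ≡ block K p
    at-true eq true {h} m = _ , m , sym (block-f true h)
    at-true eq false m = ⊥-elim (true≢false (trans (sym (any-∈⁺ (λ p → (plab p ≡ᵇ f) ∧ beq (pside p) false) m (cong (_∧ true) (≡ᵇ-refl f)))) eq))

    lbl-from : ∀ {c} → c ∈ circles → ∃ λ p → p ∈ proj₂ c × lbl c ≡ block K p
    lbl-from {c} c∈ with hasArrowPt f false (proj₂ c) in eq
    ... | true = let h , m = hasArrowPt⁻ false eq in _ , m , sym (block-f false h)
    -- `Lv` is the default label. It is right because one of two matched endpoints belongs to `f`,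
    -- and here its side can only be `true`.
    ... | false with R.glued-pair (proj₂ (R.glued unique paired)) c∈
    ... | x , x∈ , k with end-form (track-end (proj₂ (R.glued unique paired)) c∈ x∈)
    ... | atF s h = at-true eq s x∈
    ... | atE s h = at-true eq (s xor φ) (subst (_∈ proj₂ c) (idf-e s h) k)

    marked-joins : ∀ {a b} → (a , b) ∈ sumJoins f e φ → Marked a × Marked b × θ (block K a) ≡ θ (block K b)
    marked-joins (here refl) = marked-f false false , marked-e φ false , θ-fe false false false
    marked-joins (there (here refl)) = marked-f true false , marked-e (not φ) false , θ-fe true false false

  off-both : ∀ {M} → Off f M → Off e M → ∀ {p} → p ∈ flat M → Unmarked p
  off-both of oe m rewrite of m | oe m = refl

  twoSum-curveCount : ∀ {M₀} → Unique (flat M₀) → Off f M₀ → Off e M₀ →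
    curveCount (twoSum G H f e φ) M₀ ≡ curveCount K (sumMatching f e φ ++ M₀)
  twoSum-curveCount {M₀} uM of oe = trans (cong (λ X → curveCount X M₀) twoSum≡)
    (trans (curveCount-relabel θ (R.reglued lbl) M₀)
      (R.reglued-curveCount unique paired lbl {sumMatching f e φ} uM (off-both of oe) matching⁻ (matching⁺ ∘ end-form)))

  twoSum-blockCount : ∀ {J₀} → Off f J₀ → Off e J₀ →
    blockCount (twoSum G H f e φ) J₀ ≡ blockCount K (sumJoins f e φ ++ J₀)
  twoSum-blockCount {J₀} of oe = trans (cong (λ X → blockCount X J₀) twoSum≡)
    (ReglueBlocks.reglued-blockCount r idf K unique paired θ lbl (sumJoins f e φ) J₀ (marked-joins J₀)
      (λ m → off-both {J₀} of oe (∈-flat₁ m) , off-both {J₀} of oe (∈-flat₂ m)) (λ {c} _ → θ-sound J₀ (proj₁ c))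
      (linked∼ J₀ ∘ end-form) (linkedθ J₀ ∘ end-form) (lbl-from J₀))

  twoSum-removes : R.Removes K (twoSum G H f e φ)
  twoSum-removes = subst (R.Removes K) (sym twoSum≡) (Removes-relabel {r} θ (R.reglued-removes unique paired lbl))

  twoSum-proper : Proper (twoSum G H f e φ)
  twoSum-proper = record
    { unique = R.Removes.unique twoSum-removes
    ; full = λ m s h → R.Removes.keeps twoSum-removes (full (proj₁ (R.Removes.only twoSum-removes m)) s h) (proj₂ (R.Removes.only twoSum-removes m))
    }

-- States

State : Set
State = List (ℕ × Op)

support : State → List ℕ
support = map proj₁

stateMatching stateJoins : State → List (Pt × Pt)
stateMatching [] = []
stateMatching ((e , o) ∷ σ) = matching o e ++ stateMatching σ
stateJoins [] = []
stateJoins ((e , o) ∷ σ) = joins o e ++ stateJoins σ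

flat-matching : ∀ o e {p} → p ∈ flat (matching o e) → plab p ≡ e
flat-matching del e = All.lookup {P = λ p → plab p ≡ e} (refl ∷ refl ∷ refl ∷ refl ∷ [])
flat-matching con e = All.lookup {P = λ p → plab p ≡ e} (refl ∷ refl ∷ refl ∷ refl ∷ [])
flat-matching pen e = All.lookup {P = λ p → plab p ≡ e} (refl ∷ refl ∷ refl ∷ refl ∷ [])
flat-matching mdel e = All.lookup {P = λ p → plab p ≡ e} (refl ∷ refl ∷ refl ∷ refl ∷ [])

flat-joins : ∀ o e {p} → p ∈ flat (joins o e) → plab p ≡ e
flat-joins con e = All.lookup {P = λ p → plab p ≡ e} (refl ∷ refl ∷ [])
flat-joins pen e = All.lookup {P = λ p → plab p ≡ e} (refl ∷ refl ∷ [])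
flat-joins mdel e = All.lookup {P = λ p → plab p ≡ e} (refl ∷ refl ∷ [])

flat-stateMatching : ∀ σ {p} → p ∈ flat (stateMatching σ) → plab p ∈ support σ
flat-stateMatching ((e , o) ∷ σ) m with ∈-++⁻ (flat (matching o e)) (subst (_ ∈_) (flat-++ (matching o e) (stateMatching σ)) m)
... | inj₁ k = here (flat-matching o e k)
... | inj₂ k = there (flat-stateMatching σ k)

flat-stateJoins : ∀ σ {p} → p ∈ flat (stateJoins σ) → plab p ∈ support σ
flat-stateJoins ((e , o) ∷ σ) m with ∈-++⁻ (flat (joins o e)) (subst (_ ∈_) (flat-++ (joins o e) (stateJoins σ)) m)
... | inj₁ k = here (flat-joins o e k)
... | inj₂ k = there (flat-stateJoins σ k)

Unique-matching : ∀ o e → Unique (flat (matching o e))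
Unique-matching del e = ((λ ()) ∷ (λ ()) ∷ (λ ()) ∷ []) ∷ ((λ ()) ∷ (λ ()) ∷ []) ∷ ((λ ()) ∷ []) ∷ [] ∷ []
Unique-matching con e = ((λ ()) ∷ (λ ()) ∷ (λ ()) ∷ []) ∷ ((λ ()) ∷ (λ ()) ∷ []) ∷ ((λ ()) ∷ []) ∷ [] ∷ []
Unique-matching pen e = ((λ ()) ∷ (λ ()) ∷ (λ ()) ∷ []) ∷ ((λ ()) ∷ (λ ()) ∷ []) ∷ ((λ ()) ∷ []) ∷ [] ∷ []
Unique-matching mdel e = ((λ ()) ∷ (λ ()) ∷ (λ ()) ∷ []) ∷ ((λ ()) ∷ (λ ()) ∷ []) ∷ ((λ ()) ∷ []) ∷ [] ∷ []

OffAll : List ℕ → List (Pt × Pt) → Set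
OffAll E M = ∀ {p} → p ∈ flat M → plab p ∉ E

Off-there : ∀ {e M E} → OffAll (e ∷ E) M → OffAll E M
Off-there o m k = o m (there k)

Off-here : ∀ {e M E} → OffAll (e ∷ E) M → Off e M
Off-here o m = ≡ᵇ-false (λ i → o m (here i))

Off-++ : ∀ {e M M′} → Off e M → Off e M′ → Off e (M ++ M′)
Off-++ {M = M} {M′} o o′ m = [ o , o′ ]′ (∈-++⁻ (flat M) (subst (_ ∈_) (flat-++ M M′) m))

Off-state : ∀ {e} σ → e ∉ support σ → Off e (stateMatching σ)
Off-state σ n m = ≡ᵇ-false (λ i → n (subst (_∈ support σ) i (flat-stateMatching σ m)))

Off-stateJ : ∀ {e} σ → e ∉ support σ → Off e (stateJoins σ)
Off-stateJ σ n m = ≡ᵇ-false (λ i → n (subst (_∈ support σ) i (flat-stateJoins σ m)))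

Unique-state : ∀ σ {M₀} → Unique (support σ) → Unique (flat M₀) → OffAll (support σ) M₀ → Unique (flat (stateMatching σ ++ M₀))
Unique-state [] u uM o = uM
Unique-state ((e , op) ∷ σ) {M₀} (n ∷ u) uM o =
  subst (λ z → Unique (flat z)) (sym (Listₚ.++-assoc (matching op e) (stateMatching σ) M₀))
    (subst Unique (sym (flat-++ (matching op e) (stateMatching σ ++ M₀)))
      (Unique-++⁺ (Unique-matching op e) (Unique-state σ u uM (λ {p} → Off-there {e} {M₀} o {p})) apart))
  where
  apart : ∀ {x} → x ∈ flat (matching op e) → x ∉ flat (stateMatching σ ++ M₀)
  apart m k with ∈-++⁻ (flat (stateMatching σ)) (subst (_ ∈_) (flat-++ (stateMatching σ) M₀) k)
  ... | inj₁ j = All.lookup n (flat-stateMatching σ j) (sym (flat-matching op e m))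
  ... | inj₂ j = o j (here (flat-matching op e m))

∉-support : ∀ {e : ℕ} {E} → All (e ≢_) E → e ∉ E
∉-support n m = All.lookup n m refl

-- Performing a state as a sequence of operations

IsEdge : VPAP → ℕ → Set
IsEdge G e = pt e false false ∈ points G

app-edge : ∀ {G} (pG : Proper G) {e} (e∈ : IsEdge G e) o {l} → l ≢ e → IsEdge G l → IsEdge (app o e G) l
app-edge pG e∈ o n m = Cutting.Removes.keeps (EdgeOps.app-removes _ pG _ e∈ o) m (≡ᵇ-false n)

reduce : State → VPAP → VPAP
reduce [] G = G
reduce ((e , o) ∷ σ) G = reduce σ (app o e G)

module _ {G : VPAP} (pG : Proper G) {e : ℕ} (e∈ : IsEdge G e) {σ : State} (o : Op)
  (n : All (e ≢_) (support σ)) (es : ∀ {l} → l ∈ support σ → IsEdge G l) where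

  app-edges : ∀ {l} → l ∈ support σ → IsEdge (app o e G) l
  app-edges m = app-edge pG e∈ o (λ i → All.lookup n m (sym i)) (es m)

reduce-proper : ∀ σ {G} → Proper G → Unique (support σ) → (∀ {l} → l ∈ support σ → IsEdge G l) → Proper (reduce σ G)
reduce-proper [] pG u es = pG
reduce-proper ((e , o) ∷ σ) {G} pG (n ∷ u) es =
  reduce-proper σ (EdgeOps.app-proper G pG e (es (here refl)) o) u (app-edges pG (es (here refl)) {σ} o n (es ∘ there))

-- Because `M₀` is arbitrary away from the state, the remaining endpoints can be treated later in
-- different ways: by a matching of a single edge, or by the matching of a 2-sum.
reduce-curveCount : ∀ σ {G M₀} → Proper G → Unique (support σ) → (∀ {l} → l ∈ support σ → IsEdge G l) →
  Unique (flat M₀) → OffAll (support σ) M₀ → curveCount (reduce σ G) M₀ ≡ curveCount G (stateMatching σ ++ M₀)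
reduce-curveCount [] pG u es uM o = refl
reduce-curveCount ((e , op) ∷ σ) {G} {M₀} pG (n ∷ u) es uM o =
  trans (reduce-curveCount σ (EdgeOps.app-proper G pG e (es (here refl)) op) u (app-edges pG (es (here refl)) {σ} op n (es ∘ there)) uM (λ {p} → Off-there {e} {M₀} o {p}))
  (trans (EdgeOps.app-curveCount G pG e (es (here refl)) op (Unique-state σ u uM (λ {p} → Off-there {e} {M₀} o {p}))
           (λ {p} → Off-++ {e} {stateMatching σ} {M₀} (Off-state σ (∉-support n)) (λ {q} → Off-here {e} {M₀} o {q}) {p}))
    (cong (curveCount G) (sym (Listₚ.++-assoc (matching op e) (stateMatching σ) M₀))))

reduce-blockCount : ∀ σ {G J₀} → Proper G → Unique (support σ) → (∀ {l} → l ∈ support σ → IsEdge G l) →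
  OffAll (support σ) J₀ → blockCount (reduce σ G) J₀ ≡ blockCount G (stateJoins σ ++ J₀)
reduce-blockCount [] pG u es o = refl
reduce-blockCount ((e , op) ∷ σ) {G} {J₀} pG (n ∷ u) es o =
  trans (reduce-blockCount σ (EdgeOps.app-proper G pG e (es (here refl)) op) u (app-edges pG (es (here refl)) {σ} op n (es ∘ there)) (λ {p} → Off-there {e} {J₀} o {p}))
  (trans (EdgeOps.app-blockCount G pG e (es (here refl)) op
           (λ {p} → Off-++ {e} {stateJoins σ} {J₀} (Off-stateJ σ (∉-support n)) (λ {q} → Off-here {e} {J₀} o {q}) {p}))
    (cong (blockCount G) (sym (Listₚ.++-assoc (joins op e) (stateJoins σ) J₀))))

reduce-points : ∀ σ {G p} → Proper G → Unique (support σ) → (∀ {l} → l ∈ support σ → IsEdge G l) →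
  p ∈ points (reduce σ G) → p ∈ points G × plab p ∉ support σ
reduce-points [] pG u es m = m , λ ()
reduce-points ((e , o) ∷ σ) {G} {p} pG (n ∷ u) es m
  with reduce-points σ (EdgeOps.app-proper G pG e (es (here refl)) o) u (app-edges pG (es (here refl)) {σ} o n (es ∘ there)) m
... | k , p∉ with Cutting.Removes.only (EdgeOps.app-removes G pG e (es (here refl)) o) k
... | k′ , un = k′ , λ { (here refl) → true≢false (trans (sym (≡ᵇ-refl (plab p))) un) ; (there j) → p∉ j }

reduce-keeps : ∀ σ {G p} → Proper G → Unique (support σ) → (∀ {l} → l ∈ support σ → IsEdge G l) →
  p ∈ points G → plab p ∉ support σ → p ∈ points (reduce σ G)
reduce-keeps [] pG u es m p∉ = m
reduce-keeps ((e , o) ∷ σ) {G} {p} pG (n ∷ u) es m p∉ =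
  reduce-keeps σ (EdgeOps.app-proper G pG e (es (here refl)) o) u (app-edges pG (es (here refl)) {σ} o n (es ∘ there))
    (Cutting.Removes.keeps (EdgeOps.app-removes G pG e (es (here refl)) o) m (≡ᵇ-false (p∉ ∘ here))) (p∉ ∘ there)

-- Operations on one half of a disjoint union

module _ {G H : VPAP} (pH : Proper H) (dis : Disjoint G H) {e : ℕ} (e∈ : IsEdge H e) where

  private
    r : ℕ → Bool
    r l = l ≡ᵇ e

    module E = EdgeOps H pH e e∈

    unmarked-G : ∀ {c x} → c ∈ G → x ∈ proj₂ c → r (lab x) ≡ false
    unmarked-G c∈ x∈ = ≡ᵇ-false (proj₁ dis (∈-points⁺ c∈ (∈-exitPt x∈)) e∈)

    kept-id : ∀ w → (∀ {x} → x ∈ w → r (lab x) ≡ false) → E.kept w ≡ w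
    kept-id [] f = refl
    kept-id (x ∷ w) f rewrite f (here refl) = cong (x ∷_) (kept-id w (f ∘ there))

    deleted-id : ∀ X → (∀ {c x} → c ∈ X → x ∈ proj₂ c → r (lab x) ≡ false) → E.deleted X ≡ X
    deleted-id [] f = refl
    deleted-id (c ∷ X) f = cong₂ _∷_ (cong (proj₁ c ,_) (kept-id (proj₂ c) (f (here refl)))) (deleted-id X (f ∘ there))

    delete-++ : delete e (G ++ H) ≡ G ++ delete e H
    delete-++ = trans (Listₚ.map-++ _ G H) (cong (_++ delete e H) (deleted-id G unmarked-G))

    cutCircle-uncut : ∀ w → (∀ {x} → x ∈ w → r (lab x) ≡ false) → cutCircle (r ∘ lab) w ≡ nothing
    cutCircle-uncut w f = cong (cutSplit (r ∘ lab)) (go w f)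
      where
      go : ∀ w → (∀ {x} → x ∈ w → r (lab x) ≡ false) → spanNot (r ∘ lab) w ≡ (w , [])
      go [] f = refl
      go (x ∷ w) f rewrite f (here refl) | go w (f ∘ there) = refl

    cutAll-++ : ∀ X → (∀ {c x} → c ∈ X → x ∈ proj₂ c → r (lab x) ≡ false) →
      cutAll (r ∘ lab) (X ++ H) ≡ (X ++ proj₁ (cutAll (r ∘ lab) H) , proj₂ (cutAll (r ∘ lab) H))
    cutAll-++ [] f = refl
    cutAll-++ ((l , w) ∷ X) f rewrite cutAll-++ X (f ∘ there) | cutCircle-uncut w (f (here refl)) = refl

    blockOf-++ : ∀ s X → (∀ {c x} → c ∈ X → x ∈ proj₂ c → r (lab x) ≡ false) → blockOf e s (X ++ H) ≡ blockOf e s H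
    blockOf-++ s [] f = refl
    blockOf-++ s (c ∷ X) f with inCircle e s c in eq
    ... | false = blockOf-++ s X (f ∘ there)
    ... | true with any-∈⁻ (isArrow e s) (proj₂ c) eq
    ... | x , x∈ , i with ∧-true {lab x ≡ᵇ e} i
    ... | i₁ , _ = ⊥-elim (true≢false (trans (sym i₁) (f (here refl) x∈)))

    relabel-G : ∀ {X} → (∀ {c} → c ∈ X → proj₁ c ≢ E.Lv) → relabel E.θ X ≡ X
    relabel-G {[]} f = refl
    relabel-G {c ∷ X} f = cong₂ _∷_ (cong (_, proj₂ c) (replace-miss (f (here refl)))) (relabel-G (f ∘ there))

    Lv-apart : ∀ {c} → c ∈ G → proj₁ c ≢ E.Lv
    Lv-apart c∈ i with ∈-points⁻ H (E.e∈s true false)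
    ... | d , d∈ , k = proj₂ dis c∈ d∈ (trans i (block-circle (Proper.unique pH) d∈ k))

    relabel-++ : ∀ X → relab (blockOf e true (G ++ H)) (blockOf e false (G ++ H)) (G ++ X) ≡ G ++ relabel E.θ X
    relabel-++ X rewrite blockOf-++ true G unmarked-G | blockOf-++ false G unmarked-G =
      trans (Listₚ.map-++ _ G X) (cong (_++ relabel E.θ X) (relabel-G Lv-apart))

    contractBy-++ : ∀ idf → contractBy idf e (G ++ H) ≡ G ++ contractBy idf e H
    contractBy-++ idf rewrite cutAll-++ G unmarked-G =
      trans (cong (relab (blockOf e true (G ++ H)) (blockOf e false (G ++ H)))
               (trans (Listₚ.++-assoc G (proj₁ (cutAll (isEdge e) H)) _)
                 (cong (λ z → G ++ proj₁ (cutAll (isEdge e) H) ++ map (λ c → z , proj₁ c) (glue idf (proj₂ (cutAll (isEdge e) H))))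
                   (blockOf-++ false G unmarked-G))))
        (relabel-++ _)

  -- An equality of lists, not only of counts: no circle of `G` is cut, the search for the blocks of
  -- `e` passes over `G`, and no label of `G` is the one that gets replaced.
  app-++ : ∀ o → app o e (G ++ H) ≡ G ++ app o e H
  app-++ del = delete-++
  app-++ con = contractBy-++ (idfContract e)
  app-++ pen = contractBy-++ (idfPenrose e)
  app-++ mdel = trans (cong (relab (blockOf e true (G ++ H)) (blockOf e false (G ++ H))) delete-++) (relabel-++ (delete e H))

  private
    θ-from : ∀ {c} → c ∈ H → ∃ λ d → d ∈ H × E.θ (proj₁ c) ≡ proj₁ d
    θ-from {c} c∈ with proj₁ c ≡ᵇ E.Lv
    ... | false = c , c∈ , refl
    ... | true with ∈-points⁻ H e∈
    ... | d , d∈ , k = d , d∈ , block-circle (Proper.unique pH) d∈ k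

    contract-from : ∀ idf {d} → d ∈ contractBy idf e H → ∃ λ c → c ∈ H × proj₁ d ≡ proj₁ c
    contract-from idf m with ∈-map⁻ _ m
    ... | d , k , refl with ∈-++⁻ (Regluing.U r idf H) k
    ... | inj₁ j = θ-from (proj₁ (Cutting.CutOf.rest (Regluing.cutOf r idf H) j))
    ... | inj₂ j with ∈-map⁻ _ j
    ... | _ , _ , refl with ∈-points⁻ H e∈
    ... | d , d∈ , l = d , d∈ , trans E.θ-Lu (block-circle (Proper.unique pH) d∈ l)

  -- No operation invents a block label, so disjointness from `G` survives it.
  app-labels : ∀ o {d} → d ∈ app o e H → ∃ λ c → c ∈ H × proj₁ d ≡ proj₁ c
  app-labels del m with ∈-map⁻ _ m
  ... | c , c∈ , refl = c , c∈ , refl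
  app-labels con m = contract-from (idfContract e) m
  app-labels pen m = contract-from (idfPenrose e) m
  app-labels mdel m with ∈-map⁻ _ m
  ... | d , k , refl with ∈-map⁻ _ k
  ... | c , c∈ , refl = θ-from c∈

  app-disjoint : ∀ o → Disjoint G (app o e H)
  app-disjoint o = (λ p∈ q∈ → proj₁ dis p∈ (proj₁ (Cutting.Removes.only (E.app-removes o) q∈)))
                 , (λ c∈ d∈ i → let d′ , d′∈ , j = app-labels o d∈ in proj₂ dis c∈ d′∈ (trans i j))

reduce-++ : ∀ σ {G H} → Proper H → Disjoint G H → Unique (support σ) → (∀ {l} → l ∈ support σ → IsEdge H l) →
  reduce σ (G ++ H) ≡ G ++ reduce σ H × Disjoint G (reduce σ H)
reduce-++ [] pH dis u es = refl , dis
reduce-++ ((e , o) ∷ σ) {G} {H} pH dis (n ∷ u) es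
  with reduce-++ σ (EdgeOps.app-proper H pH e (es (here refl)) o) (app-disjoint pH dis (es (here refl)) o) u
         (app-edges pH (es (here refl)) {σ} o n (es ∘ there))
... | eq , d = trans (cong (reduce σ) (app-++ pH dis (es (here refl)) o)) eq , d

-- Renaming

mapLinks : (A → B) → List (A × A) → List (B × B)
mapLinks f = map (λ l → f (proj₁ l) , f (proj₂ l))

flat-mapLinks : (f : A → B) (L : List (A × A)) → flat (mapLinks f L) ≡ map f (flat L)
flat-mapLinks f [] = refl
flat-mapLinks f ((a , b) ∷ L) = cong (λ z → f a ∷ f b ∷ z) (flat-mapLinks f L)

comps-map : {A B : Set} (_≟_ : DecidableEquality A) (_≟′_ : DecidableEquality B) (ρ : A → B) (τ : B → A) →
  (∀ x → τ (ρ x) ≡ x) → ∀ N L →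
  Components.comps _≟′_ (map ρ N) (mapLinks ρ L) ≡ Components.comps _≟_ N L
comps-map _≟_ _≟′_ ρ τ inv N L = sym (comps-transfer _≟_ _≟′_ ρ τ (λ m → link (∈-map⁺ _ m)) back
    (λ {x} _ → ≡⇒∼ (inv x)) (λ m → _ , ∈-map⁺ ρ m , ε)
    (λ m → let x , x∈ , e = ∈-map⁻ ρ m in x , x∈ , ≡⇒∼ (sym e)))
  where
  back : ∀ {a b} → (a , b) ∈ mapLinks ρ L → τ a ∼[ L ] τ b
  back m with ∈-map⁻ _ m
  ... | (a , b) , k , refl = ≡⇒∼ (inv a) ◅◅ link k ◅◅ ≡⇒∼ (sym (inv b))

shiftPt : ℕ → Pt → Pt
shiftPt off p = pt (plab p ℕ.+ off) (pside p) (phead p)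

unshiftPt : ℕ → Pt → Pt
unshiftPt off p = pt (plab p ℕ.∸ off) (pside p) (phead p)

unshift-shift : ∀ off p → unshiftPt off (shiftPt off p) ≡ p
unshift-shift off (pt l s h) = cong (λ z → pt z s h) (ℕₚ.m+n∸n≡m l off)

opaque
  unfolding curves

  curves-shift : ∀ off L M → curves (mapLinks (shiftPt off) L) (mapLinks (shiftPt off) M) ≡ curves L M
  curves-shift off L M = trans
    (cong₂ (Components.comps _≟P_) (flat-mapLinks (shiftPt off) L) (sym (Listₚ.map-++ _ L M)))
    (comps-map _≟P_ _≟P_ (shiftPt off) (unshiftPt off) (unshift-shift off) (flat L) (L ++ M))

-- The exponents of α in the matrix of the linear system.
loops : Op → Op → ℕ
loops con con = 2
loops pen pen = 2
loops con _ = 1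
loops pen _ = 1
loops _ con = 1
loops _ pen = 1
loops _ _ = 2

opaque
  unfolding curves Components.comps

  curves-matching₀ : ∀ t o → curves (matching t 0) (matching o 0) ≡ loops t o
  curves-matching₀ del del = refl
  curves-matching₀ del con = refl
  curves-matching₀ del pen = refl
  curves-matching₀ del mdel = refl
  curves-matching₀ con del = refl
  curves-matching₀ con con = refl
  curves-matching₀ con pen = refl
  curves-matching₀ con mdel = refl
  curves-matching₀ pen del = refl
  curves-matching₀ pen con = refl
  curves-matching₀ pen pen = refl
  curves-matching₀ pen mdel = refl
  curves-matching₀ mdel del = refl
  curves-matching₀ mdel con = refl
  curves-matching₀ mdel pen = refl
  curves-matching₀ mdel mdel = refl

matching-shift : ∀ off o e → matching o (e ℕ.+ off) ≡ mapLinks (shiftPt off) (matching o e)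
matching-shift off del e = refl
matching-shift off con e = refl
matching-shift off pen e = refl
matching-shift off mdel e = refl

joins-shift : ∀ off o e → joins o (e ℕ.+ off) ≡ mapLinks (shiftPt off) (joins o e)
joins-shift off del e = refl
joins-shift off con e = refl
joins-shift off pen e = refl
joins-shift off mdel e = refl

-- Two perfect matchings of four points form two cycles if they agree and one otherwise. The sixteen
-- cases are evaluated at the concrete label 0 and then renamed.
curves-matching : ∀ t o e → curves (matching t e) (matching o e) ≡ loops t o
curves-matching t o e = trans (cong₂ curves (matching-shift e t 0) (matching-shift e o 0))
  (trans (curves-shift e (matching t 0) (matching o 0)) (curves-matching₀ t o))

shiftEnt : ℕ → Ent → Ent
shiftEnt off x = ent (lab x ℕ.+ off) (side x) (fwd x)

pts-shift : ∀ off w → pts (map (shiftEnt off) w) ≡ map (shiftPt off) (pts w)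
pts-shift off [] = refl
pts-shift off (x ∷ w) = cong (λ z → _ ∷ _ ∷ z) (pts-shift off w)

points-shift : ∀ off G → points (shift off G) ≡ map (shiftPt off) (points G)
points-shift off [] = refl
points-shift off (c ∷ G) = trans (cong₂ _++_ (pts-shift off (proj₂ c)) (points-shift off G)) (sym (Listₚ.map-++ _ (pts (proj₂ c)) (points G)))

arcsFrom-shift : ∀ off p w q → arcsFrom (shiftPt off p) (map (shiftEnt off) w) (shiftPt off q) ≡ mapLinks (shiftPt off) (arcsFrom p w q)
arcsFrom-shift off p [] q = refl
arcsFrom-shift off p (x ∷ w) q = cong (_ ∷_) (arcsFrom-shift off (exitPt x) w q)

circleArcs-shift : ∀ off w → circleArcs (map (shiftEnt off) w) ≡ mapLinks (shiftPt off) (circleArcs w)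
circleArcs-shift off [] = refl
circleArcs-shift off (x ∷ w) = arcsFrom-shift off (exitPt x) w (entryPt x)

arcs-shift : ∀ off G → arcs (shift off G) ≡ mapLinks (shiftPt off) (arcs G)
arcs-shift off [] = refl
arcs-shift off (c ∷ G) = trans (cong₂ _++_ (circleArcs-shift off (proj₂ c)) (arcs-shift off G)) (sym (Listₚ.map-++ _ (circleArcs (proj₂ c)) (arcs G)))

bare-map : ∀ {f} w → bare (map f w) ≡ bare w
bare-map [] = refl
bare-map (_ ∷ _) = refl

empties-shift : ∀ off G → empties (shift off G) ≡ empties G
empties-shift off [] = refl
empties-shift off (c ∷ G) = cong₂ ℕ._+_ (bare-map (proj₂ c)) (empties-shift off G)

curveCount-shift : ∀ off G M → curveCount (shift off G) (mapLinks (shiftPt off) M) ≡ curveCount G M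
curveCount-shift off G M = cong₂ ℕ._+_ (empties-shift off G)
  (trans (cong (λ z → curves z (mapLinks (shiftPt off) M)) (arcs-shift off G)) (curves-shift off (arcs G) M))

shiftNode unshiftNode : ℕ → Node → Node
shiftNode off (inj₁ l) = inj₁ (l ℕ.+ off)
shiftNode off (inj₂ p) = inj₂ (shiftPt off p)
unshiftNode off (inj₁ l) = inj₁ (l ℕ.∸ off)
unshiftNode off (inj₂ p) = inj₂ (unshiftPt off p)

unshift-shiftNode : ∀ off x → unshiftNode off (shiftNode off x) ≡ x
unshift-shiftNode off (inj₁ l) = cong inj₁ (ℕₚ.m+n∸n≡m l off)
unshift-shiftNode off (inj₂ p) = cong inj₂ (unshift-shift off p)

labels-shift : ∀ off G → labels (shift off G) ≡ map (shiftNode off) (labels G)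
labels-shift off [] = refl
labels-shift off (c ∷ G) = cong (_ ∷_) (labels-shift off G)

blockLinks-shift : ∀ off G → blockLinks (shift off G) ≡ mapLinks (shiftNode off) (blockLinks G)
blockLinks-shift off [] = refl
blockLinks-shift off (c ∷ G) = trans (cong₂ _++_ (circle (proj₂ c)) (blockLinks-shift off G))
    (sym (Listₚ.map-++ _ (map _ (pts (proj₂ c))) (blockLinks G)))
  where
  circle : ∀ w → map (λ p → inj₁ (proj₁ c ℕ.+ off) , inj₂ p) (pts (map (shiftEnt off) w))
               ≡ mapLinks (shiftNode off) (map (λ p → inj₁ (proj₁ c) , inj₂ p) (pts w))
  circle [] = refl
  circle (x ∷ w) = cong (λ z → _ ∷ _ ∷ z) (circle w)

onPoints-shift : ∀ off J → onPoints (mapLinks (shiftPt off) J) ≡ mapLinks (shiftNode off) (onPoints J)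
onPoints-shift off [] = refl
onPoints-shift off (l ∷ J) = cong (_ ∷_) (onPoints-shift off J)

blockCount-shift : ∀ off G J → blockCount (shift off G) (mapLinks (shiftPt off) J) ≡ blockCount G J
blockCount-shift off G J = trans
  (cong₂ (Components.comps _≟N_) (labels-shift off G)
    (trans (cong₂ _++_ (blockLinks-shift off G) (onPoints-shift off J)) (sym (Listₚ.map-++ _ (blockLinks G) (onPoints J)))))
  (comps-map _≟N_ _≟N_ (shiftNode off) (unshiftNode off) (unshift-shiftNode off) (labels G) (blockGraph G J))

-- Presentations with a single edge

empties-↭ : ∀ {G H} → G ↭ H → empties G ≡ empties H
empties-↭ Perm.refl = refl
empties-↭ (Perm.prep c p) = cong (bare (proj₂ c) ℕ.+_) (empties-↭ p)
empties-↭ (Perm.swap {xs} {ys} c d p) rewrite empties-↭ p = trans (sym (ℕₚ.+-assoc (bare (proj₂ c)) (bare (proj₂ d)) _))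
  (trans (cong (ℕ._+ empties ys) (ℕₚ.+-comm (bare (proj₂ c)) (bare (proj₂ d)))) (ℕₚ.+-assoc (bare (proj₂ d)) (bare (proj₂ c)) _))
empties-↭ (Perm.trans p q) = trans (empties-↭ p) (empties-↭ q)

curveCount-↭ : ∀ {G H M} → G ↭ H → curveCount G M ≡ curveCount H M
curveCount-↭ {M = M} p = cong₂ ℕ._+_ (empties-↭ p) (curves-↭ {M = M} (arcs-↭ p) ↭-refl)

edge⇒∼ : ∀ {G H J} → (∀ {c} → c ∈ G → c ∈ H) → ∀ {a b} → BlockEdge G J a b → a ∼[ blockGraph H J ] b
edge⇒∼ {H = H} {J} f (inside c∈ p∈) = inside∼ {H} {J} (f c∈) p∈
edge⇒∼ {H = H} {J} f (joined j) = joined∼ {H} {J} j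

blockCount-↭ : ∀ {G H J} → G ↭ H → blockCount G J ≡ blockCount H J
blockCount-↭ {G} {H} {J} p = comps-cong _≟N_ (edge⇒∼ {J = J} (↭⇒∈ p) ∘ blockEdge G) (edge⇒∼ {J = J} (↭⇒∈ (↭-sym p)) ∘ blockEdge H)
  (↭⇒∈ (Permₚ.map⁺ _ p)) (↭⇒∈ (Permₚ.map⁺ _ (↭-sym p)))

record Sorted (H : VPAP) : Set where
  field
    core rest : VPAP
    perm  : H ↭ core ++ rest
    empty : ∀ {c} → c ∈ rest → proj₂ c ≡ []
    nonempty : ∀ {c} → c ∈ core → proj₂ c ≢ []

sort : ∀ H → Sorted H
sort [] = record { core = [] ; rest = [] ; perm = ↭-refl ; empty = λ () ; nonempty = λ () }
sort ((l , []) ∷ H) = record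
  { core = core ; rest = (l , []) ∷ rest
  ; perm = ↭-trans (prep (l , []) perm) (↭-sym (Permₚ.shift (l , []) core rest))
  ; empty = λ { (here refl) → refl ; (there m) → empty m } ; nonempty = nonempty }
  where open Sorted (sort H)
sort ((l , x ∷ w) ∷ H) = record
  { core = (l , x ∷ w) ∷ core ; rest = rest ; perm = prep _ perm ; empty = empty
  ; nonempty = λ { (here refl) () ; (there m) → nonempty m } }
  where open Sorted (sort H)

same-arrow : ∀ {x y X} → lab x ≡ lab y → side x ≡ side y → entryPt y ∈ X → ¬ Unique (entryPt x ∷ exitPt x ∷ X)
same-arrow {ent l s f} {ent l′ s′ f′} refl refl m ((_ ∷ n) ∷ n′ ∷ _) with Bool-split f′ f
... | inj₁ refl = All.lookup n m refl
... | inj₂ refl = All.lookup n′ m (cong (pt l s) (sym (Boolₚ.not-involutive f)))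

-- Two of the three sides agree, and arrows with the same label and side have the same pair of
-- endpoints, whichever way they point.
three-arrows : ∀ {x y z X} → lab x ≡ lab y → lab y ≡ lab z →
  ¬ Unique (entryPt x ∷ exitPt x ∷ entryPt y ∷ exitPt y ∷ entryPt z ∷ exitPt z ∷ X)
three-arrows {x} {y} {z} i j u with Bool-split (side x) (side y) | Bool-split (side x) (side z) | Bool-split (side y) (side z)
... | inj₁ s | _ | _ = same-arrow {x} {y} i s (here refl) u
... | inj₂ _ | inj₁ s | _ = same-arrow {x} {z} (trans i j) s (there (there (here refl))) u
... | inj₂ _ | inj₂ _ | inj₁ s = same-arrow {y} {z} j s (here refl) (Unique-++⁻ʳ (_ ∷ _ ∷ []) u)
... | inj₂ a | inj₂ b | inj₂ c = same-arrow {x} {z} (trans i j) (trans a (trans (cong not c) (Boolₚ.not-involutive (side z)))) (there (there (here refl))) u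

data Shape (e : ℕ) : VPAP → Set where
  one : ∀ l s f f′ → Shape e ((l , ent e s f ∷ ent e (not s) f′ ∷ []) ∷ [])
  two : ∀ l l′ s f f′ → Shape e ((l , ent e s f ∷ []) ∷ (l′ , ent e (not s) f′ ∷ []) ∷ [])

-- Enumeration by the number of arrows on the first circles. Too few arrows contradict `es`, three
-- contradict `three-arrows`, and equal sides contradict uniqueness.
shape : ∀ {e} core → Unique (points core) → (∀ {c} → c ∈ core → proj₂ c ≢ []) → (∀ {p} → p ∈ points core → plab p ≡ e) →
  (∀ s → pt e s false ∈ points core) → Shape e core
shape [] u ne le es with es false
... | ()
shape ((l , []) ∷ cs) u ne le es = ⊥-elim (ne (here refl) refl)
shape ((l , x ∷ []) ∷ []) u ne le es with es (not (side x))
... | here i = ⊥-elim (Boolₚ.not-¬ refl (sym (cong pside i)))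
... | there (here i) = ⊥-elim (Boolₚ.not-¬ refl (sym (cong pside i)))
shape ((l , x ∷ []) ∷ (l′ , []) ∷ cs) u ne le es = ⊥-elim (ne (there (here refl)) refl)
shape ((l , x@(ent a s f) ∷ []) ∷ (l′ , y@(ent b s′ f′) ∷ []) ∷ []) u ne le es with le (here refl) | le (there (there (here refl))) | Bool-split s′ s
... | refl | refl | inj₁ i = ⊥-elim (same-arrow {x} {y} refl (sym i) (here refl) u)
... | refl | refl | inj₂ refl = two l l′ s f f′
shape ((l , x ∷ []) ∷ (l′ , y ∷ []) ∷ (l″ , []) ∷ cs) u ne le es = ⊥-elim (ne (there (there (here refl))) refl)
shape ((l , x ∷ []) ∷ (l′ , y ∷ []) ∷ (l″ , z ∷ w) ∷ cs) u ne le es = ⊥-elim (three-arrows {x} {y} {z}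
  (trans (le (here refl)) (sym (le (there (there (here refl)))))) (trans (le (there (there (here refl)))) (sym (le (there (there (there (there (here refl)))))))) u)
shape ((l , x ∷ []) ∷ (l′ , y ∷ z ∷ w) ∷ cs) u ne le es = ⊥-elim (three-arrows {x} {y} {z}
  (trans (le (here refl)) (sym (le (there (there (here refl)))))) (trans (le (there (there (here refl)))) (sym (le (there (there (there (there (here refl)))))))) u)
shape ((l , x@(ent a s f) ∷ y@(ent b s′ f′) ∷ []) ∷ []) u ne le es with le (here refl) | le (there (there (here refl))) | Bool-split s′ s
... | refl | refl | inj₁ i = ⊥-elim (same-arrow {x} {y} refl (sym i) (here refl) u)
... | refl | refl | inj₂ refl = one l s f f′
shape ((l , x ∷ y ∷ []) ∷ (l′ , []) ∷ cs) u ne le es = ⊥-elim (ne (there (here refl)) refl)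
shape ((l , x ∷ y ∷ []) ∷ (l′ , z ∷ w) ∷ cs) u ne le es = ⊥-elim (three-arrows {x} {y} {z}
  (trans (le (here refl)) (sym (le (there (there (here refl)))))) (trans (le (there (there (here refl)))) (sym (le (there (there (there (there (here refl)))))))) u)
shape ((l , x ∷ y ∷ z ∷ w) ∷ cs) u ne le es = ⊥-elim (three-arrows {x} {y} {z}
  (trans (le (here refl)) (sym (le (there (there (here refl)))))) (trans (le (there (there (here refl)))) (sym (le (there (there (there (there (here refl)))))))) u)

infix 4 _±∈_
_±∈_ : A × A → List (A × A) → Set
(a , b) ±∈ M = (a , b) ∈ M ⊎ (b , a) ∈ M

pair± : {k l m n : A × A} → k ±∈ m ∷ n ∷ [] → l ±∈ m ∷ n ∷ [] → m ±∈ k ∷ l ∷ [] → n ±∈ k ∷ l ∷ [] →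
  flipped (k ∷ l ∷ []) (m ∷ n ∷ []) × flipped (m ∷ n ∷ []) (k ∷ l ∷ [])
pair± a b c d = (λ { (here refl) → a ; (there (here refl)) → b }) , (λ { (here refl) → c ; (there (here refl)) → d })

two-shortcut : ∀ {e l l′} s f f′ → let L = arcs ((l , ent e s f ∷ []) ∷ (l′ , ent e (not s) f′ ∷ []) ∷ []) in
  flipped L (shortcut e) × flipped (shortcut e) L
two-shortcut false false false = pair± (inj₁ (here refl)) (inj₁ (there (here refl))) (inj₁ (here refl)) (inj₁ (there (here refl)))
two-shortcut false false true = pair± (inj₁ (here refl)) (inj₂ (there (here refl))) (inj₁ (here refl)) (inj₂ (there (here refl)))
two-shortcut false true false = pair± (inj₂ (here refl)) (inj₁ (there (here refl))) (inj₂ (here refl)) (inj₁ (there (here refl)))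
two-shortcut false true true = pair± (inj₂ (here refl)) (inj₂ (there (here refl))) (inj₂ (here refl)) (inj₂ (there (here refl)))
two-shortcut true false false = pair± (inj₁ (there (here refl))) (inj₁ (here refl)) (inj₁ (there (here refl))) (inj₁ (here refl))
two-shortcut true false true = pair± (inj₁ (there (here refl))) (inj₂ (here refl)) (inj₂ (there (here refl))) (inj₁ (here refl))
two-shortcut true true false = pair± (inj₂ (there (here refl))) (inj₁ (here refl)) (inj₁ (there (here refl))) (inj₂ (here refl))
two-shortcut true true true = pair± (inj₂ (there (here refl))) (inj₂ (here refl)) (inj₂ (there (here refl))) (inj₂ (here refl))

-- Each of the two arcs runs from one arrow to the other. It joins a head to a tail if the arrows
-- point the same way round the circle, and like ends if they do not.
one-cross : ∀ {e l} s f f′ → let L = arcs ((l , ent e s f ∷ ent e (not s) f′ ∷ []) ∷ []) in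
  (flipped L (cross not e) × flipped (cross not e) L) ⊎ (flipped L (cross id e) × flipped (cross id e) L)
one-cross false false false = inj₁ (pair± (inj₁ (here refl)) (inj₂ (there (here refl))) (inj₁ (here refl)) (inj₂ (there (here refl))))
one-cross false false true = inj₂ (pair± (inj₁ (here refl)) (inj₂ (there (here refl))) (inj₁ (here refl)) (inj₂ (there (here refl))))
one-cross false true false = inj₂ (pair± (inj₁ (there (here refl))) (inj₂ (here refl)) (inj₂ (there (here refl))) (inj₁ (here refl)))
one-cross false true true = inj₁ (pair± (inj₁ (there (here refl))) (inj₂ (here refl)) (inj₂ (there (here refl))) (inj₁ (here refl)))
one-cross true false false = inj₁ (pair± (inj₂ (there (here refl))) (inj₁ (here refl)) (inj₁ (there (here refl))) (inj₂ (here refl)))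
one-cross true false true = inj₂ (pair± (inj₂ (here refl)) (inj₁ (there (here refl))) (inj₂ (here refl)) (inj₁ (there (here refl))))
one-cross true true false = inj₂ (pair± (inj₂ (there (here refl))) (inj₁ (here refl)) (inj₁ (there (here refl))) (inj₂ (here refl)))
one-cross true true true = inj₁ (pair± (inj₂ (here refl)) (inj₁ (there (here refl))) (inj₂ (here refl)) (inj₁ (there (here refl))))

-- The arcs of a one-edge presentation are themselves a perfect matching of the four endpoints, and
-- `type` is the operation with that matching. `joint` decides between `del` and `mdel`, whose
-- matchings coincide.
record Single (e : ℕ) (core : VPAP) : Set where
  field
    type  : Op
    arcs± : flipped (arcs core) (matching type e) × flipped (matching type e) (arcs core)
    bare0 : empties core ≡ 0
    joint : (type ≡ del × block core (pt e false false) ≢ block core (pt e true false))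
          ⊎ (type ≢ del × block core (pt e false false) ≡ block core (pt e true false))

single : ∀ {e core} → Unique (points core) → Shape e core → Single e core
single {e} {core} u (one l s f f′) =
  [ (λ a → record { type = con ; arcs± = a ; bare0 = refl ; joint = inj₂ ((λ ()) , same s) })
  , (λ a → record { type = pen ; arcs± = a ; bare0 = refl ; joint = inj₂ ((λ ()) , same s) }) ]′ (one-cross {e} {l} s f f′)
  where
  same : ∀ s → let c = (l , ent e s f ∷ ent e (not s) f′ ∷ []) ∷ [] in block c (pt e false false) ≡ block c (pt e true false)
  same false rewrite ≡ᵇ-refl e = refl
  same true rewrite ≡ᵇ-refl e = refl
single {e} {core} u (two l l′ s f f′) with block core (pt e false false) ℕₚ.≟ block core (pt e true false)
... | yes i = record { type = mdel ; arcs± = two-shortcut {e} {l} {l′} s f f′ ; bare0 = refl ; joint = inj₂ ((λ ()) , i) }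
... | no n = record { type = del ; arcs± = two-shortcut {e} {l} {l′} s f f′ ; bare0 = refl ; joint = inj₁ (refl , n) }

opaque
  unfolding curves

  curves-transfer : ∀ {L M L′ M′} (ρ σ : Pt → Pt) →
    (∀ {a b} → (a , b) ∈ L ++ M → ρ a ∼[ L′ ++ M′ ] ρ b) → (∀ {a b} → (a , b) ∈ L′ ++ M′ → σ a ∼[ L ++ M ] σ b) →
    (∀ {x} → x ∈ flat L → σ (ρ x) ∼[ L ++ M ] x) → (∀ {x} → x ∈ flat L → ρ x ∈ flat L′) →
    (∀ {y} → y ∈ flat L′ → y ∈ flat L × ρ y ≡ y) → curves L M ≡ curves L′ M′
  curves-transfer ρ σ f g h t s = comps-transfer _≟P_ _≟P_ ρ σ f g h (λ m → _ , t m , ε)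
    (λ m → _ , proj₁ (s m) , ≡⇒∼ (proj₂ (s m)))

-- Merging the arrows of f with those of an edge e in state t puts f in state t.
module SumCurves (L : List (Pt × Pt)) (f e : ℕ) (φ : Coupling) (t : Op) (M₀ : List (Pt × Pt))
  (offL : Off e L) (offM : Off e M₀) (f∈ : ∀ s h → pt f s h ∈ flat L) where

  swapSide : ℕ → Pt → Pt
  swapSide l p = pt l (pside p xor φ) (phead p)

  -- All four matchings are invariant under exchanging the two arrows of an edge. This is why the
  -- choice of the coupling does not affect the result.
  swap-matching : ∀ l k t {a b} → (a , b) ∈ matching t l → (swapSide k a , swapSide k b) ±∈ matching t k
  swap-matching l k del = go φ
    where
    go : ∀ φ {a b} → (a , b) ∈ shortcut l → (pt k (pside a xor φ) (phead a) , pt k (pside b xor φ) (phead b)) ±∈ shortcut k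
    go false (here refl) = inj₁ (here refl)
    go false (there (here refl)) = inj₁ (there (here refl))
    go true (here refl) = inj₁ (there (here refl))
    go true (there (here refl)) = inj₁ (here refl)
  swap-matching l k con = go φ
    where
    go : ∀ φ {a b} → (a , b) ∈ cross not l → (pt k (pside a xor φ) (phead a) , pt k (pside b xor φ) (phead b)) ±∈ cross not k
    go false (here refl) = inj₁ (here refl)
    go false (there (here refl)) = inj₁ (there (here refl))
    go true (here refl) = inj₂ (there (here refl))
    go true (there (here refl)) = inj₂ (here refl)
  swap-matching l k pen = go φ
    where
    go : ∀ φ {a b} → (a , b) ∈ cross id l → (pt k (pside a xor φ) (phead a) , pt k (pside b xor φ) (phead b)) ±∈ cross id k
    go false (here refl) = inj₁ (here refl)
    go false (there (here refl)) = inj₁ (there (here refl))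
    go true (here refl) = inj₂ (here refl)
    go true (there (here refl)) = inj₂ (there (here refl))
  swap-matching l k mdel = swap-matching l k del

  ρ : Pt → Pt
  ρ p = if plab p ≡ᵇ e then swapSide f p else p

  ρ-e : ∀ {p} → plab p ≡ e → ρ p ≡ swapSide f p
  ρ-e {p} refl rewrite ≡ᵇ-refl (plab p) = refl

  ρ-off : ∀ {p} → (plab p ≡ᵇ e) ≡ false → ρ p ≡ p
  ρ-off i rewrite i = refl

  X Y : List (Pt × Pt)
  X = (L ++ matching t e) ++ (sumMatching f e φ ++ M₀)
  Y = L ++ (matching t f ++ M₀)

  ±link : ∀ {a b M} → (a , b) ±∈ M → (∀ {l} → l ∈ M → l ∈ Y) → a ∼[ Y ] b
  ±link (inj₁ k) f = link (f k)
  ±link (inj₂ k) f = ∼-sym (link (f k))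

  sum∼ : ∀ s h → pt f s h ∼[ X ] pt e (s xor φ) h
  sum∼ s h = link (∈-++⁺ʳ (L ++ matching t e) (∈-++⁺ˡ (∈-sumMatching f e φ s h)))

  sum∼′ : ∀ {p} → plab p ≡ f → p ∼[ X ] swapSide e p
  sum∼′ {p} refl = sum∼ (pside p) (phead p)

  ρ-sum : ∀ s h → ρ (pt f s h) ∼[ Y ] ρ (pt e (s xor φ) h)
  ρ-sum s h = ≡⇒∼ (trans (ρ-off (let y , k = ∈-flat⁻ L (f∈ s h) in offL (f∈ s h)))
    (sym (trans (ρ-e {pt e (s xor φ) h} refl) (cong (λ z → pt f z h) (xor-xor s φ)))))

  forth : ∀ {a b} → (a , b) ∈ X → ρ a ∼[ Y ] ρ b
  forth m with ∈-++⁻ (L ++ matching t e) m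
  forth m | inj₁ k with ∈-++⁻ L k
  ... | inj₁ j = ≡⇒∼ (ρ-off (offL (∈-flat₁ j))) ◅◅ link (∈-++⁺ˡ j) ◅◅ ≡⇒∼ (sym (ρ-off (offL (∈-flat₂ j))))
  ... | inj₂ j = ≡⇒∼ (ρ-e (flat-matching t e (∈-flat₁ j))) ◅◅ ±link (swap-matching e f t j) (∈-++⁺ʳ L ∘ ∈-++⁺ˡ)
                 ◅◅ ≡⇒∼ (sym (ρ-e (flat-matching t e (∈-flat₂ j))))
  forth m | inj₂ k with ∈-++⁻ (sumMatching f e φ) k
  ... | inj₁ (here refl) = ρ-sum false false
  ... | inj₁ (there (here refl)) = ρ-sum false true
  ... | inj₁ (there (there (here refl))) = ρ-sum true false
  ... | inj₁ (there (there (there (here refl)))) = ρ-sum true true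
  ... | inj₂ j = ≡⇒∼ (ρ-off (offM (∈-flat₁ j))) ◅◅ link (∈-++⁺ʳ L (∈-++⁺ʳ (matching t f) j)) ◅◅ ≡⇒∼ (sym (ρ-off (offM (∈-flat₂ j))))

  back : ∀ {a b} → (a , b) ∈ Y → a ∼[ X ] b
  back m with ∈-++⁻ L m
  ... | inj₁ k = link (∈-++⁺ˡ (∈-++⁺ˡ k))
  ... | inj₂ k with ∈-++⁻ (matching t f) k
  ... | inj₂ j = link (∈-++⁺ʳ (L ++ matching t e) (∈-++⁺ʳ (sumMatching f e φ) j))
  ... | inj₁ j = sum∼′ (flat-matching t f (∈-flat₁ j)) ◅◅ mid (swap-matching f e t j) ◅◅ ∼-sym (sum∼′ (flat-matching t f (∈-flat₂ j)))
    where
    mid : ∀ {a b} → (a , b) ±∈ matching t e → a ∼[ X ] b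
    mid (inj₁ k) = link (∈-++⁺ˡ (∈-++⁺ʳ L k))
    mid (inj₂ k) = ∼-sym (link (∈-++⁺ˡ (∈-++⁺ʳ L k)))

  sum-curves : curves (L ++ matching t e) (sumMatching f e φ ++ M₀) ≡ curves L (matching t f ++ M₀)
  sum-curves = curves-transfer ρ id forth back σρ tot (λ m → subst (_ ∈_) (sym (flat-++ L (matching t e))) (∈-++⁺ˡ m) , ρ-off (offL m))
    where
    σρ : ∀ {x} → x ∈ flat (L ++ matching t e) → ρ x ∼[ X ] x
    σρ {x} m with ∈-++⁻ (flat L) (subst (_ ∈_) (flat-++ L (matching t e)) m)
    ... | inj₁ k = ≡⇒∼ (ρ-off (offL k))
    ... | inj₂ k with flat-matching t e k
    ... | refl = ≡⇒∼ (ρ-e {x} refl) ◅◅ sum∼′ refl ◅◅ ≡⇒∼ (cong (λ z → pt (plab x) z (phead x)) (xor-xor (pside x) φ))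
    tot : ∀ {x} → x ∈ flat (L ++ matching t e) → ρ x ∈ flat L
    tot {x} m with ∈-++⁻ (flat L) (subst (_ ∈_) (flat-++ L (matching t e)) m)
    ... | inj₁ k = subst (_∈ flat L) (sym (ρ-off (offL k))) k
    ... | inj₂ k = subst (_∈ flat L) (sym (ρ-e (flat-matching t e k))) (f∈ _ _)

-- The exponents of β in the matrix of the linear system.
blocks : Op → Op → ℕ
blocks del del = 2
blocks _ _ = 1

joins-both : ∀ {t f} → t ≢ del → joins t f ≡ both f
joins-both {del} n = ⊥-elim (n refl)
joins-both {con} n = refl
joins-both {pen} n = refl
joins-both {mdel} n = refl

module SingleBlocks {e : ℕ} {core : VPAP} (u : Unique (points core)) (le : ∀ {p} → p ∈ points core → plab p ≡ e)
  (es : ∀ s h → pt e s h ∈ points core) (ne : ∀ {c} → c ∈ core → proj₂ c ≢ []) (sg : Single e core) where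
  open Single sg

  ℓ : Bool → ℕ
  ℓ s = block core (pt e s false)

  sided : ∀ {c p} → c ∈ core → p ∈ pts (proj₂ c) → proj₁ c ≡ ℓ (pside p)
  sided {p = p} c∈ p∈ = trans (sym (block-circle u c∈ p∈)) (cong (λ z → blockOf z (pside p) core) (le (∈-points⁺ c∈ p∈)))

  onto : ∀ s → ∃ λ c → c ∈ core × pt e s false ∈ pts (proj₂ c) × proj₁ c ≡ ℓ s
  onto s with ∈-points⁻ core (es s false)
  ... | c , c∈ , k = c , c∈ , k , sided c∈ k

  which : ∀ {c} → c ∈ core → ∃ λ s → proj₁ c ≡ ℓ s
  which {l , []} c∈ = ⊥-elim (ne c∈ refl)
  which {l , x ∷ w} c∈ = _ , sided c∈ (here refl)

  ℓ∈ : ∀ s → inj₁ (ℓ s) ∈ labels core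
  ℓ∈ s = let c , c∈ , _ , i = onto s in subst (λ z → inj₁ z ∈ labels core) i (∈-map⁺ _ c∈)

  ℓ∼ : ∀ {J} s → inj₁ (ℓ s) ∼[ blockGraph core J ] inj₂ (pt e s false)
  ℓ∼ {J} s = block∼ {core} {J} u (es s false)

  connected : ∀ {J} → (∀ s → inj₁ (ℓ s) ∼[ blockGraph core J ] inj₁ (ℓ false)) → blockCount core J ≡ 1
  connected {J} h = Components.comps-unique _≟N_ {rs = inj₁ (ℓ false) ∷ []} record
    { separated = [] ∷ []
    ; from = λ { (here refl) → _ , ℓ∈ false , ε }
    ; cover = cover }
    where
    cover : ∀ {x} → x ∈ labels core → ∃ λ r → r ∈ inj₁ (ℓ false) ∷ [] × x ∼[ blockGraph core J ] r
    cover m with ∈-map⁻ _ m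
    ... | c , c∈ , refl with which c∈
    ... | s , i = _ , here refl , ≡⇒∼ (cong inj₁ i) ◅◅ h s

  -- An invariant that is constant along every link as long as nothing is joined; it tells the two
  -- blocks apart.
  κ : Node → ℕ
  κ (inj₁ l) = l
  κ (inj₂ p) = ℓ (pside p)

  κ-inv : ∀ {a b} → BlockEdge core [] a b → κ a ≡ κ b
  κ-inv (inside c∈ p∈) = sided c∈ p∈

  disconnected : ℓ false ≢ ℓ true → blockCount core [] ≡ 2
  disconnected n = Components.comps-unique _≟N_ {rs = inj₁ (ℓ false) ∷ inj₁ (ℓ true) ∷ []} record
    { separated = ((λ r → n (∼-fold (On.isEquivalence κ isEquivalence) (κ-inv ∘ blockEdge core) r)) ∷ []) ∷ [] ∷ []
    ; from = λ { (here refl) → _ , ℓ∈ false , ε ; (there (here refl)) → _ , ℓ∈ true , ε }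
    ; cover = cover }
    where
    cover : ∀ {x} → x ∈ labels core → ∃ λ r → r ∈ inj₁ (ℓ false) ∷ inj₁ (ℓ true) ∷ [] × x ∼[ blockGraph core [] ] r
    cover m with ∈-map⁻ _ m
    ... | c , c∈ , refl with which c∈
    ... | false , i = _ , here refl , ≡⇒∼ (cong inj₁ i)
    ... | true , i = _ , there (here refl) , ≡⇒∼ (cong inj₁ i)

  blocks-joint : ∀ {t} → t ≢ del → ∀ o → blocks t o ≡ 1
  blocks-joint {del} n o = ⊥-elim (n refl)
  blocks-joint {con} n o = refl
  blocks-joint {pen} n o = refl
  blocks-joint {mdel} n o = refl

  self-blocks : ∀ o → blockCount core (joins o e) ≡ blocks type o
  self-blocks o with joint
  ... | inj₂ (n , i) = trans (connected {joins o e} (λ { false → ε ; true → ≡⇒∼ (cong inj₁ (sym i)) })) (sym (blocks-joint n o))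
  ... | inj₁ (t , n) = trans (go o) (cong (λ t → blocks t o) (sym t))
    where
    by-join : blockCount core (both e) ≡ 1
    by-join = connected {both e} (λ { false → ε ; true → ℓ∼ {both e} true ◅◅ ∼-sym (joined∼ {core} {both e} (here refl)) ◅◅ ∼-sym (ℓ∼ {both e} false) })
    go : ∀ o → blockCount core (joins o e) ≡ blocks del o
    go del = disconnected n
    go con = by-join
    go pen = by-join
    go mdel = by-join

  module _ {G : VPAP} (pG : Proper G) (dis : Disjoint G core) {f : ℕ} (φ : Coupling) (f∈ : IsEdge G f)
    {J₀ : List (Pt × Pt)} (off : Off e J₀) where

    private
      J J′ : List (Pt × Pt)
      J = sumJoins f e φ ++ J₀
      J′ = joins type f ++ J₀

      X Y : List (Node × Node)
      X = blockGraph (G ++ core) J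
      Y = blockGraph G J′

      f∈s : ∀ s h → pt f s h ∈ points G
      f∈s = Proper.full pG f∈

      offG : ∀ {p} → p ∈ points G → (plab p ≡ᵇ e) ≡ false
      offG m = ≡ᵇ-false (proj₁ dis m (es false false))

      side∼ : type ≢ del → ∀ s s′ → inj₂ (pt f s false) ∼[ Y ] inj₂ (pt f s′ false)
      side∼ n s s′ = base s ◅◅ ∼-sym (base s′)
        where
        base : ∀ s → inj₂ (pt f s false) ∼[ Y ] inj₂ (pt f false false)
        base false = ε
        base true = ∼-sym (joined∼ {G} {J′} (∈-++⁺ˡ (subst ((pt f false false , pt f true false) ∈_) (sym (joins-both n)) (here refl))))

      at : Bool → Node
      at s = inj₂ (pt f (s xor φ) false)

      ρ : Node → Node
      ρ (inj₁ l) = if l ≡ᵇ ℓ false then at false else if l ≡ᵇ ℓ true then at true else inj₁ l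
      ρ (inj₂ p) = if plab p ≡ᵇ e then at (pside p) else inj₂ p

      -- If both arrows lie in the same block, the first test in `ρ` catches both sides and sends
      -- them to `at false`. Then `type` is not `del`, so the two sides of `f` are joined in the
      -- target graph as well.
      ρ-ℓ : ∀ s → ρ (inj₁ (ℓ s)) ∼[ Y ] at s
      ρ-ℓ false rewrite ≡ᵇ-refl (ℓ false) = ε
      ρ-ℓ true with ℓ true ≡ᵇ ℓ false in i
      ... | false rewrite ≡ᵇ-refl (ℓ true) = ε
      ... | true with joint
      ... | inj₁ (_ , n) = ⊥-elim (n (sym (≡ᵇ-sound {ℓ true} {ℓ false} i)))
      ... | inj₂ (n , _) = side∼ n (false xor φ) (true xor φ)

      ρ-e : ∀ {p} → plab p ≡ e → ρ (inj₂ p) ≡ at (pside p)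
      ρ-e {p} refl rewrite ≡ᵇ-refl (plab p) = refl

      ρ-off : ∀ {p} → (plab p ≡ᵇ e) ≡ false → ρ (inj₂ p) ≡ inj₂ p
      ρ-off i rewrite i = refl

      ρ-G : ∀ {c} → c ∈ G → ρ (inj₁ (proj₁ c)) ≡ inj₁ (proj₁ c)
      ρ-G {c} c∈ with proj₁ c ≡ᵇ ℓ false in i | proj₁ c ≡ᵇ ℓ true in k
      ... | false | false = refl
      ... | true | _ = let d , d∈ , _ , j = onto false in ⊥-elim (proj₂ dis c∈ d∈ (trans (≡ᵇ-sound i) (sym j)))
      ... | false | true = let d , d∈ , _ , j = onto true in ⊥-elim (proj₂ dis c∈ d∈ (trans (≡ᵇ-sound k) (sym j)))

      ρ-sum : ∀ s → ρ (inj₂ (pt f s false)) ∼[ Y ] ρ (inj₂ (pt e (s xor φ) false))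
      ρ-sum s = ≡⇒∼ (trans (ρ-off (offG (f∈s s false))) (trans (cong (λ z → inj₂ (pt f z false)) (sym (xor-xor s φ))) (sym (ρ-e {pt e (s xor φ) false} refl))))

      forth : ∀ {a b} → BlockEdge (G ++ core) J a b → ρ a ∼[ Y ] ρ b
      forth (inside c∈ p∈) with ∈-++⁻ G c∈
      ... | inj₁ k = ≡⇒∼ (ρ-G k) ◅◅ inside∼ {G} {J′} k p∈ ◅◅ ≡⇒∼ (sym (ρ-off (offG (∈-points⁺ k p∈))))
      ... | inj₂ k = ≡⇒∼ (cong (ρ ∘ inj₁) (sided k p∈)) ◅◅ ρ-ℓ _ ◅◅ ≡⇒∼ (sym (ρ-e (le (∈-points⁺ k p∈))))
      forth (joined j) with ∈-++⁻ (sumJoins f e φ) j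
      ... | inj₁ (here refl) = ρ-sum false
      ... | inj₁ (there (here refl)) = ρ-sum true
      ... | inj₂ k = ≡⇒∼ (ρ-off (off (∈-flat₁ k))) ◅◅ joined∼ {G} {J′} (∈-++⁺ʳ (joins type f) k) ◅◅ ≡⇒∼ (sym (ρ-off (off (∈-flat₂ k))))

      in-core : ∀ s → inj₁ (ℓ s) ∼[ X ] inj₂ (pt e s false)
      in-core s = let c , c∈ , k , i = onto s in ≡⇒∼ (cong inj₁ (sym i)) ◅◅ inside∼ {G ++ core} {J} (∈-++⁺ʳ G c∈) k

      sum∼ : ∀ s → inj₂ (pt f s false) ∼[ X ] inj₁ (ℓ (s xor φ))
      sum∼ s = joined∼ {G ++ core} {J} (∈-++⁺ˡ (∈-sumJoins f e φ s)) ◅◅ ∼-sym (in-core (s xor φ))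

      ℓ-equal : type ≢ del → ∀ s s′ → ℓ s ≡ ℓ s′
      ℓ-equal n s s′ with joint
      ... | inj₁ (i , _) = ⊥-elim (n i)
      ... | inj₂ (_ , i) = trans (base s) (sym (base s′))
        where
        base : ∀ s → ℓ s ≡ ℓ false
        base false = refl
        base true = sym i

      both∼ : ∀ {a b} → type ≢ del → (a , b) ∈ both f → inj₂ a ∼[ X ] inj₂ b
      both∼ n (here refl) = sum∼ false ◅◅ ≡⇒∼ (cong inj₁ (ℓ-equal n _ _)) ◅◅ ∼-sym (sum∼ true)

      joins∼ : ∀ t → t ≡ type → ∀ {a b} → (a , b) ∈ joins t f → inj₂ a ∼[ X ] inj₂ b
      joins∼ con refl = both∼ λ ()
      joins∼ pen refl = both∼ λ ()
      joins∼ mdel refl = both∼ λ ()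

      back : ∀ {a b} → BlockEdge G J′ a b → a ∼[ X ] b
      back (inside c∈ p∈) = inside∼ {G ++ core} {J} (∈-++⁺ˡ c∈) p∈
      back (joined j) with ∈-++⁻ (joins type f) j
      ... | inj₁ k = joins∼ type refl k
      ... | inj₂ k = joined∼ {G ++ core} {J} (∈-++⁺ʳ (sumJoins f e φ) k)

      split-label : ∀ {x} → x ∈ labels (G ++ core) → (∃ λ c → c ∈ G × x ≡ inj₁ (proj₁ c)) ⊎ (∃ λ s → x ≡ inj₁ (ℓ s))
      split-label m with ∈-map⁻ _ m
      ... | c , c∈ , refl with ∈-++⁻ G c∈
      ... | inj₁ k = inj₁ (c , k , refl)
      ... | inj₂ k = let s , i = which k in inj₂ (s , cong inj₁ i)

      at∼ : ∀ s → at s ∼[ X ] inj₁ (ℓ s)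
      at∼ s = sum∼ (s xor φ) ◅◅ ≡⇒∼ (cong (inj₁ ∘ ℓ) (xor-xor s φ))

      ρ-ℓ-cases : ∀ s → ρ (inj₁ (ℓ s)) ∼[ X ] inj₁ (ℓ s)
      ρ-ℓ-cases s with ℓ s ≡ᵇ ℓ false in i | ℓ s ≡ᵇ ℓ true in k
      ... | true | _ = at∼ false ◅◅ ≡⇒∼ (cong inj₁ (sym (≡ᵇ-sound {ℓ s} {ℓ false} i)))
      ... | false | true = at∼ true ◅◅ ≡⇒∼ (cong inj₁ (sym (≡ᵇ-sound {ℓ s} {ℓ true} k)))
      ... | false | false = ε

    sum-blocks : blockCount (G ++ core) J ≡ blockCount G J′
    sum-blocks = comps-transfer _≟N_ _≟N_ ρ id (forth ∘ blockEdge (G ++ core)) (back ∘ blockEdge G) σρ tot sur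
      where
      σρ : ∀ {x} → x ∈ labels (G ++ core) → ρ x ∼[ X ] x
      σρ m with split-label m
      ... | inj₁ (c , c∈ , refl) = ≡⇒∼ (ρ-G c∈)
      ... | inj₂ (s , refl) = ρ-ℓ-cases s
      tot : ∀ {x} → x ∈ labels (G ++ core) → ∃ λ y → y ∈ labels G × ρ x ∼[ Y ] y
      tot m with split-label m
      ... | inj₁ (c , c∈ , refl) = _ , ∈-map⁺ _ c∈ , ≡⇒∼ (ρ-G c∈)
      ... | inj₂ (s , refl) with ∈-points⁻ G (f∈s (s xor φ) false)
      ... | c , c∈ , k = _ , ∈-map⁺ _ c∈ , ρ-ℓ s ◅◅ ∼-sym (inside∼ {G} {J′} c∈ k)
      sur : ∀ {y} → y ∈ labels G → ∃ λ x → x ∈ labels (G ++ core) × ρ x ∼[ Y ] y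
      sur m with ∈-map⁻ _ m
      ... | c , c∈ , refl = _ , ∈-map⁺ _ (∈-++⁺ˡ c∈) , ≡⇒∼ (ρ-G c∈)

-- The effect of H on any 2-sum along e, when e is its only edge: up to m extra circles and n extra
-- blocks, the other edge is put in state `type`.
record Classified (H : VPAP) (e : ℕ) : Set where
  field
    type : Op
    m n  : ℕ
    self-curveCount : ∀ o → curveCount H (matching o e) ≡ m ℕ.+ loops type o
    self-blockCount : ∀ o → blockCount H (joins o e) ≡ n ℕ.+ blocks type o
    sum-curveCount : ∀ {G f φ M₀} → Proper G → Disjoint G H → IsEdge G f → Off e M₀ →
      curveCount (G ++ H) (sumMatching f e φ ++ M₀) ≡ m ℕ.+ curveCount G (matching type f ++ M₀)
    sum-blockCount : ∀ {G f φ J₀} → Proper G → Disjoint G H → IsEdge G f → Off e J₀ →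
      blockCount (G ++ H) (sumJoins f e φ ++ J₀) ≡ n ℕ.+ blockCount G (joins type f ++ J₀)

curveCount-bare : ∀ X {Z M} → (∀ {c} → c ∈ Z → proj₂ c ≡ []) → curveCount (X ++ Z) M ≡ length Z ℕ.+ curveCount X M
curveCount-bare X {Z} {M} b = begin
  empties (X ++ Z) ℕ.+ curves (arcs (X ++ Z)) M ≡⟨ cong₂ (λ i L → i ℕ.+ curves L M)
    (trans (empties-++ X) (cong (empties X ℕ.+_) (all-empty Z b)))
    (trans (arcs-++ X) (trans (cong (arcs X ++_) (no-arcs Z b)) (Listₚ.++-identityʳ (arcs X)))) ⟩
  (empties X ℕ.+ length Z) ℕ.+ curves (arcs X) M ≡⟨ cong (ℕ._+ curves (arcs X) M) (ℕₚ.+-comm (empties X) (length Z)) ⟩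
  (length Z ℕ.+ empties X) ℕ.+ curves (arcs X) M ≡⟨ ℕₚ.+-assoc (length Z) (empties X) _ ⟩
  length Z ℕ.+ curveCount X M ∎
  where
  open ≡-Reasoning
  all-empty : ∀ Z → (∀ {c} → c ∈ Z → proj₂ c ≡ []) → empties Z ≡ length Z
  all-empty [] b = refl
  all-empty (c ∷ Z) b rewrite b (here refl) = cong suc (all-empty Z (b ∘ there))
  no-arcs : ∀ Z → (∀ {c} → c ∈ Z → proj₂ c ≡ []) → arcs Z ≡ []
  no-arcs [] b = refl
  no-arcs (c ∷ Z) b rewrite b (here refl) = no-arcs Z (b ∘ there)

points-bare : ∀ Z → (∀ {c} → c ∈ Z → proj₂ c ≡ []) → points Z ≡ []
points-bare [] b = refl
points-bare (c ∷ Z) b rewrite b (here refl) = points-bare Z (b ∘ there)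

module _ (core Z : VPAP) (b : ∀ {c} → c ∈ Z → proj₂ c ≡ []) where
  open DecMembership _≟N_ using (_∈?_)

  isolated : List Node
  isolated = List.filter (λ x → ¬? (x ∈? labels core)) (labels Z)

  blockCount-bare : ∀ {X J} → (∀ {x} → x ∈ labels core → x ∈ labels X) →
    (∀ {x} → x ∈ labels X → x ∈ labels Z → x ∈ labels core) →
    blockCount (X ++ Z) J ≡ Components.comps _≟N_ isolated [] ℕ.+ blockCount X J
  blockCount-bare {X} {J} sub sup = trans
    (comps-cong _≟N_ (to ∘ blockEdge (X ++ Z)) (fro ∘ ∈-++⁻ (blockGraph X J)) nodes⁺ nodes⁻)
    (trans (Components.comps-++ _≟N_ (_∉ isolated) (labels X) isolated (blockGraph X J) []
       (λ m k → let j , n = ∈-filter⁻ (λ x → ¬? (x ∈? labels core)) {xs = labels Z} k in n (sup m j)) (λ m n → n m)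
       (apart ∘ blockEdge X) (λ ()))
      (ℕₚ.+-comm (blockCount X J) _))
    where
    to : ∀ {x y} → BlockEdge (X ++ Z) J x y → x ∼[ blockGraph X J ++ [] ] y
    to (inside c∈ p∈) with ∈-++⁻ X c∈
    ... | inj₁ k = ∼-weaken ∈-++⁺ˡ (inside∼ {X} {J} k p∈)
    ... | inj₂ k with subst (λ w → _ ∈ pts w) (b k) p∈
    ... | ()
    to (joined j) = ∼-weaken ∈-++⁺ˡ (joined∼ {X} {J} j)
    fro : ∀ {x y} → (x , y) ∈ blockGraph X J ⊎ (x , y) ∈ [] → x ∼[ blockGraph (X ++ Z) J ] y
    fro (inj₁ m) with blockEdge X m
    ... | inside c∈ p∈ = inside∼ {X ++ Z} {J} (∈-++⁺ˡ c∈) p∈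
    ... | joined j = joined∼ {X ++ Z} {J} j
    nodes⁺ : ∀ {x} → x ∈ labels (X ++ Z) → x ∈ labels X ++ isolated
    nodes⁺ {x} m with ∈-++⁻ (labels X) (subst (_ ∈_) (Listₚ.map-++ _ X Z) m)
    ... | inj₁ k = ∈-++⁺ˡ k
    ... | inj₂ k with x ∈? labels core
    ... | yes j = ∈-++⁺ˡ (sub j)
    ... | no n = ∈-++⁺ʳ (labels X) (∈-filter⁺ (λ x → ¬? (x ∈? labels core)) k n)
    nodes⁻ : ∀ {x} → x ∈ labels X ++ isolated → x ∈ labels (X ++ Z)
    nodes⁻ m with ∈-++⁻ (labels X) m
    ... | inj₁ k = subst (_ ∈_) (sym (Listₚ.map-++ _ X Z)) (∈-++⁺ˡ k)
    ... | inj₂ k = subst (_ ∈_) (sym (Listₚ.map-++ _ X Z)) (∈-++⁺ʳ (labels X) (proj₁ (∈-filter⁻ (λ x → ¬? (x ∈? labels core)) {xs = labels Z} k)))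
    point∉ : ∀ {p} → inj₂ p ∉ isolated
    point∉ k with ∈-map⁻ _ (proj₁ (∈-filter⁻ (λ x → ¬? (x ∈? labels core)) {xs = labels Z} k))
    ... | _ , _ , ()
    apart : ∀ {x y} → BlockEdge X J x y → x ∉ isolated × y ∉ isolated
    apart (inside c∈ p∈) = (λ k → let j , n = ∈-filter⁻ (λ x → ¬? (x ∈? labels core)) {xs = labels Z} k in n (sup (∈-map⁺ _ c∈) j)) , point∉
    apart (joined j) = point∉ , point∉

-- Bare circles are set aside, and what remains is one of the four one-edge shapes. They contribute
-- the same circles and blocks whether `H` stands alone or next to `G`, which is why a single `m`
-- and a single `n` serve both the self counts and the 2-sum counts.
classify : ∀ {H e} → Proper H → IsEdge H e → (∀ {p} → p ∈ points H → plab p ≡ e) → Classified H e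
classify {H} {e} pH e∈ le = record
  { type = type
  ; m = length rest
  ; n = Components.comps _≟N_ (isolated core rest empty) []
  ; self-curveCount = λ o → trans (curveCount-↭ perm) (trans (curveCount-bare core empty)
      (cong (length rest ℕ.+_) (trans (cong₂ ℕ._+_ bare0 (curves-flippedˡ (proj₁ arcs±) (proj₂ arcs±))) (curves-matching type o e))))
  ; self-blockCount = λ o → trans (blockCount-↭ {J = joins o e} perm)
      (trans (blockCount-bare core rest empty {core} {joins o e} id (λ m _ → m)) (cong (_ ℕ.+_) (SB.self-blocks o)))
  ; sum-curveCount = λ {G} {f} {φ} {M₀} pG dis f∈ off → trans (curveCount-↭ (reassoc G)) (trans (curveCount-bare (G ++ core) empty)
      (cong (length rest ℕ.+_) (trans (cong₂ ℕ._+_ (trans (empties-++ G) (trans (cong (empties G ℕ.+_) bare0) (ℕₚ.+-identityʳ _)))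
        (trans (cong (λ z → curves z (sumMatching f e φ ++ M₀)) (arcs-++ G)) (curves-flippedˡ (ext G (proj₁ arcs±)) (ext G (proj₂ arcs±)))))
        (cong (empties G ℕ.+_) (SumCurves.sum-curves (arcs G) f e φ type M₀
          (λ m → ≡ᵇ-false (proj₁ dis (↭⇒∈ (flat-arcs G) m) e∈)) off (λ s h → ↭⇒∈ (↭-sym (flat-arcs G)) (Proper.full pG f∈ s h)))))))
  ; sum-blockCount = λ {G} {f} {φ} {J₀} pG dis f∈ off → trans (blockCount-↭ {J = sumJoins f e φ ++ J₀} (reassoc G))
      (trans (blockCount-bare core rest empty {G ++ core} {sumJoins f e φ ++ J₀}
          (λ m → subst (_ ∈_) (sym (Listₚ.map-++ _ G core)) (∈-++⁺ʳ (labels G) m)) (apart G dis))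
        (cong (_ ℕ.+_) (SB.sum-blocks pG (core-disjoint G dis) φ f∈ {J₀} off)))
  }
  where
  open Sorted (sort H)
  points↭ : points H ↭ points core
  points↭ = ↭-trans (points-↭ perm) (Perm.↭-reflexive (trans (points-++ core) (trans (cong (points core ++_) (points-bare rest empty)) (Listₚ.++-identityʳ _))))
  uc : Unique (points core)
  uc = Unique-↭ points↭ (Proper.unique pH)
  le′ : ∀ {p} → p ∈ points core → plab p ≡ e
  le′ m = le (↭⇒∈ (↭-sym points↭) m)
  es : ∀ s h → pt e s h ∈ points core
  es s h = ↭⇒∈ points↭ (Proper.full pH e∈ s h)
  sg : Single e core
  sg = single uc (shape core uc nonempty le′ (λ s → es s false))
  open Single sg
  module SB = SingleBlocks uc le′ es nonempty sg
  reassoc : ∀ G → G ++ H ↭ (G ++ core) ++ rest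
  reassoc G = ↭-trans (Permₚ.++⁺ˡ G perm) (Perm.↭-reflexive (sym (Listₚ.++-assoc G core rest)))
  ext : ∀ G {L L′} → flipped L L′ → flipped (arcs G ++ L) (arcs G ++ L′)
  ext G f m with ∈-++⁻ (arcs G) m
  ... | inj₁ k = inj₁ (∈-++⁺ˡ k)
  ... | inj₂ k with f k
  ... | inj₁ j = inj₁ (∈-++⁺ʳ (arcs G) j)
  ... | inj₂ j = inj₂ (∈-++⁺ʳ (arcs G) j)
  apart : ∀ G → Disjoint G H → ∀ {x} → x ∈ labels (G ++ core) → x ∈ labels rest → x ∈ labels core
  apart G dis m k with ∈-++⁻ (labels G) (subst (_ ∈_) (Listₚ.map-++ _ G core) m)
  ... | inj₂ j = j
  ... | inj₁ j with ∈-map⁻ _ j | ∈-map⁻ _ k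
  ... | c , c∈ , refl | d , d∈ , i = ⊥-elim (proj₂ dis c∈ (↭⇒∈ (↭-sym perm) (∈-++⁺ʳ core d∈)) (Sumₚ.inj₁-injective i))
  core-disjoint : ∀ G → Disjoint G H → Disjoint G core
  core-disjoint G dis = (λ p∈ q∈ → proj₁ dis p∈ (↭⇒∈ (↭-sym points↭) q∈)) , (λ c∈ d∈ → proj₂ dis c∈ (↭⇒∈ (↭-sym perm) (∈-++⁺ˡ d∈)))

-- Well-formed presentations

points-entries : ∀ G → points G ≡ pts (entries G)
points-entries [] = refl
points-entries (c ∷ G) = trans (cong (pts (proj₂ c) ++_) (points-entries G)) (sym (pts-++ (proj₂ c)))

count-some : ∀ l s E {y} → y ∈ E → isArrow l s y ≡ true → 1 ≤ length (filterᵇ (isArrow l s) E)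
count-some l s (x ∷ E) (here refl) i rewrite i = s≤s z≤n
count-some l s (x ∷ E) (there m) i with isArrow l s x
... | true = s≤s z≤n
... | false = count-some l s E m i

count-exists : ∀ l s E → 1 ≤ length (filterᵇ (isArrow l s) E) → ∃ λ y → y ∈ E × isArrow l s y ≡ true
count-exists l s (x ∷ E) c with isArrow l s x in i
... | true = x , here refl , i
... | false = let y , y∈ , j = count-exists l s E c in y , there y∈ , j

count-∷ : ∀ l s x E → length (filterᵇ (isArrow l s) E) ≤ length (filterᵇ (isArrow l s) (x ∷ E))
count-∷ l s x E with isArrow l s x
... | true = ℕₚ.n≤1+n _
... | false = ℕₚ.≤-refl

isArrow-self : ∀ x → isArrow (lab x) (side x) x ≡ true
isArrow-self x rewrite ≡ᵇ-refl (lab x) | beq-refl (side x) = refl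

isArrow-pts : ∀ E {p} → p ∈ pts E → ∃ λ y → y ∈ E × isArrow (plab p) (pside p) y ≡ true
isArrow-pts E m with entries-∈ E m
... | y , k , inj₁ refl = y , k , isArrow-self y
... | y , k , inj₂ refl = y , k , isArrow-self y

Unique-pts : ∀ E → (∀ {x} → x ∈ E → length (filterᵇ (isArrow (lab x) (side x)) E) ≤ 1) → Unique (pts E)
Unique-pts [] h = []
Unique-pts (x ∷ E) h = (entry≢exit ∷ All.tabulate (λ {p} m i → fresh m (sym (cong plab i)) (sym (cong pside i))))
    ∷ All.tabulate (λ {p} m i → fresh m (sym (cong plab i)) (sym (cong pside i)))
    ∷ Unique-pts E (λ {y} m → ℕₚ.≤-trans (count-∷ (lab y) (side y) x E) (h (there m)))
  where
  entry≢exit : entryPt x ≢ exitPt x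
  entry≢exit i = Boolₚ.not-¬ {fwd x} refl (sym (cong phead i))
  fresh : ∀ {p} → p ∈ pts E → plab p ≡ lab x → pside p ≡ side x → ⊥
  fresh {p} m i j with isArrow-pts E m | h (here refl)
  ... | y , y∈ , k | c rewrite isArrow-self x | i | j with count-some (lab x) (side x) E y∈ k
  ... | d with ℕₚ.≤-trans (s≤s d) c
  ... | s≤s ()

WF⇒Proper : ∀ {G} → WF G → Proper G
WF⇒Proper {G} wf = record
  { unique = subst Unique (sym (points-entries G)) (Unique-pts (entries G) (λ {x} m → ℕₚ.≤-reflexive (once (side x) (∈-map⁺ lab m))))
  ; full = full
  }
  where
  once : ∀ s {l} → l ∈ labs G → length (filterᵇ (isArrow l s) (entries G)) ≡ 1
  once false m = proj₁ (wf _ m)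
  once true m = proj₂ (wf _ m)
  full : ∀ {p} → p ∈ points G → ∀ s h → pt (plab p) s h ∈ points G
  full m s h with lab-pts (entries G) (subst (_ ∈_) (points-entries G) m)
  ... | x , x∈ , refl with count-exists (lab x) s (entries G) (ℕₚ.≤-reflexive (sym (once s (∈-map⁺ lab x∈))))
  ... | ent l s′ f , y∈ , i with ∧-true {l ≡ᵇ lab x} i
  ... | i₁ , i₂ rewrite ≡ᵇ-sound {l} {lab x} i₁ | beq-sound {s′} {s} i₂ | points-entries G with Bool-split h f
  ... | inj₁ refl = ∈-exitPt y∈
  ... | inj₂ refl = ∈-entryPt y∈

∈-labs : ∀ {G p} → p ∈ points G → plab p ∈ labs G
∈-labs {G} m with lab-pts (entries G) (subst (_ ∈_) (points-entries G) m)
... | x , x∈ , e = subst (_∈ labs G) (sym e) (∈-map⁺ lab x∈)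

labs-edge : ∀ {G l} → Proper G → l ∈ labs G → IsEdge G l
labs-edge {G} pG m with ∈-map⁻ lab m
... | x , x∈ , refl = Proper.full pG {exitPt x} (subst (exitPt x ∈_) (sym (points-entries G)) (∈-exitPt x∈)) false false

record EdgeList (E : List ℕ) (G : VPAP) : Set where
  field
    unique   : Unique E
    sound    : ∀ {l} → l ∈ E → IsEdge G l
    complete : ∀ {p} → p ∈ points G → plab p ∈ E

edges-list : ∀ {G} → Proper G → EdgeList (edges G) G
edges-list {G} pG = record
  { unique = UniqueDecₚ.deduplicate-! ℕₚ._≟_ (labs G)
  ; sound = λ m → labs-edge pG (∈-deduplicate⁻ ℕₚ._≟_ (labs G) m)
  ; complete = λ m → ∈-deduplicate⁺ ℕₚ._≟_ (∈-labs {G} m)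
  }

EdgeList-↭ : ∀ {E E′ G} → E ↭ E′ → EdgeList E G → EdgeList E′ G
EdgeList-↭ p L = record
  { unique = Unique-↭ p (EdgeList.unique L)
  ; sound = EdgeList.sound L ∘ ↭⇒∈ (↭-sym p)
  ; complete = ↭⇒∈ p ∘ EdgeList.complete L
  }

edge-first : {E : List ℕ} {e : ℕ} → e ∈ E → ∃ λ E′ → E ↭ e ∷ E′
edge-first m with ∈-∃++ m
... | E₁ , E₂ , refl = E₁ ++ E₂ , Permₚ.shift _ E₁ E₂

EdgeList-app : ∀ {e E G} (pG : Proper G) (L : EdgeList (e ∷ E) G) o → EdgeList E (app o e G)
EdgeList-app {e} {E} {G} pG L o = record
  { unique = AllPairs.tail (EdgeList.unique L)
  ; sound = λ m → app-edge pG (EdgeList.sound L (here refl)) o (λ i → All.lookup (AllPairs.head (EdgeList.unique L)) m (sym i)) (EdgeList.sound L (there m))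
  ; complete = complete
  }
  where
  complete : ∀ {p} → p ∈ points (app o e G) → plab p ∈ E
  complete m with Cutting.Removes.only (EdgeOps.app-removes G pG e (EdgeList.sound L (here refl)) o) m
  ... | k , un with EdgeList.complete L k
  ... | here refl = ⊥-elim (true≢false (trans (sym (≡ᵇ-refl e)) un))
  ... | there j = j

-- `Qhat` is given one unit of fuel per arrow, and there are at least as many arrows as edges.
EdgeList-length : ∀ {E G} → EdgeList E G → length E ≤ length (entries G)
EdgeList-length {E} {G} L = subst (length E ≤_) (Listₚ.length-map lab (entries G))
  (pigeonhole _≡_ _≡_ (λ i j → trans i (sym j)) E (labs G) (EdgeList.unique L)
    (λ m → _ , ∈-labs {G} (EdgeList.sound L m) , refl))

-- Making labels disjoint

∈-≤max : ∀ xs {x} → x ∈ xs → x ≤ List.foldr ℕ._⊔_ 0 xs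
∈-≤max (x ∷ xs) (here refl) = ℕₚ.m≤m⊔n x _
∈-≤max (x ∷ xs) (there m) = ℕₚ.≤-trans (∈-≤max xs m) (ℕₚ.m≤n⊔m x _)

beyond : ∀ {a b m} → a ≤ m → a ≢ b ℕ.+ suc m
beyond {a} {b} {m} le refl = ℕₚ.<⇒≱ (ℕₚ.m≤n+m (suc m) b) le

shift-proper : ∀ off {H} → Proper H → Proper (shift off H)
shift-proper off {H} pH = record
  { unique = subst Unique (sym (points-shift off H)) (Uniqueₚ.map⁺ inj (Proper.unique pH))
  ; full = full
  }
  where
  inj : ∀ {p q} → shiftPt off p ≡ shiftPt off q → p ≡ q
  inj {p} {q} i = trans (sym (unshift-shift off p)) (trans (cong (unshiftPt off) i) (unshift-shift off q))
  full : ∀ {p} → p ∈ points (shift off H) → ∀ s h → pt (plab p) s h ∈ points (shift off H)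
  full m s h with ∈-map⁻ (shiftPt off) (subst (_ ∈_) (points-shift off H) m)
  ... | q , q∈ , refl = subst (_ ∈_) (sym (points-shift off H)) (∈-map⁺ (shiftPt off) (Proper.full pH q∈ s h))

shift-edge : ∀ off {H e} → IsEdge H e → IsEdge (shift off H) (e ℕ.+ off)
shift-edge off {H} m = subst (_ ∈_) (sym (points-shift off H)) (∈-map⁺ (shiftPt off) m)

EdgeList-shift : ∀ off {E H} → EdgeList E H → EdgeList (map (ℕ._+ off) E) (shift off H)
EdgeList-shift off {E} {H} L = record
  { unique = Uniqueₚ.map⁺ (ℕₚ.+-cancelʳ-≡ off _ _) (EdgeList.unique L)
  ; sound = sound
  ; complete = complete
  }
  where
  sound : ∀ {l} → l ∈ map (ℕ._+ off) E → IsEdge (shift off H) l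
  sound m with ∈-map⁻ _ m
  ... | l , l∈ , refl = shift-edge off {H} (EdgeList.sound L l∈)
  complete : ∀ {p} → p ∈ points (shift off H) → plab p ∈ map (ℕ._+ off) E
  complete m with ∈-map⁻ (shiftPt off) (subst (_ ∈_) (points-shift off H) m)
  ... | q , q∈ , refl = ∈-map⁺ _ (EdgeList.complete L q∈)

shift-disjoint : ∀ G H → Disjoint G (shift (suc (maxLab G)) H)
shift-disjoint G H = pointwise , labelwise
  where
  pointwise : ∀ {p q} → p ∈ points G → q ∈ points (shift (suc (maxLab G)) H) → plab p ≢ plab q
  pointwise m k with ∈-map⁻ _ (subst (_ ∈_) (points-shift (suc (maxLab G)) H) k)
  ... | q , _ , refl = beyond (∈-≤max (map proj₁ G ++ labs G) (∈-++⁺ʳ (map proj₁ G) (∈-labs {G} m)))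
  labelwise : ∀ {c d} → c ∈ G → d ∈ shift (suc (maxLab G)) H → proj₁ c ≢ proj₁ d
  labelwise m k with ∈-map⁻ _ k
  ... | d , _ , refl = beyond (∈-≤max (map proj₁ G ++ labs G) (∈-++⁺ˡ (∈-map⁺ proj₁ m)))

EdgeList-twoSum : ∀ {G H E F f e φ} (pG : Proper G) (pH : Proper H) (dis : Disjoint G H)
  (L : EdgeList (f ∷ E) G) (L′ : EdgeList (e ∷ F) H) → EdgeList (E ++ F) (twoSum G H f e φ)
EdgeList-twoSum {G} {H} {E} {F} {f} {e} {φ} pG pH dis L L′ = record
  { unique = Unique-++⁺ (AllPairs.tail (EdgeList.unique L)) (AllPairs.tail (EdgeList.unique L′))
      (λ m k → proj₁ dis (EdgeList.sound L (there m)) (EdgeList.sound L′ (there k)) refl)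
  ; sound = sound
  ; complete = complete
  }
  where
  module T = TwoSum G H pG pH dis f e φ (EdgeList.sound L (here refl)) (EdgeList.sound L′ (here refl))
  off : ∀ {l} → l ≢ f → l ≢ e → T.r l ≡ false
  off n n′ rewrite ≡ᵇ-false n | ≡ᵇ-false n′ = refl
  sound : ∀ {l} → l ∈ E ++ F → IsEdge (twoSum G H f e φ) l
  sound m with ∈-++⁻ E m
  ... | inj₁ k = T.R.Removes.keeps T.twoSum-removes (T.G⊆ (EdgeList.sound L (there k)))
      (off (λ { refl → All.lookup (AllPairs.head (EdgeList.unique L)) k refl })
           (proj₁ dis (EdgeList.sound L (there k)) (EdgeList.sound L′ (here refl))))
  ... | inj₂ k = T.R.Removes.keeps T.twoSum-removes (T.H⊆ (EdgeList.sound L′ (there k)))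
      (off (λ i → proj₁ dis (EdgeList.sound L (here refl)) (EdgeList.sound L′ (there k)) (sym i))
           (λ { refl → All.lookup (AllPairs.head (EdgeList.unique L′)) k refl }))
  complete : ∀ {p} → p ∈ points (twoSum G H f e φ) → plab p ∈ E ++ F
  complete {p} m with T.R.Removes.only T.twoSum-removes m
  ... | k , un with ∈-++⁻ (points G) (subst (_ ∈_) (points-++ G) k)
  ... | inj₁ j with EdgeList.complete L j
  ... | here refl = ⊥-elim (true≢false (trans (sym (T.marked-f false false)) un))
  ... | there i = ∈-++⁺ˡ i
  complete {p} m | k , un | inj₂ j with EdgeList.complete L′ j
  ... | here refl = ⊥-elim (true≢false (trans (sym (T.marked-e false false)) un))
  ... | there i = ∈-++⁺ʳ E i

-- The counts of a presentation in a given state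

circles# blocks# : VPAP → State → ℕ
circles# G σ = curveCount G (stateMatching σ)
blocks# G σ = blockCount G (stateJoins σ)

module StateMatching = Additive (λ z → matching (proj₂ z) (proj₁ z)) stateMatching refl (λ _ _ → refl)
open StateMatching using () renaming (↭-hom to stateMatching-↭; ++-hom to stateMatching-++)

module StateJoins = Additive (λ z → joins (proj₂ z) (proj₁ z)) stateJoins refl (λ _ _ → refl)
open StateJoins using () renaming (↭-hom to stateJoins-↭; ++-hom to stateJoins-++)

matching-perm : ∀ G {M M′} → M ↭ M′ → curveCount G M ≡ curveCount G M′
matching-perm G p = cong (empties G ℕ.+_) (curves-↭ ↭-refl p)

joins-perm : ∀ G {J J′} → J ↭ J′ → blockCount G J ≡ blockCount G J′
joins-perm G {J} {J′} p = comps-cong _≟N_ (link ∘ ↭⇒∈ q) (link ∘ ↭⇒∈ (↭-sym q)) id id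
  where
  q : blockGraph G J ↭ blockGraph G J′
  q = Permₚ.++⁺ˡ (blockLinks G) (Permₚ.map⁺ _ p)

circles#-↭ : ∀ G {σ τ} → σ ↭ τ → circles# G σ ≡ circles# G τ
circles#-↭ G p = matching-perm G (stateMatching-↭ p)

blocks#-↭ : ∀ G {σ τ} → σ ↭ τ → blocks# G σ ≡ blocks# G τ
blocks#-↭ G p = joins-perm G (stateJoins-↭ p)

shiftState : ℕ → State → State
shiftState off = map (λ z → proj₁ z ℕ.+ off , proj₂ z)

stateMatching-shift : ∀ off σ → stateMatching (shiftState off σ) ≡ mapLinks (shiftPt off) (stateMatching σ)
stateMatching-shift off [] = refl
stateMatching-shift off ((e , o) ∷ σ) = trans (cong₂ _++_ (matching-shift off o e) (stateMatching-shift off σ))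
  (sym (Listₚ.map-++ _ (matching o e) (stateMatching σ)))

stateJoins-shift : ∀ off σ → stateJoins (shiftState off σ) ≡ mapLinks (shiftPt off) (stateJoins σ)
stateJoins-shift off [] = refl
stateJoins-shift off ((e , o) ∷ σ) = trans (cong₂ _++_ (joins-shift off o e) (stateJoins-shift off σ))
  (sym (Listₚ.map-++ _ (joins o e) (stateJoins σ)))

circles#-shift : ∀ off G σ → circles# (shift off G) (shiftState off σ) ≡ circles# G σ
circles#-shift off G σ = trans (cong (curveCount (shift off G)) (stateMatching-shift off σ)) (curveCount-shift off G (stateMatching σ))

blocks#-shift : ∀ off G σ → blocks# (shift off G) (shiftState off σ) ≡ blocks# G σ
blocks#-shift off G σ = trans (cong (blockCount (shift off G)) (stateJoins-shift off σ)) (blockCount-shift off G (stateJoins σ))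

opaque
  unfolding curves Components.comps

  curves-[] : curves [] [] ≡ 0
  curves-[] = refl

edgeless-circles : ∀ G → points G ≡ [] → circles# G [] ≡ numVertices G
edgeless-circles G none = trans (cong₂ ℕ._+_ (all G none) (trans (cong (λ z → curves z []) (no-arcs G none)) curves-[])) (ℕₚ.+-identityʳ _)
  where
  all : ∀ G → points G ≡ [] → empties G ≡ length G
  all [] e = refl
  all ((l , []) ∷ G) e = cong suc (all G e)
  no-arcs : ∀ G → points G ≡ [] → arcs G ≡ []
  no-arcs [] e = refl
  no-arcs ((l , []) ∷ G) e = no-arcs G e

edgeless-blocks : ∀ G → points G ≡ [] → blocks# G [] ≡ numBlocks G
edgeless-blocks G none = trans (Components.comps-unique _≟N_ {rs = map inj₁ ls} record
    { separated = AllPairsₚ.map⁺ (AllPairs.map (λ n r → n (Sumₚ.inj₁-injective (∼-fold (isEquivalence {A = Node}) (λ m → ⊥-elim (no-edge (blockEdge G m))) r)))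
        (UniqueDecₚ.deduplicate-! ℕₚ._≟_ (map proj₁ G)))
    ; from = from ; cover = cover }) (Listₚ.length-map inj₁ ls)
  where
  ls : List ℕ
  ls = deduplicate ℕₚ._≟_ (map proj₁ G)
  no-edge : ∀ {x y} → ¬ BlockEdge G [] x y
  no-edge (inside c∈ p∈) with subst (_ ∈_) none (∈-points⁺ c∈ p∈)
  ... | ()
  from : ∀ {r} → r ∈ map inj₁ ls → ∃ λ x → x ∈ labels G × r ∼[ blockGraph G [] ] x
  from m with ∈-map⁻ inj₁ m
  ... | l , l∈ , refl with ∈-map⁻ proj₁ (∈-deduplicate⁻ ℕₚ._≟_ (map proj₁ G) l∈)
  ... | c , c∈ , refl = _ , ∈-map⁺ _ c∈ , ε
  cover : ∀ {x} → x ∈ labels G → ∃ λ r → r ∈ map inj₁ ls × x ∼[ blockGraph G [] ] r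
  cover m with ∈-map⁻ _ m
  ... | c , c∈ , refl = _ , ∈-map⁺ inj₁ (∈-deduplicate⁺ ℕₚ._≟_ (∈-map⁺ proj₁ c∈)) , ε

app-circles# : ∀ {e E G} (pG : Proper G) (L : EdgeList (e ∷ E) G) o {σ} → support σ ≡ E → circles# (app o e G) σ ≡ circles# G ((e , o) ∷ σ)
app-circles# {e} {G = G} pG L o {σ} refl = EdgeOps.app-curveCount G pG e (EdgeList.sound L (here refl)) o
  (subst (λ z → Unique (flat z)) (Listₚ.++-identityʳ _) (Unique-state σ {[]} (AllPairs.tail (EdgeList.unique L)) [] λ ()))
  (Off-state σ (∉-support (AllPairs.head (EdgeList.unique L))))

app-blocks# : ∀ {e E G} (pG : Proper G) (L : EdgeList (e ∷ E) G) o {σ} → support σ ≡ E → blocks# (app o e G) σ ≡ blocks# G ((e , o) ∷ σ)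
app-blocks# {e} {G = G} pG L o {σ} refl = EdgeOps.app-blockCount G pG e (EdgeList.sound L (here refl)) o
  (Off-stateJ σ (∉-support (AllPairs.head (EdgeList.unique L))))

-- A state of all edges but `e` leaves a one-edge presentation, to which `classify` applies. Its
-- `type`, `m` and `n` are fixed before any `G` is chosen, and this makes the coefficients
-- independent of `G`.
module Residue {e : ℕ} {E : List ℕ} {H : VPAP} (pH : Proper H) (L : EdgeList (e ∷ E) H) {σ : State} (sup : support σ ≡ E) where
  private
    uσ : Unique (support σ)
    uσ = subst Unique (sym sup) (AllPairs.tail (EdgeList.unique L))
    esσ : ∀ {l} → l ∈ support σ → IsEdge H l
    esσ m = EdgeList.sound L (there (subst (_ ∈_) sup m))
    e∉ : e ∉ support σ
    e∉ m = ∉-support (AllPairs.head (EdgeList.unique L)) (subst (_ ∈_) sup m)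
    e-off : ∀ o → OffAll (support σ) (matching o e)
    e-off o m k = e∉ (subst (_∈ support σ) (flat-matching o e m) k)
    e-offJ : ∀ o → OffAll (support σ) (joins o e)
    e-offJ o m k = e∉ (subst (_∈ support σ) (flat-joins o e m) k)

  residue : VPAP
  residue = reduce σ H

  classified : Classified residue e
  classified = classify (reduce-proper σ pH uσ esσ) (reduce-keeps σ pH uσ esσ (EdgeList.sound L (here refl)) e∉) only
    where
    only : ∀ {p} → p ∈ points residue → plab p ≡ e
    only m with reduce-points σ pH uσ esσ m
    ... | k , n with EdgeList.complete L k
    ... | here i = i
    ... | there j = ⊥-elim (n (subst (_ ∈_) (sym sup) j))

  open Classified classified public

  residue-circles# : ∀ o → circles# H ((e , o) ∷ σ) ≡ m ℕ.+ loops type o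
  residue-circles# o = trans (matching-perm H (Permₚ.++-comm (matching o e) (stateMatching σ)))
    (trans (sym (reduce-curveCount σ {M₀ = matching o e} pH uσ esσ (Unique-matching o e) (e-off o))) (self-curveCount o))

  residue-blocks# : ∀ o → blocks# H ((e , o) ∷ σ) ≡ n ℕ.+ blocks type o
  residue-blocks# o = trans (joins-perm H (Permₚ.++-comm (joins o e) (stateJoins σ)))
    (trans (sym (reduce-blockCount σ {J₀ = joins o e} pH uσ esσ (e-offJ o))) (self-blockCount o))

  module _ {G : VPAP} {f : ℕ} {F : List ℕ} {φ : Coupling} (pG : Proper G) (K : EdgeList (f ∷ F) G) (dis : Disjoint G H) {τ : State} (supτ : support τ ≡ F) where
    private
      f∈ : IsEdge G f
      f∈ = EdgeList.sound K (here refl)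
      module T = TwoSum G H pG pH dis f e φ f∈ (EdgeList.sound L (here refl))
      uτ : Unique (support τ)
      uτ = subst Unique (sym supτ) (AllPairs.tail (EdgeList.unique K))
      τ-edge : ∀ {l} → l ∈ support τ → IsEdge G l
      τ-edge k = EdgeList.sound K (there (subst (_ ∈_) supτ k))
      f∉τ : f ∉ support τ
      f∉τ k = ∉-support (AllPairs.head (EdgeList.unique K)) (subst (_ ∈_) supτ k)
      e∉τ : e ∉ support τ
      e∉τ k = proj₁ dis (τ-edge k) (EdgeList.sound L (here refl)) refl
      f∉σ : f ∉ support σ
      f∉σ k = proj₁ dis f∈ (esσ k) refl
      apart : ∀ {l} → l ∈ support τ → l ∉ support σ
      apart k j = proj₁ dis (τ-edge k) (esσ j) refl
      uM : Unique (flat (stateMatching τ))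
      uM = subst (λ z → Unique (flat z)) (Listₚ.++-identityʳ _) (Unique-state τ {[]} uτ [] λ ())
      supp-++ : support (τ ++ σ) ≡ support τ ++ support σ
      supp-++ = Listₚ.map-++ proj₁ τ σ
      off-++ : ∀ {l} → l ∉ support τ → l ∉ support σ → l ∉ support (τ ++ σ)
      off-++ n n′ k = [ n , n′ ]′ (∈-++⁻ (support τ) (subst (_ ∈_) supp-++ k))
      dis′ : Disjoint G residue
      dis′ = proj₂ (reduce-++ σ pH dis uσ esσ)
      K-edges : ∀ {l} → l ∈ support σ → IsEdge (G ++ H) l
      K-edges k = T.H⊆ (esσ k)
      ext : List (Pt × Pt)
      ext = sumMatching f e φ ++ stateMatching τ
      sum-lab : ∀ {p} → p ∈ flat (sumMatching f e φ) → plab p ≡ f ⊎ plab p ≡ e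
      sum-lab = All.lookup {P = λ p → plab p ≡ f ⊎ plab p ≡ e}
        (inj₁ refl ∷ inj₂ refl ∷ inj₁ refl ∷ inj₂ refl ∷ inj₁ refl ∷ inj₂ refl ∷ inj₁ refl ∷ inj₂ refl ∷ [])
      sumJ-lab : ∀ {p} → p ∈ flat (sumJoins f e φ) → plab p ≡ f ⊎ plab p ≡ e
      sumJ-lab = All.lookup {P = λ p → plab p ≡ f ⊎ plab p ≡ e} (inj₁ refl ∷ inj₂ refl ∷ inj₁ refl ∷ inj₂ refl ∷ [])
      fe∉ : ∀ {E l} → f ∉ E → e ∉ E → l ≡ f ⊎ l ≡ e → l ∉ E
      fe∉ nf ne (inj₁ refl) = nf
      fe∉ nf ne (inj₂ refl) = ne
      uSum : Unique (flat (sumMatching f e φ))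
      uSum = go φ
        where
        fe : ∀ {s h s′ h′} → pt f s h ≢ pt e s′ h′
        fe i = T.f≢e (cong plab i)
        ef : ∀ {s h s′ h′} → pt e s h ≢ pt f s′ h′
        ef i = T.f≢e (sym (cong plab i))
        go : ∀ φ → Unique (flat (sumMatching f e φ))
        go false = (fe ∷ (λ ()) ∷ fe ∷ (λ ()) ∷ fe ∷ (λ ()) ∷ fe ∷ []) ∷ (ef ∷ (λ ()) ∷ ef ∷ (λ ()) ∷ ef ∷ (λ ()) ∷ [])
          ∷ (fe ∷ (λ ()) ∷ fe ∷ (λ ()) ∷ fe ∷ []) ∷ (ef ∷ (λ ()) ∷ ef ∷ (λ ()) ∷ []) ∷ (fe ∷ (λ ()) ∷ fe ∷ []) ∷ (ef ∷ (λ ()) ∷ [])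
          ∷ (fe ∷ []) ∷ [] ∷ []
        go true = (fe ∷ (λ ()) ∷ fe ∷ (λ ()) ∷ fe ∷ (λ ()) ∷ fe ∷ []) ∷ (ef ∷ (λ ()) ∷ ef ∷ (λ ()) ∷ ef ∷ (λ ()) ∷ [])
          ∷ (fe ∷ (λ ()) ∷ fe ∷ (λ ()) ∷ fe ∷ []) ∷ (ef ∷ (λ ()) ∷ ef ∷ (λ ()) ∷ []) ∷ (fe ∷ (λ ()) ∷ fe ∷ []) ∷ (ef ∷ (λ ()) ∷ [])
          ∷ (fe ∷ []) ∷ [] ∷ []
      uExt : Unique (flat ext)
      uExt = subst Unique (sym (flat-++ (sumMatching f e φ) (stateMatching τ)))
        (Unique-++⁺ uSum uM (λ k j → fe∉ f∉τ e∉τ (sum-lab k) (flat-stateMatching τ j)))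
      extOff : OffAll (support σ) ext
      extOff {p} k with ∈-++⁻ (flat (sumMatching f e φ)) (subst (p ∈_) (flat-++ (sumMatching f e φ) (stateMatching τ)) k)
      ... | inj₁ j = fe∉ f∉σ e∉ (sum-lab j)
      ... | inj₂ j = apart (flat-stateMatching τ j)
      extJ : List (Pt × Pt)
      extJ = sumJoins f e φ ++ stateJoins τ
      extJOff : OffAll (support σ) extJ
      extJOff {p} k with ∈-++⁻ (flat (sumJoins f e φ)) (subst (p ∈_) (flat-++ (sumJoins f e φ) (stateJoins τ)) k)
      ... | inj₁ j = fe∉ f∉σ e∉ (sumJ-lab j)
      ... | inj₂ j = apart (flat-stateJoins τ j)
      uAll : Unique (flat (stateMatching (τ ++ σ)))
      uAll = subst (λ z → Unique (flat z)) (Listₚ.++-identityʳ _) (Unique-state (τ ++ σ) {[]}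
        (subst Unique (sym supp-++) (Unique-++⁺ uτ uσ apart)) [] λ ())

    -- The gluing of the 2-sum becomes one more pending matching on the disjoint union. Hence `σ`
    -- may be performed before it, acting on `H` alone, and what is finally summed into `f` is the
    -- residue.
    sum-circles# : circles# (twoSum G H f e φ) (τ ++ σ) ≡ m ℕ.+ circles# G ((f , type) ∷ τ)
    sum-circles# = begin
      curveCount (twoSum G H f e φ) (stateMatching (τ ++ σ))
        ≡⟨ T.twoSum-curveCount uAll (Off-state (τ ++ σ) (off-++ f∉τ f∉σ)) (Off-state (τ ++ σ) (off-++ e∉τ e∉)) ⟩
      curveCount (G ++ H) (sumMatching f e φ ++ stateMatching (τ ++ σ))
        ≡⟨ matching-perm (G ++ H) (↭-trans (Permₚ.++⁺ˡ (sumMatching f e φ) (Perm.↭-reflexive (stateMatching-++ τ)))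
             (solve 3 (λ a b c → (a ⊕ (b ⊕ c)) ⊜ (c ⊕ (a ⊕ b))) ↭-refl (sumMatching f e φ) (stateMatching τ) (stateMatching σ))) ⟩
      curveCount (G ++ H) (stateMatching σ ++ ext)
        ≡⟨ sym (reduce-curveCount σ {M₀ = ext} T.pK uσ K-edges uExt (λ {p} → extOff {p})) ⟩
      curveCount (reduce σ (G ++ H)) ext
        ≡⟨ cong (λ X → curveCount X ext) (proj₁ (reduce-++ σ pH dis uσ esσ)) ⟩
      curveCount (G ++ residue) ext
        ≡⟨ sum-curveCount {G} {f} {φ} pG dis′ f∈ (Off-state τ e∉τ) ⟩
      m ℕ.+ curveCount G (matching type f ++ stateMatching τ) ∎
      where open ≡-Reasoning

    sum-blocks# : blocks# (twoSum G H f e φ) (τ ++ σ) ≡ n ℕ.+ blocks# G ((f , type) ∷ τ)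
    sum-blocks# = begin
      blockCount (twoSum G H f e φ) (stateJoins (τ ++ σ))
        ≡⟨ T.twoSum-blockCount (Off-stateJ (τ ++ σ) (off-++ f∉τ f∉σ)) (Off-stateJ (τ ++ σ) (off-++ e∉τ e∉)) ⟩
      blockCount (G ++ H) (sumJoins f e φ ++ stateJoins (τ ++ σ))
        ≡⟨ joins-perm (G ++ H) (↭-trans (Permₚ.++⁺ˡ (sumJoins f e φ) (Perm.↭-reflexive (stateJoins-++ τ)))
             (solve 3 (λ a b c → (a ⊕ (b ⊕ c)) ⊜ (c ⊕ (a ⊕ b))) ↭-refl (sumJoins f e φ) (stateJoins τ) (stateJoins σ))) ⟩
      blockCount (G ++ H) (stateJoins σ ++ extJ)
        ≡⟨ sym (reduce-blockCount σ {J₀ = extJ} T.pK uσ K-edges (λ {p} → extJOff {p})) ⟩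
      blockCount (reduce σ (G ++ H)) extJ
        ≡⟨ cong (λ X → blockCount X extJ) (proj₁ (reduce-++ σ pH dis uσ esσ)) ⟩
      blockCount (G ++ residue) extJ
        ≡⟨ sum-blockCount {G} {f} {φ} pG dis′ f∈ (Off-stateJ τ e∉τ) ⟩
      n ℕ.+ blockCount G (joins type f ++ stateJoins τ) ∎
      where open ≡-Reasoning

-- State sums

firstEdge-nothing : ∀ G → firstEdge G ≡ nothing → points G ≡ []
firstEdge-nothing G eq = trans (points-entries G) (cong pts (go eq))
  where
  go : firstEdge G ≡ nothing → entries G ≡ []
  go eq with entries G
  ... | [] = refl

firstEdge-just : ∀ G {e} → firstEdge G ≡ just e → e ∈ labs G
firstEdge-just G eq with entries G
firstEdge-just G refl | x ∷ E = here refl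

no-edges : ∀ {E G} → points G ≡ [] → EdgeList E G → E ≡ []
no-edges {[]} none L = refl
no-edges {l ∷ E} none L with subst (_ ∈_) none (EdgeList.sound L (here refl))
... | ()

module StateSums {ℓ₁ ℓ₂ : Level} (R : CommutativeRing ℓ₁ ℓ₂) where
  open CommutativeRing R using (_+_; _*_; 0#; 1#; _≈_; +-cong; *-cong; *-congˡ; *-congʳ; *-comm; *-assoc; *-identityˡ;
    commutativeSemiring; reflexive)
    renaming (Carrier to K; refl to ≈-refl; sym to ≈-sym; trans to ≈-trans; setoid to K-setoid)
  open QhatDef R using (pow; base; Qfuel; Qhat; IsSolution)
  open RingSolver commutativeSemiring using (_:=_; _:+_; _:*_) renaming (solve to ring; con to num)
  open import Relation.Binary.Reasoning.Setoid K-setoid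

  opaque
    Σop : (Op → K) → K
    Σop f = f del + f con + f pen + f mdel

    Σop-unfold : ∀ f → Σop f ≈ f del + f con + f pen + f mdel
    Σop-unfold f = ≈-refl

    Σop-cong : ∀ {f g} → (∀ o → f o ≈ g o) → Σop f ≈ Σop g
    Σop-cong h = +-cong (+-cong (+-cong (h del) (h con)) (h pen)) (h mdel)

    Σop-+ : ∀ f g → Σop (λ o → f o + g o) ≈ Σop f + Σop g
    Σop-+ f g = ring 8 (λ a b c d a′ b′ c′ d′ → (a :+ a′) :+ (b :+ b′) :+ (c :+ c′) :+ (d :+ d′) := (a :+ b :+ c :+ d) :+ (a′ :+ b′ :+ c′ :+ d′))
      ≈-refl (f del) (f con) (f pen) (f mdel) (g del) (g con) (g pen) (g mdel)

    Σop-*ˡ : ∀ k f → k * Σop f ≈ Σop (λ o → k * f o)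
    Σop-*ˡ k f = ring 5 (λ k a b c d → k :* (a :+ b :+ c :+ d) := k :* a :+ k :* b :+ k :* c :+ k :* d)
      ≈-refl k (f del) (f con) (f pen) (f mdel)

    Σop-swap : ∀ (f : Op → Op → K) → Σop (λ o → Σop (f o)) ≈ Σop (λ p → Σop (λ o → f o p))
    Σop-swap f = ≈-sym (≈-trans (Σop-+ (λ p → f del p + f con p + f pen p) (f mdel))
      (+-cong (≈-trans (Σop-+ (λ p → f del p + f con p) (f pen)) (+-cong (Σop-+ (f del) (f con)) ≈-refl)) ≈-refl))

  Weight : Set ℓ₁
  Weight = ℕ → Op → K

  ΣS : Weight → List ℕ → (State → K) → K
  ΣS w [] F = F []
  ΣS w (e ∷ E) F = Σop (λ o → w e o * ΣS w E (λ σ → F ((e , o) ∷ σ)))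

  ΣS-cong : ∀ {w} E {F F′} → (∀ σ → support σ ≡ E → F σ ≈ F′ σ) → ΣS w E F ≈ ΣS w E F′
  ΣS-cong [] h = h [] refl
  ΣS-cong (e ∷ E) h = Σop-cong (λ o → *-congˡ (ΣS-cong E (λ σ s → h ((e , o) ∷ σ) (cong (e ∷_) s))))

  ΣS-weights : ∀ {w w′} E {F} → (∀ {l} → l ∈ E → ∀ o → w l o ≈ w′ l o) → ΣS w E F ≈ ΣS w′ E F
  ΣS-weights [] h = ≈-refl
  ΣS-weights (e ∷ E) h = Σop-cong (λ o → *-cong (h (here refl) o) (ΣS-weights E (h ∘ there)))

  ΣS-Σop : ∀ {w} E (F : Op → State → K) → ΣS w E (λ σ → Σop (λ t → F t σ)) ≈ Σop (λ t → ΣS w E (F t))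
  ΣS-Σop [] F = ≈-refl
  ΣS-Σop {w} (e ∷ E) F = begin
    Σop (λ o → w e o * ΣS w E (λ σ → Σop (λ t → F t ((e , o) ∷ σ))))
      ≈⟨ Σop-cong (λ o → ≈-trans (*-congˡ (ΣS-Σop E (λ t σ → F t ((e , o) ∷ σ)))) (Σop-*ˡ (w e o) _)) ⟩
    Σop (λ o → Σop (λ t → w e o * ΣS w E (λ σ → F t ((e , o) ∷ σ))))
      ≈⟨ Σop-swap _ ⟩
    Σop (λ t → ΣS w (e ∷ E) (F t)) ∎

  ΣS-*ˡ : ∀ {w} E k F → ΣS w E (λ σ → k * F σ) ≈ k * ΣS w E F
  ΣS-*ˡ [] k F = ≈-refl
  ΣS-*ˡ {w} (e ∷ E) k F = ≈-trans (Σop-cong (λ o → ≈-trans (*-congˡ (ΣS-*ˡ E k (λ σ → F ((e , o) ∷ σ))))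
      (ring 3 (λ a b c → a :* (b :* c) := b :* (a :* c)) ≈-refl (w e o) k (ΣS w E (λ σ → F ((e , o) ∷ σ))))))
    (≈-sym (Σop-*ˡ k _))

  ΣS-*ʳ : ∀ {w} E k F → ΣS w E (λ σ → F σ * k) ≈ ΣS w E F * k
  ΣS-*ʳ E k F = ≈-trans (ΣS-cong E (λ σ _ → *-comm (F σ) k)) (≈-trans (ΣS-*ˡ E k F) (*-comm k _))

  ΣS-++ : ∀ {w} E E′ F → ΣS w (E ++ E′) F ≈ ΣS w E (λ τ → ΣS w E′ (λ σ → F (τ ++ σ)))
  ΣS-++ [] E′ F = ≈-refl
  ΣS-++ (e ∷ E) E′ F = Σop-cong (λ o → *-congˡ (ΣS-++ E E′ (λ σ → F ((e , o) ∷ σ))))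

  ΣS-map : ∀ {u : Op → K} (g : ℕ → ℕ) E F →
    ΣS (λ _ → u) (map g E) F ≈ ΣS (λ _ → u) E (λ σ → F (map (λ z → g (proj₁ z) , proj₂ z) σ))
  ΣS-map g [] F = ≈-refl
  ΣS-map g (e ∷ E) F = Σop-cong (λ o → *-congˡ (ΣS-map g E (λ σ → F ((g e , o) ∷ σ))))

  -- A state lists its edges in the order of `E`, so exchanging two edges also permutes the argument
  -- of `F`; `inv` absorbs this.
  ΣS-↭ : ∀ {w E E′ F} → E ↭ E′ → (∀ {σ τ} → σ ↭ τ → F σ ≈ F τ) → ΣS w E F ≈ ΣS w E′ F
  ΣS-↭ Perm.refl inv = ≈-refl
  ΣS-↭ (Perm.prep e p) inv = Σop-cong (λ o → *-congˡ (ΣS-↭ p (λ q → inv (prep (e , o) q))))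
  ΣS-↭ {w} {F = F} (Perm.swap {xs} {ys} e f p) inv = begin
    Σop (λ o → w e o * Σop (λ q → w f q * ΣS w xs (λ σ → F ((e , o) ∷ (f , q) ∷ σ))))
      ≈⟨ Σop-cong (λ o → Σop-*ˡ (w e o) _) ⟩
    Σop (λ o → Σop (λ q → w e o * (w f q * ΣS w xs (λ σ → F ((e , o) ∷ (f , q) ∷ σ)))))
      ≈⟨ Σop-swap _ ⟩
    Σop (λ q → Σop (λ o → w e o * (w f q * ΣS w xs (λ σ → F ((e , o) ∷ (f , q) ∷ σ)))))
      ≈⟨ Σop-cong (λ q → Σop-cong (λ o → ≈-trans (exchange (w e o) (w f q) _)
           (*-congˡ (*-congˡ (≈-trans (ΣS-cong xs (λ σ _ → inv (Perm.swap (e , o) (f , q) ↭-refl)))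
             (ΣS-↭ p (λ r → inv (prep (f , q) (prep (e , o) r))))))))) ⟩
    Σop (λ q → Σop (λ o → w f q * (w e o * ΣS w ys (λ σ → F ((f , q) ∷ (e , o) ∷ σ)))))
      ≈⟨ Σop-cong (λ q → ≈-sym (Σop-*ˡ (w f q) _)) ⟩
    Σop (λ q → w f q * Σop (λ o → w e o * ΣS w ys (λ σ → F ((f , q) ∷ (e , o) ∷ σ)))) ∎
    where
    exchange : ∀ a b c → a * (b * c) ≈ b * (a * c)
    exchange = ring 3 (λ a b c → a :* (b :* c) := b :* (a :* c)) ≈-refl
  ΣS-↭ (Perm.trans p q) inv = ≈-trans (ΣS-↭ p inv) (ΣS-↭ q inv)

  pow-+ : ∀ z m n → pow z (m ℕ.+ n) ≈ pow z m * pow z n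
  pow-+ z zero n = ≈-sym (*-identityˡ _)
  pow-+ z (suc m) n = ≈-trans (*-congˡ (pow-+ z m n)) (≈-sym (*-assoc z _ _))

  weights : K → K → K → K → Op → K
  weights a b c x del = a
  weights a b c x con = b
  weights a b c x pen = c
  weights a b c x mdel = x

  -- The polynomial as a state sum

  module _ (α β : K) where

    value : VPAP → State → K
    value G σ = pow α (circles# G σ) * pow β (blocks# G σ)

    value-≡ : ∀ {G H σ τ} → circles# G σ ≡ circles# H τ → blocks# G σ ≡ blocks# H τ → value G σ ≈ value H τ
    value-≡ p q = reflexive (cong₂ (λ i j → pow α i * pow β j) p q)

    value-↭ : ∀ G {σ τ} → σ ↭ τ → value G σ ≈ value G τ
    value-↭ G {σ} {τ} p = value-≡ {G} {G} {σ} {τ} (circles#-↭ G p) (blocks#-↭ G p)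

    table : Op → Op → K
    table t o = pow α (loops t o) * pow β (blocks t o)

    module _ (a b c x : K) where

      u : Op → K
      u = weights a b c x

      -- Proved together with `app-sum`. The enumeration is arbitrary and `n` is only a bound,
      -- because the edges left after an operation are not enumerated in the order in which
      -- `firstEdge` will meet them.
      Qfuel-sum : ∀ n {E G} → Proper G → EdgeList E G → length E ≤ n → Qfuel a b c x α β n G ≈ ΣS (λ _ → u) E (value G)
      app-sum : ∀ n {e E G} → Proper G → EdgeList (e ∷ E) G → length E ≤ n → ∀ o →
        Qfuel a b c x α β n (app o e G) ≈ ΣS (λ _ → u) E (λ σ → value G ((e , o) ∷ σ))

      edgeless : ∀ {E G} → points G ≡ [] → EdgeList E G → base α β G ≈ ΣS (λ _ → u) E (value G)
      edgeless {E} {G} none L with no-edges {E} none L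
      ... | refl = reflexive (cong₂ (λ i j → pow α i * pow β j) (sym (edgeless-circles G none)) (sym (edgeless-blocks G none)))

      Qfuel-sum zero {[]} {G} pG L le = edgeless (no-points (points G) refl) L
        where
        no-points : ∀ ps → points G ≡ ps → ps ≡ []
        no-points [] _ = refl
        no-points (p ∷ ps) i with EdgeList.complete L (subst (p ∈_) (sym i) (here refl))
        ... | ()
      Qfuel-sum (suc n) {E} {G} pG L le with firstEdge G in eq
      ... | nothing = edgeless (firstEdge-nothing G eq) L
      ... | just e with edge-first (EdgeList.complete L (labs-edge pG (firstEdge-just G eq)))
      -- The edge chosen by `firstEdge` is moved to the front for one step of the recursion, and the
      -- sum is then put back into the order of `E`.
      ... | E′ , p = ≈-trans (≈-trans (≈-sym (Σop-unfold (λ o → u o * Qfuel a b c x α β n (app o e G)))) (Σop-cong (λ o → *-congˡ (app-sum n pG (EdgeList-↭ p L) (ℕₚ.≤-pred (subst (_≤ suc n) (Permₚ.↭-length p) le)) o))))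
          (ΣS-↭ (↭-sym p) (value-↭ G))

      app-sum n {e} {E} {G} pG L le o = ≈-trans
        (Qfuel-sum n (EdgeOps.app-proper G pG e (EdgeList.sound L (here refl)) o) (EdgeList-app pG L o) le)
        (ΣS-cong E (λ σ s → value-≡ {app o e G} {G} {σ} {(e , o) ∷ σ} (app-circles# pG L o s) (app-blocks# pG L o s)))

      Qhat-sum : ∀ {E G} → Proper G → EdgeList E G → Qhat a b c x α β G ≈ ΣS (λ _ → u) E (value G)
      Qhat-sum {E} {G} pG L = Qfuel-sum (length (entries G)) pG L (EdgeList-length L)

      Qhat-app : ∀ {e E G} → Proper G → EdgeList (e ∷ E) G → ∀ o →
        Qhat a b c x α β (app o e G) ≈ ΣS (λ _ → u) E (λ σ → value G ((e , o) ∷ σ))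
      Qhat-app {e} {E} {G} pG L o = app-sum (length (entries (app o e G))) pG L (EdgeList-length (EdgeList-app pG L o)) o

      -- Grouping the states of the edges of H other than e by the state which they induce along e.
      module Coefficients {e : ℕ} {E : List ℕ} {H : VPAP} (pH : Proper H) (L : EdgeList (e ∷ E) H) where

        module Res {σ : State} (s : support σ ≡ E) = Residue pH L {σ} s

        δ : Op → Op → K
        δ del del = 1#
        δ con con = 1#
        δ pen pen = 1#
        δ mdel mdel = 1#
        δ _ _ = 0#

        Σop-δ : ∀ t k (v : Op → K) → Σop (λ o → (δ t o * k) * v o) ≈ k * v t
        Σop-δ del k v = ≈-trans (Σop-unfold _) (ring 5 (λ k a b c d → (num 1 :* k) :* a :+ (num 0 :* k) :* b :+ (num 0 :* k) :* c :+ (num 0 :* k) :* d := k :* a) ≈-refl k (v del) (v con) (v pen) (v mdel))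
        Σop-δ con k v = ≈-trans (Σop-unfold _) (ring 5 (λ k a b c d → (num 0 :* k) :* a :+ (num 1 :* k) :* b :+ (num 0 :* k) :* c :+ (num 0 :* k) :* d := k :* b) ≈-refl k (v del) (v con) (v pen) (v mdel))
        Σop-δ pen k v = ≈-trans (Σop-unfold _) (ring 5 (λ k a b c d → (num 0 :* k) :* a :+ (num 0 :* k) :* b :+ (num 1 :* k) :* c :+ (num 0 :* k) :* d := k :* c) ≈-refl k (v del) (v con) (v pen) (v mdel))
        Σop-δ mdel k v = ≈-trans (Σop-unfold _) (ring 5 (λ k a b c d → (num 0 :* k) :* a :+ (num 0 :* k) :* b :+ (num 0 :* k) :* c :+ (num 1 :* k) :* d := k :* d) ≈-refl k (v del) (v con) (v pen) (v mdel))

        scale : ∀ {σ} → support σ ≡ E → K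
        scale s = pow α (Res.m s) * pow β (Res.n s)

        -- Contribution of one state to `A_t`: the monomial of the extra circles and blocks if the
        -- residue has type `t`, and zero otherwise. The residue exists only for states supported on
        -- `E`, so other states need a default value.
        coefficient : State → Op → K
        coefficient σ t with Listₚ.≡-dec ℕₚ._≟_ (support σ) E
        ... | yes s = δ (Res.type s) t * scale s
        ... | no _ = 0#

        -- The decision procedure yields its own proof of the support condition. Handing that proof
        -- on avoids comparing residues formed from two different proofs.
        coefficient-at : ∀ σ → support σ ≡ E → ∃ λ (s : support σ ≡ E) → ∀ t → coefficient σ t ≡ δ (Res.type s) t * scale s
        coefficient-at σ s with Listₚ.≡-dec ℕₚ._≟_ (support σ) E
        ... | yes s′ = s′ , λ t → refl
        ... | no n = ⊥-elim (n s)

        -- The `A_t`, candidates for the solution of the linear system.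
        total : Op → K
        total t = ΣS (λ _ → u) E (λ σ → coefficient σ t)

        spread : ∀ σ → support σ ≡ E → (v : Op → K) →
          ∃ λ (s : support σ ≡ E) → Σop (λ t → coefficient σ t * v t) ≈ scale s * v (Res.type s)
        spread σ s v with coefficient-at σ s
        ... | s′ , h = s′ , ≈-trans (Σop-cong (λ t → *-congʳ (reflexive (h t)))) (Σop-δ (Res.type s′) (scale s′) v)

        pull : ∀ {v : Op → K} {F} → (∀ σ → support σ ≡ E → F σ ≈ Σop (λ t → coefficient σ t * v t)) →
          ΣS (λ _ → u) E F ≈ Σop (λ t → total t * v t)
        pull {v} h = ≈-trans (ΣS-cong E h) (≈-trans (ΣS-Σop E (λ t σ → coefficient σ t * v t))
          (Σop-cong (λ t → ΣS-*ʳ E (v t) (λ σ → coefficient σ t))))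

        powers : ∀ m n i j → pow α (m ℕ.+ i) * pow β (n ℕ.+ j) ≈ (pow α m * pow β n) * (pow α i * pow β j)
        powers m n i j = ≈-trans (*-cong (pow-+ α m i) (pow-+ β n j))
          (ring 4 (λ a b c d → (a :* b) :* (c :* d) := (a :* c) :* (b :* d)) ≈-refl (pow α m) (pow α i) (pow β n) (pow β j))

        totals-solve : ∀ o → ΣS (λ _ → u) E (λ σ → value H ((e , o) ∷ σ)) ≈ Σop (λ t → total t * table t o)
        totals-solve o = pull at
          where
          at : ∀ σ → support σ ≡ E → value H ((e , o) ∷ σ) ≈ Σop (λ t → coefficient σ t * table t o)
          at σ s with spread σ s (λ t → table t o)
          ... | s′ , h = ≈-trans (reflexive (cong₂ (λ i j → pow α i * pow β j) (Res.residue-circles# s′ o) (Res.residue-blocks# s′ o)))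
            (≈-trans (powers (Res.m s′) (Res.n s′) _ _) (≈-sym h))

        -- The grouping of states is that of `totals-solve`, with the values of `G` in place of a
        -- column of the matrix. The weights `w` on the rest of `G` are free, since midway through
        -- the tensor product its edges carry two kinds of weights.
        totals-sum : ∀ {w G f F φ} (pG : Proper G) (N : EdgeList (f ∷ F) G) (dis : Disjoint G H) →
          ΣS w F (λ τ → ΣS (λ _ → u) E (λ σ → value (twoSum G H f e φ) (τ ++ σ)))
            ≈ Σop (λ t → total t * ΣS w F (λ τ → value G ((f , t) ∷ τ)))
        totals-sum {w} {G} {f} {F} {φ} pG N dis = begin
          ΣS w F (λ τ → ΣS (λ _ → u) E (λ σ → value (twoSum G H f e φ) (τ ++ σ)))
            ≈⟨ ΣS-cong F (λ τ r → pull (at τ r)) ⟩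
          ΣS w F (λ τ → Σop (λ t → total t * value G ((f , t) ∷ τ)))
            ≈⟨ ΣS-Σop F (λ t τ → total t * value G ((f , t) ∷ τ)) ⟩
          Σop (λ t → ΣS w F (λ τ → total t * value G ((f , t) ∷ τ)))
            ≈⟨ Σop-cong (λ t → ΣS-*ˡ F (total t) (λ τ → value G ((f , t) ∷ τ))) ⟩
          Σop (λ t → total t * ΣS w F (λ τ → value G ((f , t) ∷ τ))) ∎
          where
          at : ∀ τ → support τ ≡ F → ∀ σ → support σ ≡ E →
            value (twoSum G H f e φ) (τ ++ σ) ≈ Σop (λ t → coefficient σ t * value G ((f , t) ∷ τ))
          at τ r σ s with spread σ s (λ t → value G ((f , t) ∷ τ))
          ... | s′ , h = ≈-trans (reflexive (cong₂ (λ i j → pow α i * pow β j)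
              (Res.sum-circles# s′ {φ = φ} pG N dis r) (Res.sum-blocks# s′ {φ = φ} pG N dis r)))
            (≈-trans (powers (Res.m s′) (Res.n s′) _ _) (≈-sym h))

      -- Replacing the edges one after another

      module Tensor {H : VPAP} {e : ℕ} {E : List ℕ} (φ : ℕ → Coupling) (pH : Proper H) (L : EdgeList (e ∷ E) H) (ϕ : Op → K)
        (unique : ∀ ψ₂ ψp ψx ψ₁ → IsSolution a b c x α β H e ψ₂ ψp ψx ψ₁ →
          (ψ₂ ≈ ϕ del) × (ψp ≈ ϕ con) × (ψx ≈ ϕ pen) × (ψ₁ ≈ ϕ mdel)) where

        module _ (off : ℕ) where
          H′ : VPAP
          H′ = shift off H

          pH′ : Proper H′
          pH′ = shift-proper off pH

          L′ : EdgeList (e ℕ.+ off ∷ map (ℕ._+ off) E) H′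
          L′ = EdgeList-shift off L

          open Coefficients pH′ L′ public

          -- The coefficients belong to a renamed copy of `H`, whereas the system is stated for `H`;
          -- the counts are invariant under the renaming.
          solution : ∀ o → Σop (λ t → total t * table t o) ≈ Qhat a b c x α β (app o e H)
          solution o = ≈-sym (begin
            Qhat a b c x α β (app o e H)
              ≈⟨ Qhat-app pH L o ⟩
            ΣS (λ _ → u) E (λ σ → value H ((e , o) ∷ σ))
              ≈⟨ ΣS-cong E (λ σ _ → value-≡ {H} {H′} {(e , o) ∷ σ} {shiftState off ((e , o) ∷ σ)}
                   (sym (circles#-shift off H ((e , o) ∷ σ))) (sym (blocks#-shift off H ((e , o) ∷ σ)))) ⟩
            ΣS (λ _ → u) E (λ σ → value H′ (shiftState off ((e , o) ∷ σ)))
              ≈⟨ ≈-sym (ΣS-map (ℕ._+ off) E (λ σ → value H′ ((e ℕ.+ off , o) ∷ σ))) ⟩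
            ΣS (λ _ → u) (map (ℕ._+ off) E) (λ σ → value H′ ((e ℕ.+ off , o) ∷ σ))
              ≈⟨ totals-solve o ⟩
            Σop (λ t → total t * table t o) ∎)

          isSolution : IsSolution a b c x α β H e (total del) (total con) (total pen) (total mdel)
          isSolution =
              -- The right-hand side spells powers the way `pow` unfolds, a square being
              -- `z * (z * 1#)`. The square of β occurs only where `del` meets `del`: with all other
              -- pairs the two arrows end up in one block.
              ≈-trans (ring 6 (λ α β p q r s → (α :* β) :* ((α :* β) :* p :+ q :+ r :+ α :* s)
                := p :* ((α :* (α :* num 1)) :* (β :* (β :* num 1))) :+ q :* ((α :* num 1) :* (β :* num 1))
                  :+ r :* ((α :* num 1) :* (β :* num 1)) :+ s :* ((α :* (α :* num 1)) :* (β :* num 1))) ≈-refl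
                α β (total del) (total con) (total pen) (total mdel)) (≈-trans (≈-sym (Σop-unfold _)) (solution del))
            , ≈-trans (ring 6 (λ α β p q r s → (α :* β) :* (p :+ α :* q :+ r :+ s)
                := p :* ((α :* num 1) :* (β :* num 1)) :+ q :* ((α :* (α :* num 1)) :* (β :* num 1))
                  :+ r :* ((α :* num 1) :* (β :* num 1)) :+ s :* ((α :* num 1) :* (β :* num 1))) ≈-refl
                α β (total del) (total con) (total pen) (total mdel)) (≈-trans (≈-sym (Σop-unfold _)) (solution con))
            , ≈-trans (ring 6 (λ α β p q r s → (α :* β) :* (p :+ q :+ α :* r :+ s)
                := p :* ((α :* num 1) :* (β :* num 1)) :+ q :* ((α :* num 1) :* (β :* num 1))
                  :+ r :* ((α :* (α :* num 1)) :* (β :* num 1)) :+ s :* ((α :* num 1) :* (β :* num 1))) ≈-refl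
                α β (total del) (total con) (total pen) (total mdel)) (≈-trans (≈-sym (Σop-unfold _)) (solution pen))
            , ≈-trans (ring 6 (λ α β p q r s → (α :* β) :* (α :* p :+ q :+ r :+ α :* s)
                := p :* ((α :* (α :* num 1)) :* (β :* num 1)) :+ q :* ((α :* num 1) :* (β :* num 1))
                  :+ r :* ((α :* num 1) :* (β :* num 1)) :+ s :* ((α :* (α :* num 1)) :* (β :* num 1))) ≈-refl
                α β (total del) (total con) (total pen) (total mdel)) (≈-trans (≈-sym (Σop-unfold _)) (solution mdel))

          total≈ϕ : ∀ t → total t ≈ ϕ t
          total≈ϕ t = go t (unique (total del) (total con) (total pen) (total mdel) isSolution)
            where
            go : ∀ t → (total del ≈ ϕ del) × (total con ≈ ϕ con) × (total pen ≈ ϕ pen) × (total mdel ≈ ϕ mdel) → total t ≈ ϕ t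
            go del h = proj₁ h
            go con h = proj₁ (proj₂ h)
            go pen h = proj₁ (proj₂ (proj₂ h))
            go mdel h = proj₂ (proj₂ (proj₂ h))

        -- The edges still to be replaced by a copy of H carry the weights ϕ.
        opaque
          mixed : List ℕ → Weight
          mixed fs l with l ∈ℕ? fs
          ... | yes _ = ϕ
          ... | no _ = u

          mixed-∈ : ∀ {fs l} → l ∈ fs → ∀ o → mixed fs l o ≈ ϕ o
          mixed-∈ {fs} {l} m o with l ∈ℕ? fs
          ... | yes _ = ≈-refl
          ... | no n = ⊥-elim (n m)

          mixed-∉ : ∀ {fs l} → l ∉ fs → ∀ o → mixed fs l o ≈ u o
          mixed-∉ {fs} {l} n o with l ∈ℕ? fs
          ... | yes m = ⊥-elim (n m)
          ... | no _ = ≈-refl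

        mixed-∷ : ∀ {f fs l} → l ≢ f → ∀ o → mixed fs l o ≈ mixed (f ∷ fs) l o
        mixed-∷ {f} {fs} {l} n o = go (l ∈ℕ? fs)
          where
          go : Dec (l ∈ fs) → mixed fs l o ≈ mixed (f ∷ fs) l o
          go (yes m) = ≈-trans (mixed-∈ m o) (≈-sym (mixed-∈ (there m) o))
          go (no k) = ≈-trans (mixed-∉ k o) (≈-sym (mixed-∉ (λ { (here i) → n i ; (there m) → k m }) o))

        -- Stated for every intermediate presentation `X`. With nothing left to replace all weights
        -- are `u` and the sum is `Qhat` of `X`; going back over an edge `f` trades a copy of `H`
        -- for `f` itself with weights `ϕ`.
        fold-sum : ∀ fs {F X} → Proper X → EdgeList F X → Unique fs → (∀ {l} → l ∈ fs → l ∈ F) →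
          Qhat a b c x α β (foldl (tensorStep H e φ) X fs) ≈ ΣS (mixed fs) F (value X)
        fold-sum [] {F} pX N uf f⊆ = ≈-trans (Qhat-sum pX N) (ΣS-weights F (λ _ o → ≈-sym (mixed-∉ (λ ()) o)))
        fold-sum (f ∷ fs) {F} {X} pX N (f∉ ∷ uf) f⊆ with edge-first (f⊆ (here refl))
        ... | F′ , p = begin
          Qhat a b c x α β (foldl (tensorStep H e φ) X₁ fs)
            ≈⟨ fold-sum fs (TwoSum.twoSum-proper X (H′ off) pX (pH′ off) dis f (e ℕ.+ off) (φ f)
                 (EdgeList.sound N′ (here refl)) (EdgeList.sound (L′ off) (here refl)))
                 (EdgeList-twoSum pX (pH′ off) dis N′ (L′ off)) uf (∈-++⁺ˡ ∘ fs⊆) ⟩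
          ΣS (mixed fs) (F′ ++ map (ℕ._+ off) E) (value X₁)
            ≈⟨ ΣS-++ F′ (map (ℕ._+ off) E) (value X₁) ⟩
          ΣS (mixed fs) F′ (λ τ → ΣS (mixed fs) (map (ℕ._+ off) E) (λ σ → value X₁ (τ ++ σ)))
            -- The edges of the new copy are not among those still to be replaced, since their
            -- labels are disjoint from all labels of `X`; so they carry the original weights.
            ≈⟨ ΣS-cong F′ (λ τ _ → ΣS-weights (map (ℕ._+ off) E) (λ m → mixed-∉ (λ k →
                 proj₁ dis (EdgeList.sound N′ (there (fs⊆ k))) (EdgeList.sound (L′ off) (there m)) refl))) ⟩
          ΣS (mixed fs) F′ (λ τ → ΣS (λ _ → u) (map (ℕ._+ off) E) (λ σ → value X₁ (τ ++ σ)))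
            ≈⟨ totals-sum off {φ = φ f} pX N′ dis ⟩
          Σop (λ t → total off t * ΣS (mixed fs) F′ (λ τ → value X ((f , t) ∷ τ)))
            -- Uniqueness enters here, through `total≈ϕ`. The two weight functions agree away from
            -- `f`, and the sum over `t` is by definition the one that treats `f` as the first edge.
            ≈⟨ Σop-cong (λ t → *-cong (≈-trans (total≈ϕ off t) (≈-sym (mixed-∈ (here refl) t)))
                 (ΣS-weights F′ (λ m → mixed-∷ {f} {fs} (λ { refl → All.lookup (AllPairs.head (EdgeList.unique N′)) m refl })))) ⟩
          ΣS (mixed (f ∷ fs)) (f ∷ F′) (value X)
            ≈⟨ ΣS-↭ (↭-sym p) (value-↭ X) ⟩
          ΣS (mixed (f ∷ fs)) F (value X) ∎
          where
          off : ℕ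
          off = suc (maxLab X)
          X₁ : VPAP
          X₁ = tensorStep H e φ X f
          dis : Disjoint X (H′ off)
          dis = shift-disjoint X H
          N′ : EdgeList (f ∷ F′) X
          N′ = EdgeList-↭ p N
          fs⊆ : ∀ {l} → l ∈ fs → l ∈ F′
          fs⊆ m with ↭⇒∈ p (f⊆ (there m))
          ... | here refl = ⊥-elim (All.lookup f∉ m refl)
          ... | there k = k

    tensor-Qhat : ∀ {a b c x} {H e} (φ : ℕ → Coupling) {G} → Proper G → Proper H → IsEdge H e → (ϕ₂ ϕp ϕx ϕ₁ : K) →
      (∀ ψ₂ ψp ψx ψ₁ → IsSolution a b c x α β H e ψ₂ ψp ψx ψ₁ → (ψ₂ ≈ ϕ₂) × (ψp ≈ ϕp) × (ψx ≈ ϕx) × (ψ₁ ≈ ϕ₁)) →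
      Qhat a b c x α β (tensor G H e φ) ≈ Qhat ϕ₂ ϕp ϕx ϕ₁ α β G
    tensor-Qhat {a} {b} {c} {x} {H} {e} φ {G} pG pH e∈ ϕ₂ ϕp ϕx ϕ₁ unique
      with edge-first (EdgeList.complete (edges-list pH) e∈)
    ... | E , p = ≈-trans (T.fold-sum (edges G) pG L (EdgeList.unique L) id)
        (≈-trans (ΣS-weights (edges G) (λ m o → T.mixed-∈ m o)) (≈-sym (Qhat-sum ϕ₂ ϕp ϕx ϕ₁ pG L)))
      where
      module T = Tensor a b c x φ pH (EdgeList-↭ p (edges-list pH)) (weights ϕ₂ ϕp ϕx ϕ₁) unique
      L : EdgeList (edges G) G
      L = edges-list pG

open QhatDef using (Qhat; IsSolution)
open CommutativeRing using (Carrier; _≈_)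

theorem4p2 : ∀ {ℓ₁ ℓ₂ : Level} (R : CommutativeRing ℓ₁ ℓ₂)
    (G H : VPAP) (e : ℕ) (φ : ℕ → Coupling) →
    WF G → WF H → e ∈ labs H →
    (a b c x α β φ₂ φp φx φ₁ : Carrier R) →
    IsSolution R a b c x α β H e φ₂ φp φx φ₁ →
    (∀ ψ₂ ψp ψx ψ₁ → IsSolution R a b c x α β H e ψ₂ ψp ψx ψ₁ →
       (_≈_ R ψ₂ φ₂) × (_≈_ R ψp φp) × (_≈_ R ψx φx) × (_≈_ R ψ₁ φ₁)) →
    _≈_ R (Qhat R a b c x α β (tensor G H e φ)) (Qhat R φ₂ φp φx φ₁ α β G)
theorem4p2 R G H e φ wfG wfH e∈ a b c x α β φ₂ φp φx φ₁ _ unique =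
  StateSums.tensor-Qhat R α β {a} {b} {c} {x} {H} {e} φ {G} (WF⇒Proper wfG) (WF⇒Proper wfH) (labs-edge {H} (WF⇒Proper wfH) e∈) φ₂ φp φx φ₁ unique
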